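{- Let $N$ be a finite alphabet of node labels and $n\ge 0$. If a tree language $L\subseteq Tr(N,n)$ is the tree language of some tree abstract categorial grammar $G=(\Sigma,Tree_{N,n},\phi,S)$, then its encoding $[L]=\{[\alpha]:\alpha\in L\}\subseteq T(N,n)^*$ is the language $L(G')$ of some linear logic grammar $G'$ over the alphabet $T(N,n)$.
   Context: Trees. $Tr(N,n)$ is the set of rooted planar trees with nodes labelled in $N$ and every node having at most $n$ children; such trees are identified with terms built from function symbols $A_k$ ($A\in N$, $0\le k\le n$) of arity $k$ (root labelled $A$ with $k$ children). Let $T(N,n)=\{A^i_k: A\in N, 0\le i\le k\le n\}$ and encode trees as words: $[A_0]=A^0_0$, $[A_k(\alpha_1,\dots,\alpha_k)]=A^0_k[\alpha_1]A^1_k[\alpha_2]\cdots A^{k-1}_k[\alpha_k]A^k_k$. Linear $\lambda$-calculus and ACG. Linear implicational types over atomic types: atoms and $A\multimap B$. Linear $\lambda$-terms: variables, constants, applications $(ts)$ with disjoint free variables, and $\lambda x.t$ with $x$ free exactly once in $t$. Typing rules: $x:A\vdash x:A$; from $\Gamma\vdash t:A\multimap B$ and $\Delta\vdash s:A$ infer $\Gamma,\Delta\vdash(ts):B$; from $\Gamma,x:A,\Delta\vdash t:B$ infer $\Gamma,\Delta\vdash\lambda x.t:A\multimap B$. A linear signature $\Sigma=(N',C,\mathfrak T)$ has finite sets of atomic types and constants and a type $\mathfrak T(c)$ per constant; $\vdash_\Sigma$ means derivable with extra axioms $\vdash c:\mathfrak T(c)$. A map of signatures $\phi:\Sigma_1\to\Sigma_2$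 maps types homomorphically ($\phi(A\multimap B)=\phi(A)\multimap\phi(B)$) and constants $c$ to terms with $\vdash_{\Sigma_2}\phi(c):\phi(\mathfrak T_1(c))$, extended to terms by $\phi(x)=x$, $\phi(ts)=\phi(t)\phi(s)$, $\phi(\lambda x.t)=\lambda x.\phi(t)$. An ACG is $(\Sigma_{abstr},\Sigma_{obj},\phi,S)$ with $\phi:\Sigma_{abstr}\to\Sigma_{obj}$ and $S$ atomic in $\Sigma_{abstr}$. The tree signature $Tree_{N,n}$ has one atomic type $\mathcal T$, constants $A_k$ ($A\in N$, $k\le n$) with $\mathfrak T(A_k)=\mathcal T\multimap\dots\multimap\mathcal T\multimap\mathcal T$ ($k$ arguments). Trees are represented by terms $\rho(A_0)=A_0$, $\rho(A_k(\alpha_1,\dots,\alpha_k))=A_k\rho(\alpha_1)\cdots\rho(\alpha_k)$. A tree ACG is an ACG with $\Sigma_{obj}=Tree_{N,n}$; its tree language is $L(G)=\{\alpha\in Tr(N,n):\rho(\alpha)\text{ is }\beta\eta\text{ -equivalent to }\phi(t)\text{ for some closed }t\text{ with }\vdash_\Sigma t:S\}$. Linear logic grammars (LLG) over an alphabet $T$. A boundary $X$ is $|X|\in\mathbb N$ with a subset $X_l\subseteq\{1,\dots,|X|\}$ of left endpoints, $X_r$ its complement; $X\otimes Y$: cardinality $|X|+|Y|$, left set $X_l\cup\{|X|+i:i\in Y_l\}$; $X^\perp$: same cardinality, left set $\{|X|+1-i:i\in X_r\}$. A regular multiword with boundary $X$ is a perfect matching of $\{1,\dots,|X|\}$ by edges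 $(i,w,j)$, $w\in T^*$, each from a left to a right endpoint; a multiword may additionally carry a finite multiset of cyclic words and is regular if it carries none. A cowordism $X\to Y$ is a multiword with boundary $Y\otimes X^\perp$; composition glues matching boundary vertices (order-reversingly), concatenating labels along paths and collecting closed cycles as cyclic words; identities consist of $\epsilon$-labelled edges. LL formulas over literals: $P,P^\perp$ combined by $\otimes,\wp$, De Morgan negation; rules Id, Cut, Exchange, $\wp$, $\otimes$ of multiplicative linear logic. With boundaries $[P]$ for literals, $[A\otimes B]=[A]\otimes[B]$, $[A^\perp]=[A]^\perp$, $[A_1,\dots,A_n]=[A_n]\otimes\dots\otimes[A_1]$; a derivation of $\vdash\Gamma$ is interpreted as a multiword with boundary $[\Gamma]$ (Id as the identity, Ex by permuting blocks, $\wp$ trivially, $\otimes$ as the union with blocks arranged as $[\Delta]\otimes[A]\otimes[B]\otimes[\Gamma]$, Cut by gluing the $[A]$ and $[A]^\perp$ blocks as in composition). An LLG $(N'',T,Lex,S')$ has finitely many literals with boundaries, a finite lexicon of pairs $\sigma/\vdash\Gamma$ ($\sigma$ a multiword with boundary $[\Gamma]$), and $S'$ with $[S']$ having one left and one right endpoint; a judgement is derivable if obtained by interpreting an LL derivation from lexicon sequents; its language is the set of labels of single edges of regular $\sigma$ with $\sigma/\vdash S'$ derivable. -}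

module Defs where

open import Data.Nat using (ℕ; zero; suc; _+_; _∸_; _≤_; z≤n; _<ᵇ_; _≡ᵇ_; pred)
open import Data.Fin using (Fin; zero; suc)
open import Data.List using (List; []; _∷_; _++_; map; reverse; length; concatMap; upTo)
open import Data.List.Membership.Propositional using (_∈_)
open import Data.List.Relation.Unary.All using (All)
open import Data.List.Relation.Binary.Permutation.Propositional using (_↭_)
open import Data.Vec using (Vec; []; _∷_; tabulate)
open import Data.Maybe using (Maybe; just; nothing)
open import Data.Bool using (Bool; true; false; not; if_then_else_)
open import Data.Product using (Σ; _×_; _,_)
open import Data.Sum using (_⊎_; inj₁; inj₂)
open import Data.Unit using (⊤; tt)
open import Relation.Binary.PropositionalEquality using (_≡_)

data Tr (N : Set) (n : ℕ) : Set where
  node : (A : N) (k : ℕ) → k ≤ n → Vec (Tr N n) k → Tr N n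

record TSym (N : Set) (n : ℕ) : Set where
  constructor sym
  field
    lab : N
    k   : ℕ
    k≤n : k ≤ n
    i   : Fin (suc k)

mutual
  encode : ∀ {N n} → Tr N n → List (TSym N n)
  encode (node A k p αs) = sym A k p zero ∷ encodeArgs A k p αs (tabulate suc)

  encodeArgs : ∀ {N n j} (A : N) (k : ℕ) (p : k ≤ n) →
               Vec (Tr N n) j → Vec (Fin (suc k)) j → List (TSym N n)
  encodeArgs A k p [] [] = []
  encodeArgs A k p (α ∷ αs) (i ∷ is) = encode α ++ (sym A k p i ∷ encodeArgs A k p αs is)

data LTy (At : Set) : Set where
  atom : At → LTy At
  _⊸_  : LTy At → LTy At → LTy At
infixr 5 _⊸_

data Tm (C : Set) : Set where
  var : ℕ → Tm C
  con : C → Tm C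
  app : Tm C → Tm C → Tm C
  lam : Tm C → Tm C

shift : ∀ {C} → ℕ → Tm C → Tm C
shift c (var k)   = if k <ᵇ c then var k else var (suc k)
shift c (con x)   = con x
shift c (app t s) = app (shift c t) (shift c s)
shift c (lam t)   = lam (shift (suc c) t)

subst : ∀ {C} → ℕ → Tm C → Tm C → Tm C
subst j s (var k)   = if k ≡ᵇ j then s else (if j <ᵇ k then var (pred k) else var k)
subst j s (con x)   = con x
subst j s (app t u) = app (subst j s t) (subst j s u)
subst j s (lam t)   = lam (subst (suc j) (shift 0 s) t)

data _≈βη_ {C : Set} : Tm C → Tm C → Set where
  β     : ∀ t s → app (lam t) s ≈βη subst 0 s t
  η     : ∀ t → lam (app (shift 0 t) (var 0)) ≈βη t
  ≈refl : ∀ {t} → t ≈βη t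
  ≈sym  : ∀ {t u} → t ≈βη u → u ≈βη t
  ≈trans : ∀ {t u v} → t ≈βη u → u ≈βη v → t ≈βη v
  ≈app  : ∀ {t t' s s'} → t ≈βη t' → s ≈βη s' → app t s ≈βη app t' s'
  ≈lam  : ∀ {t t'} → t ≈βη t' → lam t ≈βη lam t'

Ctx : Set → Set
Ctx At = List (Maybe (LTy At))

Empty : ∀ {At} → Ctx At → Set
Empty Γ = All (_≡ nothing) Γ

data Only {At : Set} : ℕ → LTy At → Ctx At → Set where
  here  : ∀ {A Γ} → Empty Γ → Only zero A (just A ∷ Γ)
  there : ∀ {i A Γ} → Only i A Γ → Only (suc i) A (nothing ∷ Γ)

data Merge {At : Set} : Ctx At → Ctx At → Ctx At → Set where
  []    : Merge [] [] []
  left  : ∀ {x Γ Δ Θ} → Merge Γ Δ Θ → Merge (just x ∷ Γ) (nothing ∷ Δ) (just x ∷ Θ)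
  right : ∀ {x Γ Δ Θ} → Merge Γ Δ Θ → Merge (nothing ∷ Γ) (just x ∷ Δ) (just x ∷ Θ)
  none  : ∀ {Γ Δ Θ} → Merge Γ Δ Θ → Merge (nothing ∷ Γ) (nothing ∷ Δ) (nothing ∷ Θ)

data Typing {At Con : Set} (𝔗 : Con → LTy At) : Ctx At → Tm Con → LTy At → Set where
  tvar : ∀ {i A Γ} → Only i A Γ → Typing 𝔗 Γ (var i) A
  tcon : ∀ {c Γ} → Empty Γ → Typing 𝔗 Γ (con c) (𝔗 c)
  tapp : ∀ {Γ Δ Θ t s A B} → Typing 𝔗 Γ t (A ⊸ B) → Typing 𝔗 Δ s A →
         Merge Γ Δ Θ → Typing 𝔗 Θ (app t s) B
  tlam : ∀ {Γ t A B} → Typing 𝔗 (just A ∷ Γ) t B → Typing 𝔗 Γ (lam t) (A ⊸ B)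

mapTy : ∀ {A₁ A₂} → (A₁ → LTy A₂) → LTy A₁ → LTy A₂
mapTy f (atom a) = f a
mapTy f (A ⊸ B)  = mapTy f A ⊸ mapTy f B

mapTm : ∀ {C₁ C₂} → (C₁ → Tm C₂) → Tm C₁ → Tm C₂
mapTm f (var k)   = var k
mapTm f (con c)   = f c
mapTm f (app t s) = app (mapTm f t) (mapTm f s)
mapTm f (lam t)   = lam (mapTm f t)

record TreeCon (N : Set) (n : ℕ) : Set where
  constructor tcon
  field
    lab : N
    k   : ℕ
    k≤n : k ≤ n

arrows : ℕ → LTy ⊤
arrows zero    = atom tt
arrows (suc k) = atom tt ⊸ arrows k

treeTy : ∀ {N n} → TreeCon N n → LTy ⊤
treeTy (tcon A k p) = arrows k

mutual
  rho : ∀ {N n} → Tr N n → Tm (TreeCon N n)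
  rho (node A k p αs) = rhoArgs (con (tcon A k p)) αs

  rhoArgs : ∀ {N n j} → Tm (TreeCon N n) → Vec (Tr N n) j → Tm (TreeCon N n)
  rhoArgs h []       = h
  rhoArgs h (α ∷ αs) = rhoArgs (app h (rho α)) αs

record TreeACG (N : Set) (n : ℕ) : Set where
  field
    nAt nCon : ℕ
    𝔗      : Fin nCon → LTy (Fin nAt)
    φAt    : Fin nAt → LTy ⊤
    φCon   : Fin nCon → Tm (TreeCon N n)
    φTyped : ∀ c → Typing treeTy [] (φCon c) (mapTy φAt (𝔗 c))
    S      : Fin nAt

treeLang : ∀ {N n} → TreeACG N n → Tr N n → Set
treeLang G α = Σ (Tm (Fin nCon)) λ t → Typing 𝔗 [] t (atom S) × (rho α ≈βη mapTm φCon t)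
  where open TreeACG G

-- boundary: list of polarities, true = left endpoint; position i ↦ index i-1
Boundary : Set
Boundary = List Bool

perp : Boundary → Boundary
perp X = reverse (map not X)

_!!_ : ∀ {A : Set} → List A → ℕ → Maybe A
[] !! _ = nothing
(x ∷ xs) !! zero = just x
(x ∷ xs) !! suc i = xs !! i

atB : Boundary → ℕ → Bool
atB [] _ = false
atB (x ∷ xs) zero = x
atB (x ∷ xs) (suc i) = atB xs i

Edge : Set → Set → Set
Edge V T = V × List T × V

-- multiword: edges (i , w , j) (0-based positions) plus multiset of cyclic words
record MW (T : Set) : Set where
  constructor mw
  field
    edges  : List (Edge ℕ T)
    cycles : List (List T)
open MW public

endpoints : ∀ {T} → List (Edge ℕ T) → List ℕ
endpoints = concatMap (λ { (i , _ , j) → i ∷ j ∷ [] })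

record Valid {T : Set} (X : Boundary) (σ : MW T) : Set where
  field
    perfect  : endpoints (edges σ) ↭ upTo (length X)
    oriented : All (λ { (i , _ , j) → (X !! i ≡ just true) × (X !! j ≡ just false) }) (edges σ)

relabel : ∀ {T} → (ℕ → ℕ) → MW T → MW T
relabel f (mw es cs) = mw (map (λ { (i , w , j) → (f i , w , f j) }) es) cs

-- identity cowordism X → X (boundary X ⊗ X^⊥), ε-labelled edges
idMW : ∀ {T} → Boundary → MW T
idMW {T} X = mw (map e (upTo m)) []
  where
    m = length X
    e : ℕ → Edge ℕ T
    e p = if atB X p then (p , [] , (m + m ∸ 1) ∸ p) else ((m + m ∸ 1) ∸ p , [] , p)

-- gluing along inner vertices (inj₂), concatenating labels along paths,
-- collecting closed cycles as cyclic words
data Glue {T : Set} : List (Edge (ℕ ⊎ ℕ) T) → List (List T) → MW T → Set where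
  done : ∀ es cs →
         Glue (map (λ { (i , w , j) → (inj₁ i , w , inj₁ j) }) es) cs (mw es cs)
  join : ∀ {es rest u w k w' v cs r} →
         es ↭ ((u , w , inj₂ k) ∷ (inj₂ k , w' , v) ∷ rest) →
         Glue ((u , w ++ w' , v) ∷ rest) cs r → Glue es cs r
  loop : ∀ {es rest w k cs r} →
         es ↭ ((inj₂ k , w , inj₂ k) ∷ rest) →
         Glue rest (w ∷ cs) r → Glue es cs r

mapE : ∀ {V W T} → (V → W) → List (Edge V T) → List (Edge W T)
mapE f = map (λ { (i , w , j) → (f i , w , f j) })

data Fm (nLit : ℕ) : Set where
  pos neg : Fin nLit → Fm nLit
  _⊗_ _⅋_ : Fm nLit → Fm nLit → Fm nLit

dual : ∀ {L} → Fm L → Fm L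
dual (pos P) = neg P
dual (neg P) = pos P
dual (A ⊗ B) = dual A ⅋ dual B
dual (A ⅋ B) = dual A ⊗ dual B

module LL (nLit : ℕ) (bnd : Fin nLit → Boundary) (T : Set) where

  -- [P] given, [P^⊥] = [P]^⊥, [A⊗B] = [A]⊗[B], hence [A⅋B] = ([A]^⊥⊗[B]^⊥)^⊥ = [B]⊗[A]
  bndF : Fm nLit → Boundary
  bndF (pos P) = bnd P
  bndF (neg P) = perp (bnd P)
  bndF (A ⊗ B) = bndF A ++ bndF B
  bndF (A ⅋ B) = bndF B ++ bndF A

  bndCtx : List (Fm nLit) → Boundary
  bndCtx []      = []
  bndCtx (A ∷ Γ) = bndCtx Γ ++ bndF A

  LexEntry : Set
  LexEntry = Σ (List (Fm nLit)) λ Γ → Σ (MW T) λ σ → Valid (bndCtx Γ) σ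

  -- exchange: blocks [Δ][B][A][Γ] ↦ [Δ][A][B][Γ]
  exPos : ℕ → ℕ → ℕ → ℕ → ℕ
  exPos d b a p = if p <ᵇ d then p else
                  (if p <ᵇ d + b then p + a else
                  (if p <ᵇ d + b + a then p ∸ b else p))

  -- tensor: premise ⊢Γ,A on [A][Γ] and premise ⊢B,Δ on [Δ][B],
  -- conclusion ⊢Γ,A⊗B,Δ on [Δ][A][B][Γ]
  tensL : ℕ → ℕ → ℕ → ℕ → ℕ
  tensL d a b p = if p <ᵇ a then d + p else d + b + p

  tensR : ℕ → ℕ → ℕ → ℕ
  tensR d a p = if p <ᵇ d then p else p + a

  -- cut: premise ⊢Γ,A on [A][Γ], premise ⊢A^⊥,Δ on [Δ][A^⊥],
  -- conclusion ⊢Γ,Δ on [Δ][Γ]; position q of [A]^⊥ is glued to a-1-q of [A]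
  cutL : ℕ → ℕ → ℕ → ℕ ⊎ ℕ
  cutL d a p = if p <ᵇ a then inj₂ p else inj₁ (d + (p ∸ a))

  cutR : ℕ → ℕ → ℕ → ℕ ⊎ ℕ
  cutR d a p = if p <ᵇ d then inj₁ p else inj₂ ((a ∸ 1) ∸ (p ∸ d))

  data Derivable (Lex : List LexEntry) : List (Fm nLit) → MW T → Set where
    lexR : ∀ {Γ σ v} → (Γ , σ , v) ∈ Lex → Derivable Lex Γ σ
    idR  : ∀ A → Derivable Lex (dual A ∷ A ∷ []) (idMW (bndF A))
    exR  : ∀ Γ A B Δ {σ} → Derivable Lex (Γ ++ A ∷ B ∷ Δ) σ →
           Derivable Lex (Γ ++ B ∷ A ∷ Δ)
             (relabel (exPos (length (bndCtx Δ)) (length (bndF B)) (length (bndF A))) σ)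
    parR : ∀ Γ A B {σ} → Derivable Lex (Γ ++ A ∷ B ∷ []) σ →
           Derivable Lex (Γ ++ (A ⅋ B) ∷ []) σ
    tenR : ∀ Γ A B Δ {σ₁ σ₂} → Derivable Lex (Γ ++ A ∷ []) σ₁ → Derivable Lex (B ∷ Δ) σ₂ →
           Derivable Lex (Γ ++ (A ⊗ B) ∷ Δ)
             (mw (mapE (tensR (length (bndCtx Δ)) (length (bndF A))) (edges σ₂) ++
                  mapE (tensL (length (bndCtx Δ)) (length (bndF A)) (length (bndF B))) (edges σ₁))
                 (cycles σ₁ ++ cycles σ₂))
    cut  : ∀ Γ A Δ {σ₁ σ₂ τ} → Derivable Lex (Γ ++ A ∷ []) σ₁ → Derivable Lex (dual A ∷ Δ) σ₂ →
           Glue (mapE (cutR (length (bndCtx Δ)) (length (bndF A))) (edges σ₂) ++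
                 mapE (cutL (length (bndCtx Δ)) (length (bndF A))) (edges σ₁))
                (cycles σ₁ ++ cycles σ₂) τ →
           Derivable Lex (Γ ++ Δ) τ

record LLG (T : Set) : Set where
  field
    nLit  : ℕ
    bnd   : Fin nLit → Boundary
    Lex   : List (LL.LexEntry nLit bnd T)
    S'    : Fin nLit
    S'bnd : (bnd S' ≡ true ∷ false ∷ []) ⊎ (bnd S' ≡ false ∷ true ∷ [])

llgLang : ∀ {T} → LLG T → List T → Set
llgLang {T} G w =
  Σ (MW T) λ σ → LL.Derivable nLit bnd T Lex (pos S' ∷ []) σ × (cycles σ ≡ []) ×
    Σ ℕ λ i → Σ ℕ λ j → edges σ ≡ (i , w , j) ∷ []
  where open LLG G

{-# OPTIONS --safe #-}
-- Atoms p of Σ become literals with boundary [φ p], where [𝒯] has a left and a right endpoint,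
-- A ⊸ B becomes A^⊥ ⅋ B, and a constant c contributes the multiword that interprets φ(c).
--
-- Multiwords are compared with λ-terms through valuations of the boundary vertices in words:
-- an edge (u, w, v) demands x_u = w x_v.  Gluing composes the solution sets, so a logical
-- relation between sets of valuations and λ-terms shows that the multiword of a term
-- φ(t) : 𝒯 is the single edge labelled [α] with φ(t) ≈ ρ(α).  A natural number that strictly
-- decreases along the edges excludes cyclic words.
--
-- A term t is turned into a derivation through the combinators B, C, I.  Conversely, a
-- derivation in classical multiplicative linear logic with cuts is interpreted in a Chu-style
-- phase model in which literals have no counter-elements.  There A ⊸ B is the full function
-- space, so elements can be reified into linear λ-terms, and no cut elimination is needed.
--
-- That ρ(α) ≈βη ρ(α′) forces [α] = [α′], and that ρ(α) is never ≈βη to a term of functional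
-- type, is seen in an extensional filter model of the untyped λ-calculus.
module Submission where

open import Defs
import Algebra.Solver.CommutativeMonoid
open import Data.Bool using (Bool; true; false; not; if_then_else_)
open import Data.Empty using (⊥; ⊥-elim)
open import Data.Fin using (Fin; zero; suc)
open import Data.List using (List; []; _∷_; _++_; map; reverse; length; upTo; allFin; applyUpTo)
open import Data.List.Membership.Propositional using (_∈_; _∉_)
open import Data.List.Membership.Propositional.Properties using (∈-++⁺ˡ; ∈-++⁺ʳ; ∈-++⁻; ∈-map⁺; ∈-map⁻; ∈-allFin; ∈-∃++)
open import Data.List.Properties using (++-assoc; ++-identityʳ; length-++; length-reverse; length-map; reverse-++; reverse-involutive; unfold-reverse; map-++; map-∘; map-cong; map-injective; map-id; map-applyUpTo; ∷-injectiveˡ; ∷-injectiveʳ)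
open import Data.List.Relation.Binary.Permutation.Propositional using (_↭_; ↭-refl; ↭-sym; ↭-trans; ↭-reflexive; prep; ↭-swap)
open import Data.List.Relation.Binary.Permutation.Propositional.Properties using (↭-singleton-inv; ↭-empty-inv; ∈-resp-↭; All-resp-↭; drop-∷; drop-mid; ++⁺ˡ; ++⁺ʳ; ++-comm; map⁺; ↭-map-inv; ++-commutativeMonoid) renaming (shift to ↭-shift; ++⁺ to ↭-++)
open import Data.List.Relation.Binary.Pointwise using (Pointwise; []; _∷_) renaming (++⁺ to Pointwise-++)
open import Data.List.Relation.Unary.All using (All; []; _∷_) renaming (tabulate to all-tabulate)
open import Data.List.Relation.Unary.All.Properties using (applyUpTo⁺₁) renaming (map⁺ to All-map⁺; ++⁺ to All-++⁺; ++⁻ˡ to All-++⁻ˡ; ++⁻ʳ to All-++⁻ʳ)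
open import Data.List.Relation.Unary.Any using (here; there)
open import Data.List.Relation.Unary.Any.Properties using (¬Any[])
open import Data.Maybe using (Maybe; just; nothing)
open import Data.Nat using (ℕ; zero; suc; _+_; _∸_; _≤_; _<_; z≤n; s≤s; _<ᵇ_; _≡ᵇ_; pred; _⊔_)
open import Data.Nat.Properties using (+-assoc; +-comm; +-identityʳ; +-monoʳ-<; +-suc; +-∸-assoc; <-irrefl; <-trans; m+n∸m≡n; m+n∸n≡m; m∸[m∸n]≡n; m≤m+n; m≤m⊔n; m≤n⇒m≤1+n; m≤n⊔m; n∸n≡0; ∸-+-assoc; ≤-refl; ≤-reflexive; ≤-trans)
open import Data.Product using (Σ; _×_; _,_; proj₁; proj₂; swap)
open import Data.Sum using (_⊎_; inj₁; inj₂; [_,_]′)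
open import Data.Unit using (⊤; tt)
open import Data.Vec using (Vec; []; _∷_; tabulate)
open import Function using (id; _∘_)
open import Function.Bundles using (_⇔_; mk⇔)
open import Level using (Lift; lift)
open import Relation.Binary.PropositionalEquality using (_≡_; _≢_; refl; trans; cong; cong₂) renaming (sym to ≡-sym; subst to ≡-subst; subst₂ to ≡-subst₂)

-- The strict decrease has a price: an identity net is not neutral for solution sets, since each of
-- its edges uses up one unit of the number. Membership in the logical relation therefore has to
-- survive moving every value along one further edge (`R-shift`); at the type of trees this works
-- because the number at the right endpoint is universally quantified. The decrease excludes cycles
-- only where a solution exists, while a type may have no closed inhabitant from which to get one.
-- In the filter model a free variable belongs to every type, so that all related relations are
-- nonempty. The model thus serves three ends: it makes gluing succeed, it identifies the word of a
-- tree, and it separates trees from functions. The construction is run twice, once on the tree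
-- signature itself to obtain the multiwords of the terms φ(c), and once on the signature of the
-- grammar with these multiwords as lexicon. The type φ(S) may be compound. Then [S] need not have
-- two endpoints, but the tree language is empty and a separate grammar is given.

-- Tokens of an extensional filter model.

module Tokens (T : Set) where

  -- The list of arguments is understood to continue with empty ones: X ⇒ t adds an argument,
  -- and [] ⇒ tok [] a is identified (by ⊑ in both directions) with tok [] a, which yields η.
  data Tok : Set where
    tok : List (List Tok) → Maybe (List T) → Tok

  atomOf : Tok → Maybe (List T)
  atomOf (tok _ a) = a

  hd : Tok → List Tok
  hd (tok [] _)      = []
  hd (tok (X ∷ _) _) = X

  tl : Tok → Tok
  tl (tok [] a)       = tok [] a
  tl (tok (_ ∷ Xs) a) = tok Xs a

  infixr 6 _⇒_
  _⇒_ : List Tok → Tok → Tok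
  X ⇒ tok Xs a = tok (X ∷ Xs) a

  infix 4 _⊑_
  -- Entailment of intersection types, contravariant in the arguments. Since `tl` never runs out of
  -- arguments, `step` alone would have no finite derivations; `base` ends them. The witnesses in
  -- `hd t` are given by a function `g`, which lets `⊑-trans` recurse structurally.
  data _⊑_ : Tok → Tok → Set where
    base : ∀ {a Xs} → tok [] a ⊑ tok Xs a
    step : ∀ {s t} (g : ∀ {x} → x ∈ hd s → Tok) →
           (∀ {x} (p : x ∈ hd s) → g p ∈ hd t) →
           (∀ {x} (p : x ∈ hd s) → g p ⊑ x) →
           tl s ⊑ tl t → s ⊑ t

  atomOf-tl : ∀ s → atomOf (tl s) ≡ atomOf s
  atomOf-tl (tok [] _)      = refl
  atomOf-tl (tok (_ ∷ _) _) = refl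

  ⊑-atomOf : ∀ {s t} → s ⊑ t → atomOf s ≡ atomOf t
  ⊑-atomOf base = refl
  ⊑-atomOf {s} {t} (step _ _ _ p) =
    trans (≡-sym (atomOf-tl s)) (trans (⊑-atomOf p) (atomOf-tl t))

  mutual
    ⊑-refl : ∀ {s} → s ⊑ s
    ⊑-refl {tok Xs a} = ⊑-refl-args Xs

    ⊑-refl-args : ∀ Xs {a} → tok Xs a ⊑ tok Xs a
    ⊑-refl-args []       = base
    ⊑-refl-args (X ∷ Xs) = step (λ {x} _ → x) id (∈⇒⊑-refl X) (⊑-refl-args Xs)

    ∈⇒⊑-refl : ∀ X {x} → x ∈ X → x ⊑ x
    ∈⇒⊑-refl (x ∷ X) (here refl) = ⊑-refl
    ∈⇒⊑-refl (x ∷ X) (there p)   = ∈⇒⊑-refl X p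

  ⊑-pad : ∀ {s a Xs} → s ⊑ tok [] a → s ⊑ tok Xs a
  ⊑-pad base = base
  ⊑-pad {Xs = []} p@(step _ _ _ _) = p
  ⊑-pad {Xs = X ∷ Xs} (step g m h p) =
    step (λ q → g q) (λ q → ⊥-elim (¬Any[] (m q))) h (⊑-pad p)

  ⊑-trans : ∀ {s t u} → s ⊑ t → t ⊑ u → s ⊑ u
  ⊑-trans {u = tok Us b} base q with ⊑-atomOf q
  ... | refl = base
  ⊑-trans (step g m h p) base = ⊑-pad (step g m h p)
  ⊑-trans (step g m h p) (step g' m' h' p') =
    step (λ q → g' (m q)) (λ q → m' (m q)) (λ q → ⊑-trans (h' (m q)) (h q)) (⊑-trans p p')

  ⊑-hd : ∀ {s t x} → s ⊑ t → x ∈ hd s → Σ Tok λ y → y ∈ hd t × y ⊑ x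
  ⊑-hd (step g m h _) p = g p , m p , h p

  ⊑-tl : ∀ {s t} → s ⊑ t → tl s ⊑ tl t
  ⊑-tl {t = tok [] a} base      = base
  ⊑-tl {t = tok (X ∷ Xs) a} base = base
  ⊑-tl (step _ _ _ p) = p

  ⇒-mono : ∀ {X Y u v} → (∀ {x} → x ∈ X → Σ Tok λ y → y ∈ Y × y ⊑ x) →
           u ⊑ v → X ⇒ u ⊑ Y ⇒ v
  ⇒-mono {u = tok _ _} {tok _ _} f p =
    step (λ q → proj₁ (f q)) (λ q → proj₁ (proj₂ (f q))) (λ q → proj₂ (proj₂ (f q))) p

  hd⇒tl-⊑ : ∀ u → hd u ⇒ tl u ⊑ u
  hd⇒tl-⊑ (tok [] a) = step (λ ()) (λ ()) (λ ()) base
  hd⇒tl-⊑ (tok (X ∷ Xs) a) = ⊑-refl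

  ⊑-hd⇒tl : ∀ u → u ⊑ hd u ⇒ tl u
  ⊑-hd⇒tl (tok [] a) = base
  ⊑-hd⇒tl (tok (X ∷ Xs) a) = ⊑-refl

  Up : (Tok → Set) → Set
  Up U = ∀ {s t} → s ⊑ t → U s → U t

  ↑ : List Tok → Tok → Set
  ↑ X u = Σ Tok λ x → x ∈ X × x ⊑ u

  ↑-up : ∀ X → Up (↑ X)
  ↑-up X p (x , x∈X , q) = x , x∈X , ⊑-trans q p

  ↑-mono : ∀ {X Y} → (∀ {x} → x ∈ X → x ∈ Y) → ∀ {u} → ↑ X u → ↑ Y u
  ↑-mono f (x , x∈X , q) = x , f x∈X , q

  Env : Set₁
  Env = ℕ → Tok → Set

  UpEnv : Env → Set
  UpEnv ρ = ∀ i → Up (ρ i)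

  infixr 5 _∙_
  _∙_ : (Tok → Set) → Env → Env
  (U ∙ ρ) zero    = U
  (U ∙ ρ) (suc i) = ρ i

  ∙-up : ∀ {U ρ} → Up U → UpEnv ρ → UpEnv (U ∙ ρ)
  ∙-up p q zero    = p
  ∙-up p q (suc i) = q i

  -- Soundness of the filter model for βη.

  module Denotation {C : Set} (Con : C → Tok → Set) (Con-up : ∀ c → Up (Con c)) where

    -- Read `⟦ t ⟧ ρ u` as: `t` has the intersection type `u`. An abstraction splits every token
    -- into `hd u` and `tl u`, also one whose list of arguments is empty; this is what makes the
    -- model extensional.
    ⟦_⟧ : Tm C → Env → Tok → Set
    ⟦ var i ⟧ ρ u   = ρ i u
    ⟦ con c ⟧ ρ u   = Con c u
    ⟦ app t s ⟧ ρ u = Σ (List Tok) λ X → ⟦ t ⟧ ρ (X ⇒ u) × (∀ {x} → x ∈ X → ⟦ s ⟧ ρ x)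
    ⟦ lam t ⟧ ρ u   = ⟦ t ⟧ (↑ (hd u) ∙ ρ) (tl u)

    infix 4 _⊆_
    _⊆_ : Env → Env → Set
    ρ ⊆ ρ' = ∀ i u → ρ i u → ρ' i u

    ∙-⊆ : ∀ {U U' ρ ρ'} → (∀ u → U u → U' u) → ρ ⊆ ρ' → (U ∙ ρ) ⊆ (U' ∙ ρ')
    ∙-⊆ f g zero    = f
    ∙-⊆ f g (suc i) = g i

    ⟦⟧-mono : ∀ t {ρ ρ' u} → ρ ⊆ ρ' → ⟦ t ⟧ ρ u → ⟦ t ⟧ ρ' u
    ⟦⟧-mono (var i) f d = f i _ d
    ⟦⟧-mono (con c) f d = d
    ⟦⟧-mono (app t s) f (X , d , e) = X , ⟦⟧-mono t f d , λ p → ⟦⟧-mono s f (e p)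
    ⟦⟧-mono (lam t) f d = ⟦⟧-mono t (∙-⊆ (λ _ p → p) f) d

    ⟦⟧-up : ∀ t {ρ} → UpEnv ρ → Up (⟦ t ⟧ ρ)
    ⟦⟧-up (var i) up p d = up i p d
    ⟦⟧-up (con c) up p d = Con-up c p d
    ⟦⟧-up (app t s) up p (X , d , e) =
      X , ⟦⟧-up t up (⇒-mono (λ {x} q → x , q , ⊑-refl) p) d , e
    ⟦⟧-up (lam t) up {s'} {t'} p d =
      ⟦⟧-up t (∙-up (↑-up _) up) (⊑-tl p) (⟦⟧-mono t (∙-⊆ widen (λ _ _ q → q)) d)
      where
      widen : ∀ u → ↑ (hd s') u → ↑ (hd t') u
      widen u (x , q , r) with ⊑-hd p q
      ... | y , q' , r' = y , q' , ⊑-trans r' r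

    skip : ℕ → ℕ → ℕ
    skip c k = if k <ᵇ c then k else suc k

    ∙-skip : ∀ U ρ c i → (U ∙ ρ) (skip (suc c) i) ≡ (U ∙ (λ k → ρ (skip c k))) i
    ∙-skip U ρ c zero = refl
    ∙-skip U ρ c (suc k) with k <ᵇ c
    ... | true  = refl
    ... | false = refl

    ⟦shift⟧ : ∀ t c {ρ u} → (⟦ shift c t ⟧ ρ u → ⟦ t ⟧ (λ k → ρ (skip c k)) u) ×
                            (⟦ t ⟧ (λ k → ρ (skip c k)) u → ⟦ shift c t ⟧ ρ u)
    ⟦shift⟧ (var k) c with k <ᵇ c
    ... | true  = id , id
    ... | false = id , id
    ⟦shift⟧ (con x) c = id , id
    ⟦shift⟧ (app t s) c =
      (λ (X , d , e) → X , proj₁ (⟦shift⟧ t c) d , λ p → proj₁ (⟦shift⟧ s c) (e p)) ,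
      (λ (X , d , e) → X , proj₂ (⟦shift⟧ t c) d , λ p → proj₂ (⟦shift⟧ s c) (e p))
    ⟦shift⟧ (lam t) c {ρ} =
      (λ d → ⟦⟧-mono t (λ i u → ≡-subst (λ U → U u) (∙-skip _ ρ c i)) (proj₁ (⟦shift⟧ t (suc c)) d)) ,
      (λ d → proj₂ (⟦shift⟧ t (suc c))
               (⟦⟧-mono t (λ i u → ≡-subst (λ U → U u) (≡-sym (∙-skip _ ρ c i))) d))

    ins : ℕ → (Tok → Set) → Env → Env
    ins j U ρ k = if k ≡ᵇ j then U else (if j <ᵇ k then ρ (pred k) else ρ k)

    ⟦subst⟧-lam-env : ∀ j s U ρ →
      (ins (suc j) (⟦ shift 0 s ⟧ (U ∙ ρ)) (U ∙ ρ) ⊆ (U ∙ ins j (⟦ s ⟧ ρ) ρ)) ×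
      ((U ∙ ins j (⟦ s ⟧ ρ) ρ) ⊆ ins (suc j) (⟦ shift 0 s ⟧ (U ∙ ρ)) (U ∙ ρ))
    ⟦subst⟧-lam-env j s U ρ = to , from
      where
      to : ins (suc j) (⟦ shift 0 s ⟧ (U ∙ ρ)) (U ∙ ρ) ⊆ (U ∙ ins j (⟦ s ⟧ ρ) ρ)
      to zero u d = d
      to (suc k) u d with k ≡ᵇ j
      to (suc k) u d | true = proj₁ (⟦shift⟧ s 0) d
      to (suc zero) u d | false = d
      to (suc (suc k)) u d | false with j <ᵇ suc k
      ... | true  = d
      ... | false = d
      from : (U ∙ ins j (⟦ s ⟧ ρ) ρ) ⊆ ins (suc j) (⟦ shift 0 s ⟧ (U ∙ ρ)) (U ∙ ρ)
      from zero u d = d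
      from (suc k) u d with k ≡ᵇ j
      from (suc k) u d | true = proj₂ (⟦shift⟧ s 0) d
      from (suc zero) u d | false = d
      from (suc (suc k)) u d | false with j <ᵇ suc k
      ... | true  = d
      ... | false = d

    ⟦subst⟧ : ∀ t j s {ρ u} → (⟦ subst j s t ⟧ ρ u → ⟦ t ⟧ (ins j (⟦ s ⟧ ρ) ρ) u) ×
                              (⟦ t ⟧ (ins j (⟦ s ⟧ ρ) ρ) u → ⟦ subst j s t ⟧ ρ u)
    ⟦subst⟧ (var k) j s with k ≡ᵇ j
    ... | true = id , id
    ... | false with j <ᵇ k
    ...   | true  = id , id
    ...   | false = id , id
    ⟦subst⟧ (con x) j s = id , id
    ⟦subst⟧ (app t t') j s =
      (λ (X , d , e) → X , proj₁ (⟦subst⟧ t j s) d , λ p → proj₁ (⟦subst⟧ t' j s) (e p)) ,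
      (λ (X , d , e) → X , proj₂ (⟦subst⟧ t j s) d , λ p → proj₂ (⟦subst⟧ t' j s) (e p))
    ⟦subst⟧ (lam t) j s {ρ} =
      (λ d → ⟦⟧-mono t (proj₁ (⟦subst⟧-lam-env j s _ ρ)) (proj₁ (⟦subst⟧ t (suc j) (shift 0 s)) d)) ,
      (λ d → proj₂ (⟦subst⟧ t (suc j) (shift 0 s)) (⟦⟧-mono t (proj₂ (⟦subst⟧-lam-env j s _ ρ)) d))

    Within : List Tok → (Tok → Set) → Set
    Within X U = ∀ {x} → x ∈ X → U x

    within-++ : ∀ {X Y U} → Within X U → Within Y U → Within (X ++ Y) U
    within-++ {X} f g p = [ f , g ]′ (∈-++⁻ X p)

    -- Continuity, with F X an environment approximating ρ by the finite part X of U.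
    ⟦⟧-cont : ∀ t (U : Tok → Set) (F : List Tok → Env) {ρ u} →
              (∀ {X Y} → (∀ {x} → x ∈ X → x ∈ Y) → F X ⊆ F Y) →
              (∀ i v → ρ i v → Σ (List Tok) λ X → Within X U × F X i v) →
              ⟦ t ⟧ ρ u → Σ (List Tok) λ X → Within X U × ⟦ t ⟧ (F X) u
    ⟦⟧-cont (var i) U F mono ap d = ap i _ d
    ⟦⟧-cont (con c) U F mono ap d = [] , (λ ()) , d
    ⟦⟧-cont (app t s) U F {ρ} mono ap (Y , d , e) with ⟦⟧-cont t U F mono ap d
    ... | X , X⊆ , d' with args Y e
      where
      args : ∀ Y → (∀ {y} → y ∈ Y → ⟦ s ⟧ ρ y) →
             Σ (List Tok) λ Z → Within Z U × (∀ {y} → y ∈ Y → ⟦ s ⟧ (F Z) y)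
      args [] e = [] , (λ ()) , λ ()
      args (y ∷ Y) e with ⟦⟧-cont s U F mono ap (e (here refl)) | args Y (λ p → e (there p))
      ... | Z₁ , w₁ , d₁ | Z₂ , w₂ , d₂ =
        Z₁ ++ Z₂ , within-++ w₁ w₂ ,
        λ { (here refl) → ⟦⟧-mono s (mono ∈-++⁺ˡ) d₁
          ; (there p)   → ⟦⟧-mono s (mono (∈-++⁺ʳ Z₁)) (d₂ p) }
    ...   | Z , Z⊆ , e' =
      X ++ Z , within-++ X⊆ Z⊆ ,
      Y , ⟦⟧-mono t (mono ∈-++⁺ˡ) d' , λ p → ⟦⟧-mono s (mono (∈-++⁺ʳ X)) (e' p)
    ⟦⟧-cont (lam t) U F {ρ} {u} mono ap d =
      ⟦⟧-cont t U (λ X → ↑ (hd u) ∙ F X) (λ f → ∙-⊆ (λ _ p → p) (mono f)) ap' d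
      where
      ap' : ∀ i v → (↑ (hd u) ∙ ρ) i v → Σ (List Tok) λ X → Within X U × (↑ (hd u) ∙ F X) i v
      ap' zero v p    = [] , (λ ()) , p
      ap' (suc i) v p = ap i v p

    ⟦lam⟧-⇒ : ∀ t {ρ X u} → (⟦ lam t ⟧ ρ (X ⇒ u) → ⟦ t ⟧ (↑ X ∙ ρ) u) ×
                            (⟦ t ⟧ (↑ X ∙ ρ) u → ⟦ lam t ⟧ ρ (X ⇒ u))
    ⟦lam⟧-⇒ t {u = tok _ _} = id , id

    ins₀ : ∀ U ρ → (ins 0 U ρ ⊆ (U ∙ ρ)) × ((U ∙ ρ) ⊆ ins 0 U ρ)
    ins₀ U ρ = (λ { zero _ d → d ; (suc i) _ d → d }) , (λ { zero _ d → d ; (suc i) _ d → d })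

    ≈-sound : ∀ {t t'} → t ≈βη t' → ∀ {ρ} → UpEnv ρ → ∀ {u} →
              (⟦ t ⟧ ρ u → ⟦ t' ⟧ ρ u) × (⟦ t' ⟧ ρ u → ⟦ t ⟧ ρ u)
    ≈-sound (β t s) {ρ} up {u} = to , from
      where
      to : ⟦ app (lam t) s ⟧ ρ u → ⟦ subst 0 s t ⟧ ρ u
      to (X , d , e) = proj₂ (⟦subst⟧ t 0 s) (⟦⟧-mono t (λ i v → proj₂ (ins₀ _ ρ) i v)
        (⟦⟧-mono t (∙-⊆ (λ v (x , p , q) → ⟦⟧-up s up q (e p)) (λ _ _ q → q)) (proj₁ (⟦lam⟧-⇒ t) d)))
      from : ⟦ subst 0 s t ⟧ ρ u → ⟦ app (lam t) s ⟧ ρ u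
      -- An application has to name a finite set of argument tokens. Continuity extracts the
      -- finitely many tokens of `s` that the derivation uses.
      from d with ⟦⟧-cont t (⟦ s ⟧ ρ) (λ X → ↑ X ∙ ρ) (λ f → ∙-⊆ (λ _ → ↑-mono f) (λ _ _ q → q)) ap
                    (⟦⟧-mono t (proj₁ (ins₀ _ ρ)) (proj₁ (⟦subst⟧ t 0 s) d))
        where
        ap : ∀ i v → (⟦ s ⟧ ρ ∙ ρ) i v → Σ (List Tok) λ X → Within X (⟦ s ⟧ ρ) × (↑ X ∙ ρ) i v
        ap zero v p    = v ∷ [] , (λ { (here refl) → p }) , v , here refl , ⊑-refl
        ap (suc i) v p = [] , (λ ()) , p
      ... | X , w , d' = X , proj₂ (⟦lam⟧-⇒ t) d' , w
    ≈-sound (η t) {ρ} up {u} = to , from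
      where
      to : ⟦ lam (app (shift 0 t) (var 0)) ⟧ ρ u → ⟦ t ⟧ ρ u
      -- η rests on `u` and `hd u ⇒ tl u` entailing each other, one entailment for each direction.
      to (X , d , e) =
        ⟦⟧-up t up (⊑-trans (⇒-mono e ⊑-refl) (hd⇒tl-⊑ u)) (proj₁ (⟦shift⟧ t 0) d)
      from : ⟦ t ⟧ ρ u → ⟦ lam (app (shift 0 t) (var 0)) ⟧ ρ u
      from d = hd u , proj₂ (⟦shift⟧ t 0) (⟦⟧-up t up (⊑-hd⇒tl u) d) , λ {x} p → x , p , ⊑-refl
    ≈-sound ≈refl up = id , id
    ≈-sound (≈sym p) up = swap (≈-sound p up)
    ≈-sound (≈trans p q) up =
      (λ d → proj₁ (≈-sound q up) (proj₁ (≈-sound p up) d)) ,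
      (λ d → proj₂ (≈-sound p up) (proj₂ (≈-sound q up) d))
    ≈-sound (≈app p q) up =
      (λ (X , d , e) → X , proj₁ (≈-sound p up) d , λ r → proj₁ (≈-sound q up) (e r)) ,
      (λ (X , d , e) → X , proj₂ (≈-sound p up) d , λ r → proj₂ (≈-sound q up) (e r))
    ≈-sound (≈lam p) up = ≈-sound p (∙-up (↑-up _) up)

-- Shifting, substitution and the laws of the combinators.

<ᵇ-true : ∀ k j → (k <ᵇ j) ≡ true → ((k ≡ᵇ j) ≡ false) × ((j <ᵇ k) ≡ false) × ((k <ᵇ suc j) ≡ true)
<ᵇ-true zero (suc j) p = refl , refl , refl
<ᵇ-true (suc k) (suc j) p = <ᵇ-true k j p

<ᵇ-false : ∀ k j → (k <ᵇ j) ≡ false → ((suc k ≡ᵇ j) ≡ false) × ((j <ᵇ suc k) ≡ true) × ((suc k <ᵇ j) ≡ false)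
<ᵇ-false k zero p = refl , refl , refl
<ᵇ-false (suc k) (suc j) p = <ᵇ-false k j p

subst-shift : ∀ {C} (t : Tm C) j s → subst j s (shift j t) ≡ t
subst-shift (var k) j s with k <ᵇ j in eq
... | true  rewrite proj₁ (<ᵇ-true k j eq) | proj₁ (proj₂ (<ᵇ-true k j eq)) = refl
... | false rewrite proj₁ (<ᵇ-false k j eq) | proj₁ (proj₂ (<ᵇ-false k j eq)) = refl
subst-shift (con x) j s = refl
subst-shift (app t u) j s = cong₂ app (subst-shift t j s) (subst-shift u j s)
subst-shift (lam t) j s = cong lam (subst-shift t (suc j) (shift 0 s))

shift-shift : ∀ {C} (t : Tm C) c → shift (suc c) (shift c t) ≡ shift c (shift c t)
shift-shift (var k) c with k <ᵇ c in eq
... | true  rewrite eq | proj₂ (proj₂ (<ᵇ-true k c eq)) = refl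
... | false rewrite eq | proj₂ (proj₂ (<ᵇ-false k c eq)) = refl
shift-shift (con x) c = refl
shift-shift (app t u) c = cong₂ app (shift-shift t c) (shift-shift u c)
shift-shift (lam t) c = cong lam (shift-shift t (suc c))

subst-shift² : ∀ {C} (t s : Tm C) → subst 1 s (shift 0 (shift 0 t)) ≡ shift 0 t
subst-shift² t s = trans (cong (subst 1 s) (≡-sym (shift-shift t 0))) (subst-shift (shift 0 t) 1 s)

≡⇒≈ : ∀ {C} {t u : Tm C} → t ≡ u → t ≈βη u
≡⇒≈ refl = ≈refl

Iᶜ Bᶜ Cᶜ : ∀ {C} → Tm C
Iᶜ = lam (var 0)
Bᶜ = lam (lam (lam (app (var 2) (app (var 1) (var 0)))))
Cᶜ = lam (lam (lam (app (app (var 2) (var 0)) (var 1))))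

I-≈ : ∀ {C} (a : Tm C) → app Iᶜ a ≈βη a
I-≈ a = β (var 0) a

B-≈ : ∀ {C} (a b c : Tm C) → app (app (app Bᶜ a) b) c ≈βη app a (app b c)
B-≈ a b c =
  ≈trans (≈app (≈app (β _ a) ≈refl) ≈refl)
  (≈trans (≈app (β _ b) ≈refl)
  (≈trans (≈app (≡⇒≈ (cong (λ x → lam (app x (app (shift 0 b) (var 0)))) (subst-shift² a (shift 0 b)))) ≈refl)
  (≈trans (β _ c) (≡⇒≈ (cong₂ (λ x y → app x (app y c)) (subst-shift a 0 c) (subst-shift b 0 c))))))

C-≈ : ∀ {C} (a b c : Tm C) → app (app (app Cᶜ a) b) c ≈βη app (app a c) b
C-≈ a b c =
  ≈trans (≈app (≈app (β _ a) ≈refl) ≈refl)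
  (≈trans (≈app (β _ b) ≈refl)
  (≈trans (≈app (≡⇒≈ (cong (λ x → lam (app (app x (var 0)) (shift 0 b))) (subst-shift² a (shift 0 b)))) ≈refl)
  (≈trans (β _ c) (≡⇒≈ (cong₂ (λ x y → app (app x c) y) (subst-shift a 0 c) (subst-shift b 0 c))))))

-- Linear combinatory terms and bracket abstraction.

World : Set → Set
World At = List (ℕ × LTy At)

Fresh : ∀ {At} → ℕ → World At → Set
Fresh x Θ = ∀ {A} → (x , A) ∉ Θ

upd : ∀ {a} {X : Set a} → (ℕ → X) → ℕ → X → ℕ → X
upd ξ x v y = if x ≡ᵇ y then v else ξ y

≡ᵇ-refl : ∀ x → (x ≡ᵇ x) ≡ true
≡ᵇ-refl zero = refl
≡ᵇ-refl (suc x) = ≡ᵇ-refl x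

≢⇒≡ᵇ-false : ∀ x y → x ≢ y → (x ≡ᵇ y) ≡ false
≢⇒≡ᵇ-false zero zero p = ⊥-elim (p refl)
≢⇒≡ᵇ-false zero (suc y) p = refl
≢⇒≡ᵇ-false (suc x) zero p = refl
≢⇒≡ᵇ-false (suc x) (suc y) p = ≢⇒≡ᵇ-false x y (λ q → p (cong suc q))

upd-same : ∀ {a} {X : Set a} (ξ : ℕ → X) x v → upd ξ x v x ≡ v
upd-same ξ x v rewrite ≡ᵇ-refl x = refl

upd-other : ∀ {a} {X : Set a} (ξ : ℕ → X) {x} v {y} → x ≢ y → upd ξ x v y ≡ ξ y
upd-other ξ {x} v {y} p rewrite ≢⇒≡ᵇ-false x y p = refl

∈⇒↭ : ∀ {A : Set} {x : A} {xs} → x ∈ xs → Σ (List A) λ ys → xs ↭ x ∷ ys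
∈⇒↭ {x = x} p with ∈-∃++ p
... | ys , zs , refl = ys ++ zs , ↭-shift x ys zs

only-bound : ∀ {At : Set} {i} {A : LTy At} {Γ} → Only i A Γ → i < length Γ
only-bound (here _)  = s≤s z≤n
only-bound (there o) = s≤s (only-bound o)

merge-length : ∀ {At : Set} {Γ Δ Θ : Ctx At} → Merge Γ Δ Θ → (length Γ ≡ length Θ) × (length Δ ≡ length Θ)
merge-length []        = refl , refl
merge-length (left m)  = cong suc (proj₁ (merge-length m)) , cong suc (proj₂ (merge-length m))
merge-length (right m) = cong suc (proj₁ (merge-length m)) , cong suc (proj₂ (merge-length m))
merge-length (none m)  = cong suc (proj₁ (merge-length m)) , cong suc (proj₂ (merge-length m))

module Linear {At Con C₂ : Set} (𝔗 : Con → LTy At) (φ : Con → Tm C₂)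
              (φ-closed : ∀ c → shift 0 (φ c) ≡ φ c) where

  -- There is no binder, so that only application, the constants and three combinators need
  -- realizers. Variables carry names, and worlds are used up to permutation; two worlds can thus be
  -- concatenated without renaming, even if a name occurs in both.
  data Lin : World At → LTy At → Set where
    lvar : ∀ {x A} → Lin ((x , A) ∷ []) A
    lcon : ∀ c → Lin [] (𝔗 c)
    lI   : ∀ A → Lin [] (A ⊸ A)
    lB   : ∀ A B C → Lin [] ((B ⊸ C) ⊸ (A ⊸ B) ⊸ A ⊸ C)
    lC   : ∀ A B C → Lin [] ((A ⊸ B ⊸ C) ⊸ B ⊸ A ⊸ C)
    lapp : ∀ {Θ₁ Θ₂ Θ A B} → Lin Θ₁ (A ⊸ B) → Lin Θ₂ A → Θ₁ ++ Θ₂ ↭ Θ → Lin Θ B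

  lin-↭ : ∀ {Θ Θ' A} → Θ ↭ Θ' → Lin Θ A → Lin Θ' A
  lin-↭ p lvar with refl ← ↭-singleton-inv (↭-sym p) = lvar
  lin-↭ p (lcon c) with refl ← ↭-empty-inv (↭-sym p) = lcon c
  lin-↭ p (lI A) with refl ← ↭-empty-inv (↭-sym p) = lI A
  lin-↭ p (lB A B C) with refl ← ↭-empty-inv (↭-sym p) = lB A B C
  lin-↭ p (lC A B C) with refl ← ↭-empty-inv (↭-sym p) = lC A B C
  lin-↭ p (lapp e e' q) = lapp e e' (↭-trans q p)

  ev : ∀ {Θ A} → Lin Θ A → (ℕ → Tm C₂) → Tm C₂
  ev (lvar {x}) ξ = ξ x
  ev (lcon c) ξ = φ c
  ev (lI A) ξ = Iᶜ
  ev (lB A B C) ξ = Bᶜ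
  ev (lC A B C) ξ = Cᶜ
  ev (lapp e e' p) ξ = app (ev e ξ) (ev e' ξ)

  ev-↭ : ∀ {Θ Θ' A} (p : Θ ↭ Θ') (e : Lin Θ A) ξ → ev (lin-↭ p e) ξ ≡ ev e ξ
  ev-↭ p lvar ξ with refl ← ↭-singleton-inv (↭-sym p) = refl
  ev-↭ p (lcon c) ξ with refl ← ↭-empty-inv (↭-sym p) = refl
  ev-↭ p (lI A) ξ with refl ← ↭-empty-inv (↭-sym p) = refl
  ev-↭ p (lB A B C) ξ with refl ← ↭-empty-inv (↭-sym p) = refl
  ev-↭ p (lC A B C) ξ with refl ← ↭-empty-inv (↭-sym p) = refl
  ev-↭ p (lapp e e' q) ξ = refl

  ev-cong : ∀ {Θ A} (e : Lin Θ A) {ξ ξ'} → (∀ {x B} → (x , B) ∈ Θ → ξ x ≡ ξ' x) → ev e ξ ≡ ev e ξ'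
  ev-cong lvar f = f (here refl)
  ev-cong (lcon c) f = refl
  ev-cong (lI A) f = refl
  ev-cong (lB A B C) f = refl
  ev-cong (lC A B C) f = refl
  ev-cong (lapp {Θ₁} e e' p) f =
    cong₂ app (ev-cong e (λ q → f (∈-resp-↭ p (∈-++⁺ˡ q)))) (ev-cong e' (λ q → f (∈-resp-↭ p (∈-++⁺ʳ Θ₁ q))))

  ev-shift : ∀ {Θ A} (e : Lin Θ A) ξ → shift 0 (ev e ξ) ≡ ev e (λ x → shift 0 (ξ x))
  ev-shift lvar ξ = refl
  ev-shift (lcon c) ξ = φ-closed c
  ev-shift (lI A) ξ = refl
  ev-shift (lB A B C) ξ = refl
  ev-shift (lC A B C) ξ = refl
  ev-shift (lapp e e' p) ξ = cong₂ app (ev-shift e ξ) (ev-shift e' ξ)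

  ev-fresh : ∀ {Θ A x} (e : Lin Θ A) {ξ} N → Fresh x Θ → ev e ξ ≡ ev e (upd ξ x N)
  ev-fresh {x = x} e {ξ} N fr = ev-cong e (λ q → ≡-sym (upd-other ξ {x} N (λ { refl → fr q })))

  -- Bracket abstraction removes a single occurrence of `x`, whereas the update of `ξ` reaches all
  -- of them. Hence freshness is a premise of the specification and not of the construction.
  Abstracts : ∀ {Θ Θ' A B} → ℕ → Lin Θ' B → Lin Θ (A ⊸ B) → Set
  Abstracts {Θ} x e e' = Fresh x Θ → ∀ ξ N → app (ev e' ξ) N ≈βη ev e (upd ξ x N)

  -- By linearity the occurrence lies in exactly one side of an application: `Cᶜ` serves the
  -- function side, `Bᶜ` the argument side, and `Iᶜ` the variable itself. The side without it keeps
  -- its value under the update because `x` is fresh there.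
  abstraction : ∀ {Θ Θ' x A B} (e : Lin Θ' B) → Θ' ↭ (x , A) ∷ Θ →
                Σ (Lin Θ (A ⊸ B)) (Abstracts x e)
  abstraction {x = x} (lvar {A = A}) p with refl ← ↭-singleton-inv (↭-sym p) =
    lI A , λ _ ξ N → ≈trans (I-≈ N) (≡⇒≈ (≡-sym (upd-same ξ x N)))
  abstraction (lcon c) p with () ← ↭-empty-inv (↭-sym p)
  abstraction (lI A) p with () ← ↭-empty-inv (↭-sym p)
  abstraction (lB A B C) p with () ← ↭-empty-inv (↭-sym p)
  abstraction (lC A B C) p with () ← ↭-empty-inv (↭-sym p)
  abstraction {Θ} {x = x} {A} (lapp {Θ₁} {Θ₂} e₁ e₂ q) p
    with ∈-++⁻ Θ₁ (∈-resp-↭ (↭-sym (↭-trans q p)) (here refl))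
  ... | inj₁ i with ∈⇒↭ i
  ...   | Θ₁' , s with abstraction e₁ s
  ...     | e₁' , spec = lapp (lapp (lC _ _ _) e₁' ↭-refl) e₂ u ,
      λ fr ξ N → ≈trans (C-≈ _ _ _) (≈app (spec (λ m → fr (∈-resp-↭ u (∈-++⁺ˡ m))) ξ N)
                   (≡⇒≈ (ev-fresh e₂ N (λ m → fr (∈-resp-↭ u (∈-++⁺ʳ Θ₁' m))))))
    where
    u : Θ₁' ++ Θ₂ ↭ Θ
    u = drop-∷ (↭-trans (↭-sym (++⁺ʳ Θ₂ s)) (↭-trans q p))
  abstraction {Θ} {x = x} {A} (lapp {Θ₁} {Θ₂} e₁ e₂ q) p | inj₂ i with ∈⇒↭ i
  ...   | Θ₂' , s with abstraction e₂ s
  ...     | e₂' , spec = lapp (lapp (lB _ _ _) e₁ ↭-refl) e₂' u ,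
      λ fr ξ N → ≈trans (B-≈ _ _ _) (≈app
                   (≡⇒≈ (ev-fresh e₁ N (λ m → fr (∈-resp-↭ u (∈-++⁺ˡ m)))))
                   (spec (λ m → fr (∈-resp-↭ u (∈-++⁺ʳ Θ₁ m))) ξ N))
    where
    u : Θ₁ ++ Θ₂' ↭ Θ
    u = drop-∷ (↭-trans (↭-sym (↭-trans (++⁺ˡ Θ₁ s) (↭-shift (x , A) Θ₁ Θ₂'))) (↭-trans q p))

  -- Variables of a de Bruijn context are named by their level.
  levels : Ctx At → World At
  levels []            = []
  levels (nothing ∷ Γ) = levels Γ
  levels (just A ∷ Γ)  = (length Γ , A) ∷ levels Γ

  level : ℕ → ℕ → Tm C₂
  level k l = var (k ∸ suc l)

  levels-empty : ∀ {Γ} → Empty Γ → levels Γ ≡ []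
  levels-empty [] = refl
  levels-empty (refl ∷ e) = levels-empty e

  levels-only : ∀ {i A Γ} → Only i A Γ → levels Γ ≡ (length Γ ∸ suc i , A) ∷ []
  levels-only (here e)  = cong (_ ∷_) (levels-empty e)
  levels-only (there o) = levels-only o

  levels-merge : ∀ {Γ Δ Θ} → Merge Γ Δ Θ → levels Γ ++ levels Δ ↭ levels Θ
  levels-merge [] = ↭-refl
  levels-merge (left m) rewrite proj₁ (merge-length m) = prep _ (levels-merge m)
  levels-merge (right {Γ = Γ} {Δ} m) rewrite proj₂ (merge-length m) =
    ↭-trans (↭-shift _ (levels Γ) (levels Δ)) (prep _ (levels-merge m))
  levels-merge (none m) = levels-merge m

  levels-bound : ∀ Γ {y A} → (y , A) ∈ levels Γ → y < length Γ
  levels-bound (nothing ∷ Γ) p = m≤n⇒m≤1+n (levels-bound Γ p)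
  levels-bound (just _ ∷ Γ) (here refl) = ≤-refl
  levels-bound (just _ ∷ Γ) (there p) = m≤n⇒m≤1+n (levels-bound Γ p)

  level-only : ∀ {i k} → i < k → k ∸ suc (k ∸ suc i) ≡ i
  level-only {i} {suc k} (s≤s p) = m∸[m∸n]≡n p

  -- Under a binder the level of a variable stays and its index grows. This stability is the reason
  -- for naming by levels.
  level-suc : ∀ k {y} → y < k → shift 0 (level k y) ≡ level (suc k) y
  level-suc (suc k) {y} (s≤s p) = cong var (≡-sym (+-∸-assoc 1 p))

  compile : ∀ {Γ t A} → Typing 𝔗 Γ t A →
            Σ (Lin (levels Γ) A) λ e → ev e (level (length Γ)) ≈βη mapTm φ t
  compile (tvar o) rewrite levels-only o = lvar , ≡⇒≈ (cong var (level-only (only-bound o)))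
  compile (tcon {c} e) rewrite levels-empty e = lcon c , ≈refl
  compile (tapp d d' m) with compile d | compile d'
  ... | e , s | e' , s' rewrite proj₁ (merge-length m) | proj₂ (merge-length m) = lapp e e' (levels-merge m) , ≈app s s'
  compile {Γ} (tlam {t = t} d) with compile d
  ... | e , s with abstraction e ↭-refl
  ...   | e' , spec = e' ,
      -- After η-expansion the specification of `e'` applies with `var 0` as the argument.
      ≈trans (≈sym (η _)) (≈lam (≈trans (≈app (≡⇒≈ (ev-shift e' _)) ≈refl)
        (≈trans (spec (λ m → <-irrefl refl (levels-bound Γ m)) _ _) (≈trans (≡⇒≈ (ev-cong e agree)) s))))
    where
    k = length Γ
    ξ : ℕ → Tm C₂
    ξ y = shift 0 (level k y)
    agree : ∀ {x B} → (x , B) ∈ levels (just _ ∷ Γ) →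
            upd ξ k (var 0) x ≡ level (suc k) x
    agree (here refl) = trans (upd-same ξ k (var 0)) (cong var (≡-sym (n∸n≡0 k)))
    agree {x} (there m) = trans (upd-other ξ {k} (var 0) (λ { refl → <-irrefl refl (levels-bound Γ m) }))
                            (level-suc k (levels-bound Γ m))

  -- The combinators contain no constants, so `mapTm φ` fixes them and the equality is syntactic.
  decompile : ∀ {A} (e : Lin [] A) → Σ (Tm Con) λ t → Typing 𝔗 [] t A × (∀ ξ → mapTm φ t ≡ ev e ξ)
  decompile (lcon c) = con c , tcon [] , λ _ → refl
  decompile (lI A) = Iᶜ , tlam (tvar (here [])) , λ _ → refl
  decompile (lB A B C) = Bᶜ ,
    tlam (tlam (tlam (tapp (tvar (there (there (here []))))
      (tapp (tvar (there (here (refl ∷ [])))) (tvar (here (refl ∷ refl ∷ [])))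
        (right (left (none []))))
      (right (right (left [])))))) , λ _ → refl
  decompile (lC A B C) = Cᶜ ,
    tlam (tlam (tlam (tapp (tapp (tvar (there (there (here [])))) (tvar (here (refl ∷ refl ∷ [])))
        (right (none (left []))))
      (tvar (there (here (refl ∷ []))))
      (left (right (left [])))))) , λ _ → refl
  decompile (lapp {[]} {[]} e e' p) with decompile e | decompile e'
  ... | t , d , f | t' , d' , f' = app t t' , tapp d d' [] , λ ξ → cong₂ app (f ξ) (f' ξ)
  decompile (lapp {[]} {_ ∷ _} e e' p) with () ← ↭-empty-inv p
  decompile (lapp {_ ∷ _} e e' p) with () ← ↭-empty-inv p

-- Lookup in concatenated and reversed lists.

<⇒<ᵇ-true : ∀ {p n} → p < n → (p <ᵇ n) ≡ true
<⇒<ᵇ-true {zero} (s≤s _) = refl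
<⇒<ᵇ-true {suc p} {suc n} (s≤s q) = <⇒<ᵇ-true q

≤⇒<ᵇ-false : ∀ {p n} → n ≤ p → (p <ᵇ n) ≡ false
≤⇒<ᵇ-false {p} z≤n = refl
≤⇒<ᵇ-false (s≤s q) = ≤⇒<ᵇ-false q

module _ {X : Set} where

  !!-++ˡ : ∀ (xs : List X) {ys p x} → xs !! p ≡ just x → (xs ++ ys) !! p ≡ just x
  !!-++ˡ (_ ∷ xs) {p = zero} e = e
  !!-++ˡ (_ ∷ xs) {p = suc p} e = !!-++ˡ xs e

  !!-++ʳ : ∀ (xs : List X) {ys q} → (xs ++ ys) !! (length xs + q) ≡ ys !! q
  !!-++ʳ [] = refl
  !!-++ʳ (_ ∷ xs) = !!-++ʳ xs

  !!-++⁻ : ∀ (xs : List X) {ys p x} → (xs ++ ys) !! p ≡ just x →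
           (p < length xs × xs !! p ≡ just x) ⊎ (Σ ℕ λ q → p ≡ length xs + q × ys !! q ≡ just x)
  !!-++⁻ [] e = inj₂ (_ , refl , e)
  !!-++⁻ (x ∷ xs) {p = zero} e = inj₁ (s≤s z≤n , e)
  !!-++⁻ (x ∷ xs) {p = suc p} e with !!-++⁻ xs e
  ... | inj₁ (l , e') = inj₁ (s≤s l , e')
  ... | inj₂ (q , e' , e'') = inj₂ (q , cong suc e' , e'')

  !!-bound : ∀ (xs : List X) {p x} → xs !! p ≡ just x → p < length xs
  !!-bound (_ ∷ xs) {zero} e = s≤s z≤n
  !!-bound (_ ∷ xs) {suc p} e = s≤s (!!-bound xs e)

  !!-reverse⁻ : ∀ (xs : List X) {q x} → reverse xs !! q ≡ just x → xs !! (length xs ∸ 1 ∸ q) ≡ just x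
  !!-reverse⁻ (y ∷ xs) {q} e with !!-++⁻ (reverse xs) (trans (cong (_!! q) (≡-sym (unfold-reverse y xs))) e)
  ... | inj₁ (l , e') = trans (cong ((y ∷ xs) !!_) (idx l)) (!!-reverse⁻ xs e')
    where
    idx : ∀ {q} → q < length (reverse xs) → length xs ∸ q ≡ suc (length xs ∸ 1 ∸ q)
    idx l rewrite length-reverse xs with length xs | l
    ... | suc n | s≤s l' = +-∸-assoc 1 l'
  ... | inj₂ (zero , refl , e') = trans (cong ((y ∷ xs) !!_) idx) e'
    where
    idx : length xs ∸ (length (reverse xs) + 0) ≡ 0
    idx rewrite length-reverse xs | +-identityʳ (length xs) = n∸n≡0 (length xs)

  !!-reverse : ∀ (xs : List X) {q x} → xs !! q ≡ just x → reverse xs !! (length xs ∸ 1 ∸ q) ≡ just x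
  !!-reverse xs {q} {x} e =
    ≡-subst (λ n → reverse xs !! (n ∸ 1 ∸ q) ≡ just x) (length-reverse xs)
      (!!-reverse⁻ (reverse xs) (trans (cong (_!! q) (reverse-involutive xs)) e))

-- Valuations of boundary vertices.

module Valuations (T : Set) where

  Val : Set
  Val = List T × ℕ

  -- The second component of a valuation strictly decreases along every edge,
  -- so a satisfiable set of edges contains no cycle.
  Reads : List T → Val → Val → Set
  Reads w x y = (proj₁ x ≡ w ++ proj₁ y) × (proj₂ y < proj₂ x)

  reads-trans : ∀ {w w' x y z} → Reads w x y → Reads w' y z → Reads (w ++ w') x z
  reads-trans {w} {w'} (e , l) (e' , l') =
    trans e (trans (cong (w ++_) e') (≡-sym (++-assoc w w' _))) , <-trans l' l

  -- A vertex beyond the end of a valuation has the value `nothing`, which satisfies no edge.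
  -- Satisfaction thereby also bounds the endpoints.
  data Reads? (w : List T) : Maybe Val → Maybe Val → Set where
    reads : ∀ {x y} → Reads w x y → Reads? w (just x) (just y)

  reads?-trans : ∀ {w w' x y z} → Reads? w x y → Reads? w' y z → Reads? (w ++ w') x z
  reads?-trans (reads r) (reads r') = reads (reads-trans r r')

  EdgeSat : ∀ {V : Set} → (V → Maybe Val) → Edge V T → Set
  EdgeSat ν (u , w , v) = Reads? w (ν u) (ν v)

  SatE : ∀ {V : Set} → (V → Maybe Val) → List (Edge V T) → Set
  SatE ν = All (EdgeSat ν)

  satE-map : ∀ {V W : Set} {ν : V → Maybe Val} {ν' : W → Maybe Val} (f : V → W) →
             (∀ {u x} → ν u ≡ just x → ν' (f u) ≡ just x) → ∀ {es} → SatE ν es → SatE ν' (mapE f es)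
  satE-map {ν = ν} {ν'} f h [] = []
  satE-map {ν = ν} {ν'} f h {(u , w , v) ∷ es} (r ∷ rs) = go r refl refl ∷ satE-map f h rs
    where
    go : ∀ {a b} → Reads? w a b → ν u ≡ a → ν v ≡ b → Reads? w (ν' (f u)) (ν' (f v))
    go (reads r) e e' rewrite h e | h e' = reads r

  -- A join eliminates the value of the inner vertex by transitivity, and removing a loop removes a
  -- constraint.
  glue-satE : ∀ {ν : ℕ ⊎ ℕ → Maybe Val} {es cs r} → Glue es cs r → SatE ν es → SatE (ν ∘ inj₁) (edges r)
  glue-satE (done es cs) s = outer es s
    where
    outer : ∀ {ν : ℕ ⊎ ℕ → Maybe Val} es → SatE ν (mapE inj₁ es) → SatE (ν ∘ inj₁) es
    outer [] [] = []
    outer (e ∷ es) (r ∷ rs) = r ∷ outer es rs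
  glue-satE (join p g) s with All-resp-↭ p s
  ... | r ∷ r' ∷ rs = glue-satE g (reads?-trans r r' ∷ rs)
  glue-satE (loop p g) s with All-resp-↭ p s
  ... | _ ∷ rs = glue-satE g rs

  Sat : MW T → List Val → Set
  Sat σ ρ = SatE (ρ !!_) (edges σ)

  -- Solutions of the identity cowordism, cut into its two halves: the words agree, and the number
  -- drops from the source of each edge to its target. Because of the drop this is a strict relation
  -- in place of equality.
  data Shift : Boundary → List Val → List Val → Set where
    []    : Shift [] [] []
    left  : ∀ {X x y ρ ρ'} → Reads [] x y → Shift X ρ ρ' → Shift (true ∷ X) (x ∷ ρ) (y ∷ ρ')
    right : ∀ {X x y ρ ρ'} → Reads [] y x → Shift X ρ ρ' → Shift (false ∷ X) (x ∷ ρ) (y ∷ ρ')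

  shift-++ : ∀ {X Y ρ ρ' τ τ'} → Shift X ρ ρ' → Shift Y τ τ' → Shift (X ++ Y) (ρ ++ τ) (ρ' ++ τ')
  shift-++ [] s = s
  shift-++ (left r p) s = left r (shift-++ p s)
  shift-++ (right r p) s = right r (shift-++ p s)

  perp-∷ : ∀ x X → perp (x ∷ X) ≡ perp X ++ not x ∷ []
  perp-∷ x X = unfold-reverse (not x) (map not X)

  shift-perp : ∀ {X ρ ρ'} → Shift X ρ ρ' → Shift (perp X) (reverse ρ') (reverse ρ)
  shift-perp [] = []
  shift-perp {true ∷ X} {x ∷ ρ} {y ∷ ρ'} (left r s)
    rewrite perp-∷ true X | unfold-reverse x ρ | unfold-reverse y ρ' = shift-++ (shift-perp s) (right r [])
  shift-perp {false ∷ X} {x ∷ ρ} {y ∷ ρ'} (right r s)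
    rewrite perp-∷ false X | unfold-reverse x ρ | unfold-reverse y ρ' = shift-++ (shift-perp s) (left r [])

  shift-length : ∀ {X ρ ρ'} → Shift X ρ ρ' → (length ρ ≡ length X) × (length ρ' ≡ length X)
  shift-length [] = refl , refl
  shift-length (left _ s) = cong suc (proj₁ (shift-length s)) , cong suc (proj₂ (shift-length s))
  shift-length (right _ s) = cong suc (proj₁ (shift-length s)) , cong suc (proj₂ (shift-length s))

  shift-!! : ∀ {X ρ ρ' p} → Shift X ρ ρ' → p < length X →
             Σ Val λ x → Σ Val λ y → (ρ !! p ≡ just x) × (ρ' !! p ≡ just y) ×
               (atB X p ≡ true → Reads [] x y) × (atB X p ≡ false → Reads [] y x)
  shift-!! {p = zero} (left r s) _ = _ , _ , refl , refl , (λ _ → r) , λ ()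
  shift-!! {p = zero} (right r s) _ = _ , _ , refl , refl , (λ ()) , λ _ → r
  shift-!! {p = suc p} (left _ s) (s≤s l) = shift-!! s l
  shift-!! {p = suc p} (right _ s) (s≤s l) = shift-!! s l

  idMW-sat : ∀ {X ρ ρ'} → Shift X ρ ρ' → Sat (idMW X) (ρ ++ reverse ρ')
  idMW-sat {X} {ρ} {ρ'} s = All-map⁺ (applyUpTo⁺₁ id (length X) edge)
    where
    m = length X
    far : ∀ {p y} → ρ' !! p ≡ just y → (ρ ++ reverse ρ') !! (m + m ∸ 1 ∸ p) ≡ just y
    far {p} e = trans (cong ((ρ ++ reverse ρ') !!_) idx) (trans (!!-++ʳ ρ) (!!-reverse ρ' e))
      where
      l : p < m
      l = ≡-subst (p <_) (proj₂ (shift-length s)) (!!-bound ρ' e)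
      idx : m + m ∸ 1 ∸ p ≡ length ρ + (length ρ' ∸ 1 ∸ p)
      idx rewrite proj₁ (shift-length s) | proj₂ (shift-length s) with m | l
      ... | suc n | s≤s l' = trans (cong (_∸ p) (+-suc n n)) (trans (+-∸-assoc (suc n) l') refl)
    edge : ∀ {p} → p < m → EdgeSat ((ρ ++ reverse ρ') !!_)
             (if atB X p then (p , [] , (m + m ∸ 1) ∸ p) else ((m + m ∸ 1) ∸ p , [] , p))
    edge {p} l with shift-!! s l
    ... | x , y , e , e' , f , g with atB X p
    ...   | true  rewrite !!-++ˡ ρ {reverse ρ'} e | far e' = reads (f refl)
    ...   | false rewrite !!-++ˡ ρ {reverse ρ'} e | far e' = reads (g refl)

  flat : List (List Val) → List Val
  flat []       = []
  flat (ρ ∷ ρs) = flat ρs ++ ρ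

  flat-++ : ∀ ρs ρs' → flat (ρs ++ ρs') ≡ flat ρs' ++ flat ρs
  flat-++ [] ρs' = ≡-sym (++-identityʳ _)
  flat-++ (ρ ∷ ρs) ρs' = trans (cong (_++ ρ) (flat-++ ρs ρs')) (++-assoc (flat ρs') (flat ρs) ρ)

  SatΓ : MW T → List (List Val) → Set
  SatΓ σ ρs = Sat σ (flat ρs)

-- Position maps of the sequent rules, block by block.

module Blocks (nLit : ℕ) (bnd : Fin nLit → Boundary) (T : Set) where
  open LL nLit bnd T

  exPos₁ : ∀ d b a {p} → p < d → exPos d b a p ≡ p
  exPos₁ d b a l rewrite <⇒<ᵇ-true l = refl

  exPos₂ : ∀ d b a {i} → i < b → exPos d b a (d + i) ≡ (d + a) + i
  exPos₂ d b a {i} l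
    rewrite ≤⇒<ᵇ-false (m≤m+n d i) | <⇒<ᵇ-true (+-monoʳ-< d l) =
      trans (+-assoc d i a) (trans (cong (d +_) (+-comm i a)) (≡-sym (+-assoc d a i)))

  exPos₃ : ∀ d b a {i} → i < a → exPos d b a ((d + b) + i) ≡ d + i
  exPos₃ d b a {i} l
    rewrite ≤⇒<ᵇ-false (≤-trans (m≤m+n d b) (m≤m+n (d + b) i)) | ≤⇒<ᵇ-false (m≤m+n (d + b) i)
          | <⇒<ᵇ-true (+-monoʳ-< (d + b) l) | +-assoc d b i | +-comm b i | ≡-sym (+-assoc d i b) =
      m+n∸n≡m (d + i) b

  exPos₄ : ∀ d b a {i} → exPos d b a (((d + b) + a) + i) ≡ ((d + a) + b) + i
  exPos₄ d b a {i}
    rewrite ≤⇒<ᵇ-false (≤-trans (m≤m+n d b) (≤-trans (m≤m+n (d + b) a) (m≤m+n (d + b + a) i)))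
          | ≤⇒<ᵇ-false (≤-trans (m≤m+n (d + b) a) (m≤m+n (d + b + a) i))
          | ≤⇒<ᵇ-false (m≤m+n (d + b + a) i) =
      cong (_+ i) (trans (+-assoc d b a) (trans (cong (d +_) (+-comm b a)) (≡-sym (+-assoc d a b))))

  tensL₁ : ∀ d a b {p} → p < a → tensL d a b p ≡ d + p
  tensL₁ d a b l rewrite <⇒<ᵇ-true l = refl

  tensL₂ : ∀ d a b {i} → tensL d a b (a + i) ≡ ((d + a) + b) + i
  tensL₂ d a b {i} rewrite ≤⇒<ᵇ-false (m≤m+n a i) =
    trans (≡-sym (+-assoc (d + b) a i))
      (cong (_+ i) (trans (+-assoc d b a) (trans (cong (d +_) (+-comm b a)) (≡-sym (+-assoc d a b)))))

  tensR₁ : ∀ d a {p} → p < d → tensR d a p ≡ p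
  tensR₁ d a l rewrite <⇒<ᵇ-true l = refl

  tensR₂ : ∀ d a {i} → tensR d a (d + i) ≡ (d + a) + i
  tensR₂ d a {i} rewrite ≤⇒<ᵇ-false (m≤m+n d i) =
    trans (+-assoc d i a) (trans (cong (d +_) (+-comm i a)) (≡-sym (+-assoc d a i)))

  cutL₁ : ∀ d a {p} → p < a → cutL d a p ≡ inj₂ p
  cutL₁ d a l rewrite <⇒<ᵇ-true l = refl

  cutL₂ : ∀ d a {i} → cutL d a (a + i) ≡ inj₁ (d + i)
  cutL₂ d a {i} rewrite ≤⇒<ᵇ-false (m≤m+n a i) = cong (λ j → inj₁ (d + j)) (m+n∸m≡n a i)

  cutR₁ : ∀ d a {p} → p < d → cutR d a p ≡ inj₁ p
  cutR₁ d a l rewrite <⇒<ᵇ-true l = refl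

  cutR₂ : ∀ d a {i} → cutR d a (d + i) ≡ inj₂ (a ∸ 1 ∸ i)
  cutR₂ d a {i} rewrite ≤⇒<ᵇ-false (m≤m+n d i) = cong (λ j → inj₂ (a ∸ 1 ∸ j)) (m+n∸m≡n d i)

-- Valuations under the sequent rules.

module RuleSat (nLit : ℕ) (bnd : Fin nLit → Boundary) (T : Set) where
  open LL nLit bnd T
  open Blocks nLit bnd T
  open Valuations T

  at : ∀ (ρ : List Val) {p q x} → p ≡ q → ρ !! q ≡ just x → ρ !! p ≡ just x
  at ρ refl e = e

  at++ : ∀ (ρ : List Val) {ρ' n p q x} → p ≡ n + q → length ρ ≡ n → ρ' !! q ≡ just x → (ρ ++ ρ') !! p ≡ just x
  at++ ρ refl refl e = trans (!!-++ʳ ρ) e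

  exR-!! : ∀ δ ε α γ {p x} → (((δ ++ ε) ++ α) ++ γ) !! p ≡ just x →
           (((δ ++ α) ++ ε) ++ γ) !! exPos (length δ) (length ε) (length α) p ≡ just x
  exR-!! δ ε α γ e with !!-++⁻ ((δ ++ ε) ++ α) e
  ... | inj₂ (q , refl , e') rewrite length-++ (δ ++ ε) {α} | length-++ δ {ε} =
        at++ ((δ ++ α) ++ ε) (exPos₄ (length δ) (length ε) (length α))
          (trans (length-++ (δ ++ α)) (cong (_+ length ε) (length-++ δ))) e'
  ... | inj₁ (_ , e₁) with !!-++⁻ (δ ++ ε) e₁
  ...   | inj₂ (q , refl , e') rewrite length-++ δ {ε} =
        !!-++ˡ ((δ ++ α) ++ ε) (!!-++ˡ (δ ++ α)
          (at++ δ (exPos₃ (length δ) (length ε) (length α) (!!-bound α e')) refl e'))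
  ...   | inj₁ (_ , e₂) with !!-++⁻ δ e₂
  ...     | inj₂ (q , refl , e') =
        !!-++ˡ ((δ ++ α) ++ ε)
          (at++ (δ ++ α) (exPos₂ (length δ) (length ε) (length α) (!!-bound ε e')) (length-++ δ) e')
  ...     | inj₁ (l , e') =
        !!-++ˡ ((δ ++ α) ++ ε) (!!-++ˡ (δ ++ α) (!!-++ˡ δ (at δ (exPos₁ (length δ) (length ε) (length α) l) e')))

  exR-sat : ∀ {σ d b a} γ ρA ρB δ → length (flat δ) ≡ d → length ρB ≡ b → length ρA ≡ a →
            SatΓ σ (γ ++ ρA ∷ ρB ∷ δ) → SatΓ (relabel (exPos d b a) σ) (γ ++ ρB ∷ ρA ∷ δ)
  exR-sat {σ} γ ρA ρB δ refl refl refl s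
    rewrite flat-++ γ (ρA ∷ ρB ∷ δ) | flat-++ γ (ρB ∷ ρA ∷ δ) =
    satE-map (exPos (length (flat δ)) (length ρB) (length ρA)) (exR-!! (flat δ) ρB ρA (flat γ)) s

  parR-sat : ∀ {σ} γ ρA ρB → SatΓ σ (γ ++ ρA ∷ ρB ∷ []) → SatΓ σ (γ ++ (ρB ++ ρA) ∷ [])
  parR-sat γ ρA ρB s rewrite flat-++ γ (ρA ∷ ρB ∷ []) | flat-++ γ ((ρB ++ ρA) ∷ []) = s

  tenR-sat : ∀ {σ₁ σ₂ d a b cs} γ ρA ρB δ → length (flat δ) ≡ d → length ρA ≡ a → length ρB ≡ b →
             SatΓ σ₁ (γ ++ ρA ∷ []) → SatΓ σ₂ (ρB ∷ δ) →
             SatΓ (mw (mapE (tensR d a) (edges σ₂) ++ mapE (tensL d a b) (edges σ₁)) cs)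
                  (γ ++ (ρA ++ ρB) ∷ δ)
  tenR-sat γ ρA ρB δ refl refl refl s₁ s₂
    rewrite flat-++ γ (ρA ∷ []) | flat-++ γ ((ρA ++ ρB) ∷ δ) | ≡-sym (++-assoc (flat δ) ρA ρB) =
    All-++⁺ (satE-map _ r s₂) (satE-map _ l s₁)
    where
    ρ = ((flat δ ++ ρA) ++ ρB) ++ flat γ
    d = length (flat δ)
    a = length ρA
    b = length ρB
    r : ∀ {p x} → (flat δ ++ ρB) !! p ≡ just x → ρ !! tensR d a p ≡ just x
    r e with !!-++⁻ (flat δ) e
    ... | inj₁ (l , e') = !!-++ˡ ((flat δ ++ ρA) ++ ρB) (!!-++ˡ (flat δ ++ ρA) (!!-++ˡ (flat δ) (at (flat δ) (tensR₁ d a l) e')))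
    ... | inj₂ (q , refl , e') =
      !!-++ˡ ((flat δ ++ ρA) ++ ρB) (at++ (flat δ ++ ρA) (tensR₂ d a) (length-++ (flat δ)) e')
    l : ∀ {p x} → (ρA ++ flat γ) !! p ≡ just x → ρ !! tensL d a b p ≡ just x
    l e with !!-++⁻ ρA e
    ... | inj₁ (l , e') = !!-++ˡ ((flat δ ++ ρA) ++ ρB) (!!-++ˡ (flat δ ++ ρA) (at++ (flat δ) (tensL₁ d a b l) refl e'))
    ... | inj₂ (q , refl , e') =
      at++ ((flat δ ++ ρA) ++ ρB) (tensL₂ d a b)
        (trans (length-++ (flat δ ++ ρA)) (cong (_+ b) (length-++ (flat δ)))) e'

  cutVal : List (List Val) → List (List Val) → List Val → ℕ ⊎ ℕ → Maybe Val
  cutVal γ δ ρA (inj₁ p) = flat (γ ++ δ) !! p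
  cutVal γ δ ρA (inj₂ p) = ρA !! p

  -- The dual block is read backwards, so `reverse ρA` gives each glued vertex the value that `ρA`
  -- gives it in the other premise. The two solutions hence combine into one, already before any
  -- gluing.
  cut-satE : ∀ {σ₁ σ₂ d a} γ ρA δ → length (flat δ) ≡ d → length ρA ≡ a →
             SatΓ σ₁ (γ ++ ρA ∷ []) → SatΓ σ₂ (reverse ρA ∷ δ) →
             SatE (cutVal γ δ ρA) (mapE (cutR d a) (edges σ₂) ++ mapE (cutL d a) (edges σ₁))
  cut-satE γ ρA δ refl refl s₁ s₂ rewrite flat-++ γ (ρA ∷ []) =
    All-++⁺ (satE-map _ r s₂) (satE-map _ l s₁)
    where
    d = length (flat δ)
    a = length ρA
    at' : ∀ {u v x} → u ≡ v → cutVal γ δ ρA v ≡ just x → cutVal γ δ ρA u ≡ just x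
    at' refl e = e
    outer : ∀ {p x} → (flat δ ++ flat γ) !! p ≡ just x → flat (γ ++ δ) !! p ≡ just x
    outer {p} e = trans (cong (_!! p) (flat-++ γ δ)) e
    r : ∀ {p x} → (flat δ ++ reverse ρA) !! p ≡ just x → cutVal γ δ ρA (cutR d a p) ≡ just x
    r e with !!-++⁻ (flat δ) e
    ... | inj₁ (l , e') = at' (cutR₁ d a l) (outer (!!-++ˡ (flat δ) e'))
    ... | inj₂ (q , refl , e') = at' (cutR₂ d a) (!!-reverse⁻ ρA e')
    l : ∀ {p x} → (ρA ++ flat γ) !! p ≡ just x → cutVal γ δ ρA (cutL d a p) ≡ just x
    l e with !!-++⁻ ρA e
    ... | inj₁ (l , e') = at' (cutL₁ d a l) e'
    ... | inj₂ (q , refl , e') = at' (cutL₂ d a) (outer (at++ (flat δ) refl refl e'))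

  cut-sat : ∀ {σ₁ σ₂ τ d a cs} γ ρA δ → length (flat δ) ≡ d → length ρA ≡ a →
            SatΓ σ₁ (γ ++ ρA ∷ []) → SatΓ σ₂ (reverse ρA ∷ δ) →
            Glue (mapE (cutR d a) (edges σ₂) ++ mapE (cutL d a) (edges σ₁)) cs τ →
            SatΓ τ (γ ++ δ)
  cut-sat {σ₁} {σ₂} γ ρA δ e e' s₁ s₂ g = glue-satE g (cut-satE {σ₁} {σ₂} γ ρA δ e e' s₁ s₂)

  Fits : List (Fm nLit) → List (List Val) → Set
  Fits = Pointwise (λ A ρ → length ρ ≡ length (bndF A))

  fits-flat : ∀ {Γ ρs} → Fits Γ ρs → length (flat ρs) ≡ length (bndCtx Γ)
  fits-flat [] = refl
  fits-flat {A ∷ Γ} {ρ ∷ ρs} (e ∷ f) =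
    trans (length-++ (flat ρs)) (trans (cong₂ _+_ (fits-flat f) e) (≡-sym (length-++ (bndCtx Γ))))

-- Perfect matchings, sorted by polarity.

endpoint : ∀ {V T : Set} → Bool → Edge V T → V
endpoint true  (u , _ , _) = u
endpoint false (_ , _ , v) = v

ends : ∀ {V T : Set} → Bool → List (Edge V T) → List V
ends b = map (endpoint b)

ends-mapE : ∀ {V W T : Set} (f : V → W) b (es : List (Edge V T)) → ends b (mapE f es) ≡ map f (ends b es)
ends-mapE f b [] = refl
ends-mapE f true (e ∷ es) = cong (_ ∷_) (ends-mapE f true es)
ends-mapE f false (e ∷ es) = cong (_ ∷_) (ends-mapE f false es)

_==_ : Bool → Bool → Bool
true  == b = b
false == b = not b

positions : Bool → ℕ → Boundary → List ℕ
positions b o []      = []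
positions b o (x ∷ X) = if x == b then o ∷ positions b (suc o) X else positions b (suc o) X

positions-++ : ∀ b o X Y → positions b o (X ++ Y) ≡ positions b o X ++ positions b (o + length X) Y
positions-++ b o [] Y = cong (λ n → positions b n Y) (≡-sym (+-identityʳ o))
positions-++ b o (x ∷ X) Y rewrite +-suc o (length X) with x == b
... | true  = cong (o ∷_) (positions-++ b (suc o) X Y)
... | false = positions-++ b (suc o) X Y

map-positions : ∀ {W : Set} (f g : ℕ → W) b o o' X → (∀ {i} → i < length X → f (o + i) ≡ g (o' + i)) →
                map f (positions b o X) ≡ map g (positions b o' X)
map-positions f g b o o' [] h = refl
map-positions f g b o o' (x ∷ X) h with x == b
... | false = map-positions f g b (suc o) (suc o') X
                (λ {i} l → ≡-subst (λ n → f n ≡ g (suc o' + i)) (+-suc o i)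
                  (≡-subst (λ n → f (o + suc i) ≡ g n) (+-suc o' i) (h (s≤s l))))
... | true = cong₂ _∷_
               (≡-subst (λ n → f n ≡ g o') (+-identityʳ o) (≡-subst (λ n → f (o + 0) ≡ g n) (+-identityʳ o') (h (s≤s z≤n))))
               (map-positions f g b (suc o) (suc o') X
                (λ {i} l → ≡-subst (λ n → f n ≡ g (suc o' + i)) (+-suc o i)
                  (≡-subst (λ n → f (o + suc i) ≡ g n) (+-suc o' i) (h (s≤s l)))))

move-positions : ∀ (f : ℕ → ℕ) b o o' X → (∀ {i} → i < length X → f (o + i) ≡ o' + i) →
                 map f (positions b o X) ≡ positions b o' X
move-positions f b o o' X h = trans (map-positions f id b o o' X h) (map-id _)

positions-suc : ∀ b o X → positions b (suc o) X ≡ map suc (positions b o X)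
positions-suc b o X = ≡-sym (move-positions suc b o (suc o) X (λ _ → refl))

length-perp : ∀ X → length (perp X) ≡ length X
length-perp X = trans (length-reverse (map not X)) (length-map not X)

not-not : ∀ x b → (not x == b) ≡ (x == not b)
not-not true true = refl
not-not true false = refl
not-not false true = refl
not-not false false = refl

positions-perp : ∀ b o X → positions b o (perp X) ↭ map (λ p → o + (length X ∸ 1 ∸ p)) (positions (not b) 0 X)
positions-perp b o [] = ↭-refl
positions-perp b o (x ∷ X) =
  ↭-trans (↭-reflexive (trans (cong (positions b o) (unfold-reverse (not x) (map not X)))
                              (positions-++ b o (perp X) (not x ∷ []))))
  (↭-trans (++⁺ʳ _ (positions-perp b o X)) last)
  where
  n = length X
  rest : map (λ p → o + (n ∸ 1 ∸ p)) (positions (not b) 0 X) ≡ map (λ p → o + (n ∸ p)) (positions (not b) 1 X)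
  rest = map-positions _ _ (not b) 0 1 X (λ {i} _ → cong (o +_) (∸-+-assoc n 1 i))
  last : map (λ p → o + (n ∸ 1 ∸ p)) (positions (not b) 0 X) ++ positions b (o + length (perp X)) (not x ∷ []) ↭
         map (λ p → o + (n ∸ p)) (positions (not b) 0 (x ∷ X))
  last rewrite rest | length-perp X | not-not x b with x == not b
  ... | true  = ++-comm _ (o + n ∷ [])
  ... | false = ↭-reflexive (++-identityʳ _)

-- Serves twice: with a reflection for `h` it yields the endpoints of identity edges, and with two
-- identity maps it splits all vertices into left and right ones.
select-positions : ∀ {W : Set} (f h : ℕ → W) b X →
  map (λ p → if atB X p == b then f p else h p) (upTo (length X)) ↭
  map f (positions b 0 X) ++ map h (positions (not b) 0 X)
select-positions f h b [] = ↭-refl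
select-positions f h b (x ∷ X)
  rewrite positions-suc b 0 X | positions-suc (not b) 0 X
  = go x b (↭-trans (↭-reflexive later) (select-positions (f ∘ suc) (h ∘ suc) b X))
  where
  F = λ p → if atB (x ∷ X) p == b then f p else h p
  later : map F (applyUpTo suc (length X)) ≡ map (F ∘ suc) (upTo (length X))
  later = trans (cong (map F) (≡-sym (map-applyUpTo id suc (length X)))) (≡-sym (map-∘ (upTo (length X))))
  go : ∀ x b {zs} →
       zs ↭ map (f ∘ suc) (positions b 0 X) ++ map (h ∘ suc) (positions (not b) 0 X) →
       (if x == b then f 0 else h 0) ∷ zs ↭
       map f (if x == b then 0 ∷ map suc (positions b 0 X) else map suc (positions b 0 X)) ++
       map h (if x == not b then 0 ∷ map suc (positions (not b) 0 X) else map suc (positions (not b) 0 X))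
  yes : ∀ b {zs} →
       zs ↭ map (f ∘ suc) (positions b 0 X) ++ map (h ∘ suc) (positions (not b) 0 X) →
       f 0 ∷ zs ↭ map f (0 ∷ map suc (positions b 0 X)) ++ map h (map suc (positions (not b) 0 X))
  yes b p rewrite ≡-sym (map-∘ {g = f} {f = suc} (positions b 0 X)) | ≡-sym (map-∘ {g = h} {f = suc} (positions (not b) 0 X)) = prep _ p
  nope : ∀ b {zs} →
       zs ↭ map (f ∘ suc) (positions b 0 X) ++ map (h ∘ suc) (positions (not b) 0 X) →
       h 0 ∷ zs ↭ map f (map suc (positions b 0 X)) ++ map h (0 ∷ map suc (positions (not b) 0 X))
  nope b p rewrite ≡-sym (map-∘ {g = f} {f = suc} (positions b 0 X)) | ≡-sym (map-∘ {g = h} {f = suc} (positions (not b) 0 X)) =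
    ↭-trans (prep _ p) (↭-sym (↭-shift _ (map (f ∘ suc) (positions b 0 X)) _))
  go true true = yes true
  go true false = nope false
  go false true = nope true
  go false false = yes false

-- Sources and targets are compared with the boundary separately. In this form the condition passes
-- through every rule by mapping positions, and `Valid` follows from it.
Matches : ∀ {T : Set} → Boundary → MW T → Set
Matches X σ = ∀ b → ends b (edges σ) ↭ positions b 0 X

all-positions : ∀ b X Y → All (λ p → (Y ++ X) !! p ≡ just b) (positions b (length Y) X)
all-positions b [] Y = []
all-positions b (x ∷ X) Y with all-positions b X (Y ++ x ∷ [])
... | rest rewrite length-++ Y {x ∷ []} | +-comm (length Y) 1 | ++-assoc Y (x ∷ []) X = go x b refl rest
  where
  first : (Y ++ x ∷ X) !! length Y ≡ just x
  first = trans (cong ((Y ++ x ∷ X) !!_) (≡-sym (+-identityʳ (length Y)))) (!!-++ʳ Y)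
  go : ∀ x' b {zs} → x' ≡ x → All (λ p → (Y ++ x ∷ X) !! p ≡ just b) zs →
       All (λ p → (Y ++ x ∷ X) !! p ≡ just b) (if x' == b then length Y ∷ zs else zs)
  go true true refl r = first ∷ r
  go true false _ r = r
  go false true _ r = r
  go false false refl r = first ∷ r

endpoints-ends : ∀ {T : Set} (es : List (Edge ℕ T)) → endpoints es ↭ ends true es ++ ends false es
endpoints-ends [] = ↭-refl
endpoints-ends ((i , w , j) ∷ es) =
  prep i (↭-trans (prep j (endpoints-ends es)) (↭-sym (↭-shift j (ends true es) (ends false es))))

matches⇒valid : ∀ {T : Set} {X} {σ : MW T} → Matches X σ → Valid X σ
matches⇒valid {X = X} {σ} v = record
  { perfect = ↭-trans (endpoints-ends (edges σ)) (↭-trans (↭-++ (v true) (v false))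
                (↭-sym (≡-subst₂ _↭_ (trans (map-cong same (upTo (length X))) (map-id _)) (cong₂ _++_ (map-id (positions true 0 X)) (map-id (positions false 0 X)))
                  (select-positions id id true X))))
  ; oriented = go (edges σ) (All-resp-↭ (↭-sym (v true)) (all-positions true X []))
                            (All-resp-↭ (↭-sym (v false)) (all-positions false X [])) }
  where
  same : ∀ p → (if atB X p == true then p else p) ≡ p
  same p with atB X p == true
  ... | true = refl
  ... | false = refl
  go : ∀ es → All (λ p → X !! p ≡ just true) (ends true es) → All (λ p → X !! p ≡ just false) (ends false es) →
       All (λ { (i , _ , j) → (X !! i ≡ just true) × (X !! j ≡ just false) }) es
  go [] [] [] = []
  go (e ∷ es) (p ∷ ps) (q ∷ qs) = (p , q) ∷ go es ps qs

idMW-matches : ∀ {T : Set} X → Matches {T} (X ++ perp X) (idMW X)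
idMW-matches {T} X b =
  ↭-trans (↭-reflexive (trans (≡-sym (map-∘ (upTo m))) (map-cong (edge b) (upTo m))))
  (↭-trans (select-positions id (λ p → m + m ∸ 1 ∸ p) b X)
  (↭-trans (↭-++ (↭-reflexive (map-id _)) (↭-trans (↭-reflexive far) (↭-sym (positions-perp b m X))))
  (↭-reflexive (≡-sym (positions-++ b 0 X (perp X))))))
  where
  m = length X
  idx : ∀ {n i} → i < n → n + n ∸ 1 ∸ i ≡ n + (n ∸ 1 ∸ i)
  idx {suc n} {i} (s≤s l) = trans (cong (_∸ i) (+-suc n n)) (+-∸-assoc (suc n) l)
  far : map (λ p → m + m ∸ 1 ∸ p) (positions (not b) 0 X) ≡ map (λ p → m + (m ∸ 1 ∸ p)) (positions (not b) 0 X)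
  far = map-positions _ _ (not b) 0 0 X idx
  edge : ∀ b p → endpoint {T = T} b (if atB X p then (p , [] , (m + m ∸ 1) ∸ p) else ((m + m ∸ 1) ∸ p , [] , p)) ≡
                 (if atB X p == b then p else (m + m ∸ 1 ∸ p))
  edge b p with atB X p
  edge true p | true = refl
  edge false p | true = refl
  edge true p | false = refl
  edge false p | false = refl

-- Matchings under the sequent rules, and existence of gluings.

module RuleMatches (nLit : ℕ) (bnd : Fin nLit → Boundary) (T : Set) where
  open LL nLit bnd T
  open Blocks nLit bnd T
  open Valuations T

  bndCtx-++ : ∀ Γ Δ → bndCtx (Γ ++ Δ) ≡ bndCtx Δ ++ bndCtx Γ
  bndCtx-++ [] Δ = ≡-sym (++-identityʳ _)
  bndCtx-++ (A ∷ Γ) Δ = trans (cong (_++ bndF A) (bndCtx-++ Γ Δ)) (++-assoc (bndCtx Δ) (bndCtx Γ) (bndF A))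

  perp-++ : ∀ X Y → perp (X ++ Y) ≡ perp Y ++ perp X
  perp-++ X Y = trans (cong reverse (map-++ not X Y)) (reverse-++ (map not X) (map not Y))

  perp-perp : ∀ X → perp (perp X) ≡ X
  perp-perp [] = refl
  perp-perp (x ∷ X) rewrite unfold-reverse (not x) (map not X) | perp-++ (perp X) (not x ∷ []) | perp-perp X with x
  ... | true = refl
  ... | false = refl

  bndF-dual : ∀ A → bndF (dual A) ≡ perp (bndF A)
  bndF-dual (pos P) = refl
  bndF-dual (neg P) = ≡-sym (perp-perp (bnd P))
  bndF-dual (A ⊗ B) rewrite bndF-dual A | bndF-dual B = ≡-sym (perp-++ (bndF A) (bndF B))
  bndF-dual (A ⅋ B) rewrite bndF-dual A | bndF-dual B = ≡-sym (perp-++ (bndF B) (bndF A))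

  idR-matches : ∀ A → Matches {T} (bndCtx (dual A ∷ A ∷ [])) (idMW (bndF A))
  idR-matches A rewrite bndF-dual A = idMW-matches (bndF A)

  parR-matches : ∀ Γ A B {σ : MW T} → Matches (bndCtx (Γ ++ A ∷ B ∷ [])) σ → Matches (bndCtx (Γ ++ (A ⅋ B) ∷ [])) σ
  parR-matches Γ A B v rewrite bndCtx-++ Γ (A ∷ B ∷ []) | bndCtx-++ Γ ((A ⅋ B) ∷ []) = v

  relabel-matches : ∀ {f : ℕ → ℕ} {X Y} (σ : MW T) → (∀ b → map f (positions b 0 X) ↭ positions b 0 Y) →
                    Matches X σ → Matches Y (relabel f σ)
  relabel-matches {f} σ h v b =
    ↭-trans (↭-reflexive (ends-mapE f b (edges σ))) (↭-trans (map⁺ f (v b)) (h b))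

  positions₃ : ∀ b D A G → positions b 0 ((D ++ A) ++ G) ≡
    (positions b 0 D ++ positions b (length D) A) ++ positions b (length D + length A) G
  positions₃ b D A G = trans (positions-++ b 0 (D ++ A) G)
    (cong₂ _++_ (positions-++ b 0 D A) (cong (λ n → positions b n G) (length-++ D)))

  positions₄ : ∀ b D A B G → positions b 0 (((D ++ A) ++ B) ++ G) ≡
    ((positions b 0 D ++ positions b (length D) A) ++ positions b (length D + length A) B) ++
    positions b (length D + length A + length B) G
  positions₄ b D A B G = trans (positions-++ b 0 ((D ++ A) ++ B) G)
    (cong₂ _++_ (positions₃ b D A B)
      (cong (λ n → positions b n G) (trans (length-++ (D ++ A)) (cong (_+ length B) (length-++ D)))))

  swap-middle : ∀ {X : Set} (P Q R S : List X) → ((P ++ Q) ++ R) ++ S ↭ ((P ++ R) ++ Q) ++ S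
  swap-middle P Q R S = ++⁺ʳ S (↭-trans (↭-reflexive (++-assoc P Q R))
    (↭-trans (++⁺ˡ P (++-comm Q R)) (↭-reflexive (≡-sym (++-assoc P R Q)))))

  exPos-positions : ∀ D B A G b →
    map (exPos (length D) (length B) (length A)) (positions b 0 (((D ++ B) ++ A) ++ G)) ↭
    positions b 0 (((D ++ A) ++ B) ++ G)
  exPos-positions D B A G b
    rewrite positions₄ b D B A G | positions₄ b D A B G
          | map-++ (exPos (length D) (length B) (length A))
              ((positions b 0 D ++ positions b (length D) B) ++ positions b (length D + length B) A)
              (positions b (length D + length B + length A) G)
          | map-++ (exPos (length D) (length B) (length A))
              (positions b 0 D ++ positions b (length D) B) (positions b (length D + length B) A)
          | map-++ (exPos (length D) (length B) (length A)) (positions b 0 D) (positions b (length D) B)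
          | move-positions (exPos (length D) (length B) (length A)) b 0 0 D (exPos₁ (length D) (length B) (length A))
          | move-positions (exPos (length D) (length B) (length A)) b (length D) (length D + length A) B
              (exPos₂ (length D) (length B) (length A))
          | move-positions (exPos (length D) (length B) (length A)) b (length D + length B) (length D) A
              (exPos₃ (length D) (length B) (length A))
          | move-positions (exPos (length D) (length B) (length A)) b (length D + length B + length A)
              (length D + length A + length B) G (λ _ → exPos₄ (length D) (length B) (length A))
    = swap-middle (positions b 0 D) _ _ _

  exR-matches : ∀ Γ A B Δ {σ : MW T} → Matches (bndCtx (Γ ++ A ∷ B ∷ Δ)) σ →
    Matches (bndCtx (Γ ++ B ∷ A ∷ Δ))
      (relabel (exPos (length (bndCtx Δ)) (length (bndF B)) (length (bndF A))) σ)
  exR-matches Γ A B Δ {σ} v rewrite bndCtx-++ Γ (A ∷ B ∷ Δ) | bndCtx-++ Γ (B ∷ A ∷ Δ) =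
    relabel-matches {X = ((bndCtx Δ ++ bndF B) ++ bndF A) ++ bndCtx Γ} {Y = ((bndCtx Δ ++ bndF A) ++ bndF B) ++ bndCtx Γ} σ
      (exPos-positions (bndCtx Δ) (bndF B) (bndF A) (bndCtx Γ)) v

  tenR-matches : ∀ Γ A B Δ {σ₁ σ₂ : MW T} {cs} → Matches (bndCtx (Γ ++ A ∷ [])) σ₁ → Matches (bndCtx (B ∷ Δ)) σ₂ →
    Matches (bndCtx (Γ ++ (A ⊗ B) ∷ Δ))
      (mw (mapE (tensR (length (bndCtx Δ)) (length (bndF A))) (edges σ₂) ++
           mapE (tensL (length (bndCtx Δ)) (length (bndF A)) (length (bndF B))) (edges σ₁)) cs)
  tenR-matches Γ A B Δ {σ₁} {σ₂} v₁ v₂ b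
    rewrite bndCtx-++ Γ (A ∷ []) | bndCtx-++ Γ ((A ⊗ B) ∷ Δ)
          | ≡-sym (++-assoc (bndCtx Δ) (bndF A) (bndF B))
          | map-++ (endpoint b) (mapE (tensR (length (bndCtx Δ)) (length (bndF A))) (edges σ₂))
              (mapE (tensL (length (bndCtx Δ)) (length (bndF A)) (length (bndF B))) (edges σ₁))
          | ends-mapE (tensR (length (bndCtx Δ)) (length (bndF A))) b (edges σ₂)
          | ends-mapE (tensL (length (bndCtx Δ)) (length (bndF A)) (length (bndF B))) b (edges σ₁) =
    ↭-trans (↭-++ (map⁺ _ (v₂ b)) (map⁺ _ (v₁ b))) (blocks (bndCtx Δ) (bndF A) (bndF B) (bndCtx Γ))
    where
    rotate : ∀ {X : Set} (P Q R S : List X) → (P ++ Q) ++ (R ++ S) ↭ ((P ++ R) ++ Q) ++ S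
    rotate P Q R S = ↭-trans (↭-reflexive (≡-sym (++-assoc (P ++ Q) R S))) (swap-middle P Q R S)
    blocks : ∀ D A B G →
      map (tensR (length D) (length A)) (positions b 0 (D ++ B)) ++
      map (tensL (length D) (length A) (length B)) (positions b 0 (A ++ G)) ↭
      positions b 0 (((D ++ A) ++ B) ++ G)
    blocks D A B G
      rewrite positions-++ b 0 D B | positions-++ b 0 A G | positions₄ b D A B G
            | map-++ (tensR (length D) (length A)) (positions b 0 D) (positions b (length D) B)
            | map-++ (tensL (length D) (length A) (length B)) (positions b 0 A) (positions b (length A) G)
            | move-positions (tensR (length D) (length A)) b 0 0 D (tensR₁ (length D) (length A))
            | move-positions (tensR (length D) (length A)) b (length D) (length D + length A) B
                (λ _ → tensR₂ (length D) (length A))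
            | move-positions (tensL (length D) (length A) (length B)) b 0 (length D) A
                (tensL₁ (length D) (length A) (length B))
            | move-positions (tensL (length D) (length A) (length B)) b (length A) (length D + length A + length B) G
                (λ _ → tensL₂ (length D) (length A) (length B))
      = rotate (positions b 0 D) _ _ _

  outer-edges : ∀ (es : List (Edge (ℕ ⊎ ℕ) T)) → (∀ b → All (λ v → Σ ℕ λ i → v ≡ inj₁ i) (ends b es)) →
                Σ (List (Edge ℕ T)) λ es' → es ≡ mapE inj₁ es'
  outer-edges [] h = [] , refl
  outer-edges (e ∷ es) h with h true | h false | outer-edges es (λ { true → tail (h true) ; false → tail (h false) })
    where
    tail : ∀ {X : Set} {P : X → Set} {x xs} → All P (x ∷ xs) → All P xs
    tail (_ ∷ ps) = ps
  ... | (i , refl) ∷ _ | (j , refl) ∷ _ | es' , refl = (i , _ , j) ∷ es' , refl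

  irreflexive : ∀ {w v} → Reads? w v v → ⊥
  irreflexive (reads (_ , l)) = <-irrefl refl l

  -- Satisfiability rules out loops, so that gluing only joins edges and leaves cs alone.
  glue-exists : ∀ ks {es : List (Edge (ℕ ⊎ ℕ) T)} {out : Bool → List ℕ} {cs ν} →
    (∀ b → ends b es ↭ map inj₁ (out b) ++ map inj₂ ks) → SatE ν es →
    Σ (List (Edge ℕ T)) λ es' → Glue es cs (mw es' cs) × (∀ b → ends b es' ↭ out b)
  glue-exists [] {es} {out} h s
    with outer-edges es (λ b → All-resp-↭ (↭-sym (h b))
           (≡-subst (All _) (≡-sym (++-identityʳ _)) (All-map⁺ (all-tabulate (λ {i} _ → i , refl)))))
  ... | es' , refl = es' , done es' _ , perm
    where
    perm : ∀ b → ends b es' ↭ out b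
    perm b with ↭-map-inv inj₁ (↭-trans (↭-reflexive (≡-sym (ends-mapE inj₁ b es'))) (h b))
    ... | ys , e , p rewrite ++-identityʳ (map {B = ℕ ⊎ ℕ} inj₁ (out b)) = ↭-trans p (↭-reflexive (≡-sym (map-injective (λ { refl → refl }) e)))
  glue-exists (k ∷ ks) {es} {out} {cs} {ν} h s
    with ∈-map⁻ (endpoint false) (∈-resp-↭ (↭-sym (h false)) (∈-++⁺ʳ (map inj₁ (out false)) (here refl)))
  ... | (u , w , _) , m , refl with ∈⇒↭ m
  ...   | es₁ , p with ∈-resp-↭ (map⁺ (endpoint true) p) (∈-resp-↭ (↭-sym (h true)) (∈-++⁺ʳ (map inj₁ (out true)) (here refl))) | All-resp-↭ p s
  ...     | here refl | r ∷ _ = ⊥-elim (irreflexive r)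
  ...     | there m' | _ with ∈-map⁻ (endpoint true) m'
  ...       | (_ , w' , v) , m'' , refl with ∈⇒↭ m''
  ...         | rest , q with ↭-trans p (prep _ q)
  ...           | pq with All-resp-↭ pq s
  ...             | r ∷ r' ∷ rs with glue-exists ks {(u , w ++ w' , v) ∷ rest} {out} {cs} {ν} h' (reads?-trans r r' ∷ rs)
    where
    h' : ∀ b → ends b ((u , w ++ w' , v) ∷ rest) ↭ map inj₁ (out b) ++ map inj₂ ks
    h' true = drop-mid (u ∷ []) (map inj₁ (out true)) (↭-trans (↭-sym (map⁺ (endpoint true) pq)) (h true))
    h' false = drop-mid [] (map inj₁ (out false)) (↭-trans (↭-sym (map⁺ (endpoint false) pq)) (h false))
  ...               | es' , g , f = es' , join pq g , f

  -- Dualising exchanges polarities, so a glued vertex is a source in one premise and a target in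
  -- the other. This is why the list of inner vertices on the right is the same for both values of
  -- `b`.
  cut-ends : ∀ D A G b →
    map (cutR (length D) (length A)) (positions b 0 (D ++ perp A)) ++
    map (cutL (length D) (length A)) (positions b 0 (A ++ G)) ↭
    map inj₁ (positions b 0 (D ++ G)) ++ map inj₂ (positions true 0 A ++ positions false 0 A)
  cut-ends D A G b
    rewrite positions-++ b 0 D (perp A) | positions-++ b 0 A G | positions-++ b 0 D G
          | map-++ (cutR (length D) (length A)) (positions b 0 D) (positions b (length D) (perp A))
          | map-++ (cutL (length D) (length A)) (positions b 0 A) (positions b (length A) G)
          | map-++ {B = ℕ ⊎ ℕ} inj₁ (positions b 0 D) (positions b (length D) G)
          | map-++ {B = ℕ ⊎ ℕ} inj₂ (positions true 0 A) (positions false 0 A)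
          | map-positions (cutR (length D) (length A)) inj₁ b 0 0 D (cutR₁ (length D) (length A))
          | map-positions (cutR (length D) (length A)) (λ i → inj₂ ((length A) ∸ 1 ∸ i)) b (length D) 0 (perp A) (λ _ → cutR₂ (length D) (length A))
          | map-positions (cutL (length D) (length A)) inj₂ b 0 0 A (cutL₁ (length D) (length A))
          | map-positions (cutL (length D) (length A)) inj₁ b (length A) (length D) G (λ _ → cutL₂ (length D) (length A))
    = ↭-trans (++⁺ʳ _ (++⁺ˡ (map inj₁ (positions b 0 D)) reflect))
        (↭-trans (regroup (map inj₁ (positions b 0 D)) _ (map inj₂ (positions b 0 A)) (map inj₁ (positions b (length D) G)))
          (++⁺ˡ (map inj₁ (positions b 0 D) ++ map inj₁ (positions b (length D) G)) (order b)))
    where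
    d = length D
    a = length A
    invol : ∀ {i n} → i < n → n ∸ 1 ∸ (n ∸ 1 ∸ i) ≡ i
    invol {n = suc n} (s≤s l) = m∸[m∸n]≡n l
    reflect : map {B = ℕ ⊎ ℕ} (λ i → inj₂ (a ∸ 1 ∸ i)) (positions b 0 (perp A)) ↭ map inj₂ (positions (not b) 0 A)
    reflect = ↭-trans (map⁺ _ (positions-perp b 0 A)) (↭-reflexive
      (trans (≡-sym (map-∘ (positions (not b) 0 A)))
             (map-positions _ inj₂ (not b) 0 0 A (λ l → cong inj₂ (invol l)))))
    regroup : ∀ {X : Set} (P Q R S : List X) → (P ++ Q) ++ (R ++ S) ↭ (P ++ S) ++ (Q ++ R)
    regroup P Q R S =
      ↭-trans (↭-reflexive (trans (++-assoc P Q (R ++ S)) (cong (P ++_) (≡-sym (++-assoc Q R S)))))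
        (↭-trans (++⁺ˡ P (++-comm (Q ++ R) S)) (↭-reflexive (≡-sym (++-assoc P S (Q ++ R)))))
    order : ∀ b → map {B = ℕ ⊎ ℕ} inj₂ (positions (not b) 0 A) ++ map inj₂ (positions b 0 A) ↭
                  map inj₂ (positions true 0 A) ++ map inj₂ (positions false 0 A)
    order true = ++-comm (map inj₂ (positions false 0 A)) _
    order false = ↭-refl

  cut-exists : ∀ Γ A Δ {σ₁ σ₂ : MW T} {cs ν} →
    Matches (bndCtx (Γ ++ A ∷ [])) σ₁ → Matches (bndCtx (dual A ∷ Δ)) σ₂ →
    let es = mapE (cutR (length (bndCtx Δ)) (length (bndF A))) (edges σ₂) ++
             mapE (cutL (length (bndCtx Δ)) (length (bndF A))) (edges σ₁) in
    SatE ν es → Σ (List (Edge ℕ T)) λ es' → Glue es cs (mw es' cs) × Matches (bndCtx (Γ ++ Δ)) (mw es' cs)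
  cut-exists Γ A Δ {σ₁} {σ₂} v₁ v₂ s
    rewrite bndCtx-++ Γ (A ∷ []) | bndF-dual A | bndCtx-++ Γ Δ =
    glue-exists (positions true 0 (bndF A) ++ positions false 0 (bndF A)) {out = λ b → positions b 0 (bndCtx Δ ++ bndCtx Γ)} h s
    where
    d = length (bndCtx Δ)
    a = length (bndF A)
    h : ∀ b → ends b (mapE (cutR d a) (edges σ₂) ++ mapE (cutL d a) (edges σ₁)) ↭ _
    h b rewrite map-++ (endpoint b) (mapE (cutR d a) (edges σ₂)) (mapE (cutL d a) (edges σ₁))
              | ends-mapE (cutR d a) b (edges σ₂) | ends-mapE (cutL d a) b (edges σ₁) =
      ↭-trans (↭-++ (map⁺ _ (v₂ b)) (map⁺ _ (v₁ b))) (cut-ends (bndCtx Δ) (bndF A) (bndCtx Γ) b)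

dual-dual : ∀ {n} (A : Fm n) → dual (dual A) ≡ A
dual-dual (pos P) = refl
dual-dual (neg P) = refl
dual-dual (A ⊗ B) = cong₂ _⊗_ (dual-dual A) (dual-dual B)
dual-dual (A ⅋ B) = cong₂ _⅋_ (dual-dual A) (dual-dual B)

objB : LTy ⊤ → Boundary
objB (atom _) = true ∷ false ∷ []
objB (A ⊸ B)  = objB B ++ perp (objB A)

-- Realizability of object types by relations on valuations.

module Realizability (N : Set) (n : ℕ) where

  T : Set
  T = TSym N n

  open Valuations T

  Obj : Set
  Obj = Tm (TreeCon N n)

  -- A constructor in the course of being applied: `M` is the application so far and `u` the part of
  -- the encoding already written. Each argument contributes its word and the separator behind it.
  Accepts : (List T → Obj → Set) → ∀ A k (p : k ≤ n) {j} → Obj → List T → Vec (Fin (suc k)) j → Set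
  Accepts K A k p M u []       = K u M
  Accepts K A k p M u (i ∷ is) = ∀ w M' → K w M' → Accepts K A k p (app M M') (u ++ w ++ sym A k p i ∷ []) is

  -- An interpretation of the type of trees, as a relation between words and terms.
  record Kind : Set₁ where
    field
      K     : List T → Obj → Set
      K-≈   : ∀ {w M M'} → M ≈βη M' → K w M → K w M'
      K-con : ∀ A k p → Accepts K A k p (con (tcon A k p)) (sym A k p zero ∷ []) (tabulate suc)
  open Kind public

  Rel : Set₁
  Rel = List Val → Set

  _⊙[_]_ : Rel → ℕ → Rel → Rel
  (Q ⊙[ a ] Q') ρ = Σ (List Val) λ ρ' → length ρ' ≡ a × Q' ρ' × Q (ρ ++ reverse ρ')

  ShiftR : Boundary → Rel → Rel
  ShiftR X Q ρ = Σ (List Val) λ ρ' → Shift X ρ ρ' × Q ρ'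

  -- Words are handled like difference lists: the left endpoint carries `w` followed by an arbitrary
  -- continuation `z`, the value of the right endpoint. The number `m` there is arbitrary too, and
  -- `m'` answers it, so that numbers can be assigned from the end of a path backwards.
  R : Kind → LTy ⊤ → Rel → Obj → Set₁
  R κ (atom _) Q M = Lift _ (Σ (List T) λ w → K κ w M ×
                       (∀ z m → Σ ℕ λ m' → Q ((w ++ z , m') ∷ (z , m) ∷ [])))
  R κ (A ⊸ B) Q M = ∀ Q' M' → R κ A Q' M' → R κ B (Q ⊙[ length (objB A) ] Q') (app M M')

  length-++-≡ : ∀ (ρ ρ' : List Val) {X Y : Boundary} → length ρ ≡ length X → length ρ' ≡ length Y →
                length (ρ ++ ρ') ≡ length (X ++ Y)
  length-++-≡ ρ ρ' {X} e e' = trans (length-++ ρ) (trans (cong₂ _+_ e e') (≡-sym (length-++ X)))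

  length-reverse-≡ : ∀ (ρ : List Val) X → length ρ ≡ length X → length (reverse ρ) ≡ length (perp X)
  length-reverse-≡ ρ X e = trans (length-reverse ρ) (trans e (≡-sym (length-perp X)))

  R-mono : ∀ κ A {Q Q' M} → (∀ ρ → length ρ ≡ length (objB A) → Q ρ → Q' ρ) → R κ A Q M → R κ A Q' M
  R-mono κ (atom _) f (lift (w , k , q)) = lift (w , k , λ z m → proj₁ (q z m) , f _ refl (proj₂ (q z m)))
  R-mono κ (A ⊸ B) f r Q' M' r' = R-mono κ B
    (λ ρ e (ρ' , e' , q' , q) → ρ' , e' , q' ,
       f _ (length-++-≡ ρ (reverse ρ') {objB B} {perp (objB A)} e (length-reverse-≡ ρ' (objB A) e')) q) (r Q' M' r')

  R-≈ : ∀ κ A {Q M M'} → M ≈βη M' → R κ A Q M → R κ A Q M'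
  R-≈ κ (atom _) e (lift (w , k , q)) = lift (w , K-≈ κ e k , q)
  R-≈ κ (A ⊸ B) e r Q' M' r' = R-≈ κ B (≈app e ≈refl) (r Q' M' r')

  -- Compensates for identity nets, which move each value along one edge. At an arrow the argument
  -- is shifted before it is fed in and the result afterwards; together these shift the whole
  -- boundary.
  R-shift : ∀ κ A {Q M} → R κ A Q M → R κ A (ShiftR (objB A) Q) M
  -- Asking `Q` at `suc m` gives room below for the right endpoint, and the outer `suc` gives room
  -- above for the left one.
  R-shift κ (atom _) (lift (w , k , q)) = lift (w , k , λ z m → suc (proj₁ (q z (suc m))) ,
    _ , left (refl , ≤-refl) (right (refl , ≤-refl) []) , proj₂ (q z (suc m)))
  R-shift κ (A ⊸ B) {Q} r Q' M' r' =
    R-mono κ B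
      (λ { ρ _ (ρ₁ , s , ρ₂ , e , (ρ₃ , s' , q') , q) →
           ρ₃ , proj₂ (shift-length s') , q' , _ , shift-++ s (shift-perp s') , q })
      (R-shift κ B (r _ _ (R-shift κ A r')))

  -- Supplies the solution without which strict decrease could not exclude loops in a cut.
  NonEmpty : Kind → Set₁
  NonEmpty κ = ∀ A {Q M} → R κ A Q M → Σ (List Val) λ ρ → length ρ ≡ length (objB A) × Q ρ

  -- Nets for the combinators and for application.

  module Realizers {At Con : Set} (𝔗 : Con → LTy At) (φAt : At → LTy ⊤) (φ : Con → Obj)
    (φ-closed : ∀ c → shift 0 (φ c) ≡ φ c)
    (nLit : ℕ) (bnd : Fin nLit → Boundary) (lit : At → Fin nLit)
    (lit-bnd : ∀ a → bnd (lit a) ≡ objB (φAt a)) where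

    open LL nLit bnd T
    open RuleSat nLit bnd T
    open RuleMatches nLit bnd T
    open Linear 𝔗 φ φ-closed

    tr : LTy At → Fm nLit
    tr (atom a) = pos (lit a)
    tr (A ⊸ B)  = dual (tr A) ⅋ tr B

    obj : LTy At → Boundary
    obj A = objB (mapTy φAt A)

    bndF-tr : ∀ A → bndF (tr A) ≡ obj A
    bndF-tr (atom a) = lit-bnd a
    bndF-tr (A ⊸ B) rewrite bndF-dual (tr A) | bndF-tr A | bndF-tr B = refl

    length-dual : ∀ A → length (bndF (dual A)) ≡ length (bndF A)
    length-dual A = trans (cong length (bndF-dual A)) (length-perp (bndF A))

    -- `D` stands for derivability from a lexicon, or for the trivial predicate when only the
    -- multiword of an object term is wanted.
    record Rules (D : List (Fm nLit) → MW T → Set) : Set where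
      field
        ruleId  : ∀ A → D (dual A ∷ A ∷ []) (idMW (bndF A))
        ruleEx  : ∀ Γ A B Δ {σ} → D (Γ ++ A ∷ B ∷ Δ) σ →
                  D (Γ ++ B ∷ A ∷ Δ) (relabel (exPos (length (bndCtx Δ)) (length (bndF B)) (length (bndF A))) σ)
        rulePar : ∀ Γ A B {σ} → D (Γ ++ A ∷ B ∷ []) σ → D (Γ ++ (A ⅋ B) ∷ []) σ
        ruleTen : ∀ Γ A B Δ {σ₁ σ₂} → D (Γ ++ A ∷ []) σ₁ → D (B ∷ Δ) σ₂ →
                  D (Γ ++ (A ⊗ B) ∷ Δ)
                    (mw (mapE (tensR (length (bndCtx Δ)) (length (bndF A))) (edges σ₂) ++
                         mapE (tensL (length (bndCtx Δ)) (length (bndF A)) (length (bndF B))) (edges σ₁))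
                        (cycles σ₁ ++ cycles σ₂))
        ruleCut : ∀ Γ A Δ {σ₁ σ₂ τ} → D (Γ ++ A ∷ []) σ₁ → D (dual A ∷ Δ) σ₂ →
                  Glue (mapE (cutR (length (bndCtx Δ)) (length (bndF A))) (edges σ₂) ++
                        mapE (cutL (length (bndCtx Δ)) (length (bndF A))) (edges σ₁))
                       (cycles σ₁ ++ cycles σ₂) τ → D (Γ ++ Δ) τ

    module Realize (D : List (Fm nLit) → MW T → Set) (rules : Rules D)
                   (κ₀ : Kind) (nonEmpty : NonEmpty κ₀) where
      open Rules rules

      record Net (Γ : List (Fm nLit)) : Set where
        constructor net
        field
          word    : MW T
          derived : D Γ word
          matches : Matches (bndCtx Γ) word
          acyclic : cycles word ≡ []
      open Net public

      netId : ∀ A → Net (dual A ∷ A ∷ [])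
      netId A = net _ (ruleId A) (idR-matches A) refl

      netEx : ∀ Γ A B Δ → Net (Γ ++ A ∷ B ∷ Δ) → Net (Γ ++ B ∷ A ∷ Δ)
      netEx Γ A B Δ (net σ d v c) = net _ (ruleEx Γ A B Δ d) (exR-matches Γ A B Δ {σ} v) c

      netPar : ∀ Γ A B → Net (Γ ++ A ∷ B ∷ []) → Net (Γ ++ (A ⅋ B) ∷ [])
      netPar Γ A B (net σ d v c) = net σ (rulePar Γ A B d) (parR-matches Γ A B {σ} v) c

      netTen : ∀ Γ A B Δ → Net (Γ ++ A ∷ []) → Net (B ∷ Δ) → Net (Γ ++ (A ⊗ B) ∷ Δ)
      netTen Γ A B Δ (net σ₁ d₁ v₁ c₁) (net σ₂ d₂ v₂ c₂) =
        net _ (ruleTen Γ A B Δ d₁ d₂) (tenR-matches Γ A B Δ {σ₁} {σ₂} {[]} v₁ v₂) (cong₂ _++_ c₁ c₂)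

      idMW-satΓ : ∀ A {ρ ρ'} → Shift (bndF A) ρ ρ' → SatΓ (word (netId A)) (reverse ρ' ∷ ρ ∷ [])
      idMW-satΓ A s = idMW-sat s

      rev-length : ∀ {X ρ} ρ' → Shift X ρ ρ' → length (reverse ρ') ≡ length X
      rev-length ρ' s = trans (length-reverse ρ') (proj₂ (shift-length s))

      -- One axiom link each for `a`, `b` and `c`, hence three shifts in the valuation. The formula
      -- `F` is a parameter because the translated type contains double duals, which reduce only
      -- propositionally; the net is built without them and transported.
      NetB : Fm nLit → Fm nLit → Fm nLit → Fm nLit → Set
      NetB a b c F = Σ (Net (F ∷ [])) λ p → ∀ {ρa ρa' ρb ρb' ρc ρc'} →
        Shift (bndF a) ρa' ρa → Shift (bndF b) ρb' ρb → Shift (bndF c) ρc ρc' →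
        Sat (word p) (((ρc ++ reverse ρa) ++ (ρa' ++ reverse ρb)) ++ (ρb' ++ reverse ρc'))

      netB : ∀ a b c → NetB a b c ((b ⊗ dual c) ⅋ ((a ⊗ dual b) ⅋ (dual a ⅋ c)))
      netB a b c = p₈ , sat
        where
        X = a ⊗ dual b
        Y = b ⊗ dual c
        p₁ = netTen (dual a ∷ []) a (dual b) (b ∷ []) (netId a) (netId b)
        p₂ = netTen (dual a ∷ X ∷ []) b (dual c) (c ∷ []) p₁ (netId c)
        p₃ = netEx (dual a ∷ []) X Y (c ∷ []) p₂
        p₄ = netEx [] (dual a) Y (X ∷ c ∷ []) p₃
        p₅ = netEx (Y ∷ []) (dual a) X (c ∷ []) p₄
        p₆ = netPar (Y ∷ X ∷ []) (dual a) c p₅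
        p₇ = netPar (Y ∷ []) X (dual a ⅋ c) p₆
        p₈ = netPar [] Y (X ⅋ (dual a ⅋ c)) p₇
        sat : ∀ {ρa ρa' ρb ρb' ρc ρc'} →
              Shift (bndF a) ρa' ρa → Shift (bndF b) ρb' ρb → Shift (bndF c) ρc ρc' →
              Sat (word p₈) (((ρc ++ reverse ρa) ++ (ρa' ++ reverse ρb)) ++ (ρb' ++ reverse ρc'))
        sat {ρa} {ρa'} {ρb} {ρb'} {ρc} {ρc'} sa sb sc = s₈
          where
          va = reverse ρa
          vX = ρa' ++ reverse ρb
          vY = ρb' ++ reverse ρc'
          la' = proj₁ (shift-length sa)
          lb' = proj₁ (shift-length sb)
          lc = proj₁ (shift-length sc)
          la : length va ≡ length (bndF (dual a))
          la = trans (rev-length ρa sa) (≡-sym (length-dual a))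
          lb : length (reverse ρb) ≡ length (bndF (dual b))
          lb = trans (rev-length ρb sb) (≡-sym (length-dual b))
          lc' : length (reverse ρc') ≡ length (bndF (dual c))
          lc' = trans (rev-length ρc' sc) (≡-sym (length-dual c))
          lX : length vX ≡ length (bndF X)
          lX = length-++-≡ ρa' (reverse ρb) {bndF a} {bndF (dual b)} la' lb
          lY : length vY ≡ length (bndF Y)
          lY = length-++-≡ ρb' (reverse ρc') {bndF b} {bndF (dual c)} lb' lc'
          s₁ : SatΓ (word p₁) (va ∷ vX ∷ ρb' ∷ [])
          s₁ = tenR-sat {word (netId a)} {word (netId b)} {cs = []} (va ∷ []) ρa' (reverse ρb) (ρb' ∷ []) lb' la' lb (idMW-satΓ a sa) (idMW-satΓ b sb)
          s₂ : SatΓ (word p₂) (va ∷ vX ∷ vY ∷ ρc ∷ [])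
          s₂ = tenR-sat {word p₁} {word (netId c)} {cs = []} (va ∷ vX ∷ []) ρb' (reverse ρc') (ρc ∷ []) lc lb' lc' s₁ (idMW-satΓ c sc)
          s₃ : SatΓ (word p₃) (va ∷ vY ∷ vX ∷ ρc ∷ [])
          s₃ = exR-sat {word p₂} (va ∷ []) vX vY (ρc ∷ []) lc lY lX s₂
          s₄ : SatΓ (word p₄) (vY ∷ va ∷ vX ∷ ρc ∷ [])
          s₄ = exR-sat {word p₃} [] va vY (vX ∷ ρc ∷ []) (length-++-≡ ρc vX {bndF c} {bndF X} lc lX) lY la s₃
          s₅ : SatΓ (word p₅) (vY ∷ vX ∷ va ∷ ρc ∷ [])
          s₅ = exR-sat {word p₄} (vY ∷ []) va vX (ρc ∷ []) lc lX la s₄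
          s₈ = parR-sat {word p₇} [] vY ((ρc ++ va) ++ vX) (parR-sat {word p₆} (vY ∷ []) vX (ρc ++ va) (parR-sat {word p₅} (vY ∷ vX ∷ []) va ρc s₅))

      NetC : Fm nLit → Fm nLit → Fm nLit → Fm nLit → Set
      NetC a b c F = Σ (Net (F ∷ [])) λ p → ∀ {ρa ρa' ρb ρb' ρc ρc'} →
        Shift (bndF a) ρa' ρa → Shift (bndF b) ρb' ρb → Shift (bndF c) ρc ρc' →
        Sat (word p) (((ρc ++ reverse ρa) ++ reverse ρb) ++ (ρa' ++ (ρb' ++ reverse ρc')))

      netC : ∀ a b c → NetC a b c ((a ⊗ (b ⊗ dual c)) ⅋ (dual b ⅋ (dual a ⅋ c)))
      netC a b c = p₈ , sat
        where
        W = b ⊗ dual c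
        Z = a ⊗ W
        p₁ = netTen (dual b ∷ []) b (dual c) (c ∷ []) (netId b) (netId c)
        p₂ = netEx [] (dual b) W (c ∷ []) p₁
        p₃ = netTen (dual a ∷ []) a W (dual b ∷ c ∷ []) (netId a) p₂
        p₄ = netEx [] (dual a) Z (dual b ∷ c ∷ []) p₃
        p₅ = netEx (Z ∷ []) (dual a) (dual b) (c ∷ []) p₄
        p₆ = netPar (Z ∷ dual b ∷ []) (dual a) c p₅
        p₇ = netPar (Z ∷ []) (dual b) (dual a ⅋ c) p₆
        p₈ = netPar [] Z (dual b ⅋ (dual a ⅋ c)) p₇
        sat : ∀ {ρa ρa' ρb ρb' ρc ρc'} →
              Shift (bndF a) ρa' ρa → Shift (bndF b) ρb' ρb → Shift (bndF c) ρc ρc' →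
              Sat (word p₈) (((ρc ++ reverse ρa) ++ reverse ρb) ++ (ρa' ++ (ρb' ++ reverse ρc')))
        sat {ρa} {ρa'} {ρb} {ρb'} {ρc} {ρc'} sa sb sc = s₈
          where
          va = reverse ρa
          vb = reverse ρb
          vW = ρb' ++ reverse ρc'
          vZ = ρa' ++ vW
          la' = proj₁ (shift-length sa)
          lb' = proj₁ (shift-length sb)
          lc = proj₁ (shift-length sc)
          la : length va ≡ length (bndF (dual a))
          la = trans (rev-length ρa sa) (≡-sym (length-dual a))
          lb : length vb ≡ length (bndF (dual b))
          lb = trans (rev-length ρb sb) (≡-sym (length-dual b))
          lc' : length (reverse ρc') ≡ length (bndF (dual c))
          lc' = trans (rev-length ρc' sc) (≡-sym (length-dual c))
          lW : length vW ≡ length (bndF W)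
          lW = length-++-≡ ρb' (reverse ρc') {bndF b} {bndF (dual c)} lb' lc'
          lZ : length vZ ≡ length (bndF Z)
          lZ = length-++-≡ ρa' vW {bndF a} {bndF W} la' lW
          lbc : length (ρc ++ vb) ≡ length (bndF c ++ bndF (dual b))
          lbc = length-++-≡ ρc vb {bndF c} {bndF (dual b)} lc lb
          s₁ : SatΓ (word p₁) (vb ∷ vW ∷ ρc ∷ [])
          s₁ = tenR-sat {word (netId b)} {word (netId c)} {cs = []} (vb ∷ []) ρb' (reverse ρc') (ρc ∷ []) lc lb' lc' (idMW-satΓ b sb) (idMW-satΓ c sc)
          s₂ : SatΓ (word p₂) (vW ∷ vb ∷ ρc ∷ [])
          s₂ = exR-sat {word p₁} [] vb vW (ρc ∷ []) lc lW lb s₁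
          s₃ : SatΓ (word p₃) (va ∷ vZ ∷ vb ∷ ρc ∷ [])
          s₃ = tenR-sat {word (netId a)} {word p₂} {cs = []} (va ∷ []) ρa' vW (vb ∷ ρc ∷ []) lbc la' lW (idMW-satΓ a sa) s₂
          s₄ : SatΓ (word p₄) (vZ ∷ va ∷ vb ∷ ρc ∷ [])
          s₄ = exR-sat {word p₃} [] va vZ (vb ∷ ρc ∷ []) lbc lZ la s₃
          s₅ : SatΓ (word p₅) (vZ ∷ vb ∷ va ∷ ρc ∷ [])
          s₅ = exR-sat {word p₄} (vZ ∷ []) va vb (ρc ∷ []) lc lb la s₄
          s₈ = parR-sat {word p₇} [] vZ ((ρc ++ va) ++ vb) (parR-sat {word p₆} (vZ ∷ []) vb (ρc ++ va) (parR-sat {word p₅} (vZ ∷ vb ∷ []) va ρc s₅))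

      NetArg : ∀ A B → Net (A ∷ []) → Fm nLit → Set
      NetArg A B p F = Σ (Net (F ∷ B ∷ [])) λ q → ∀ {ρA ρB ρ} → length ρA ≡ length (bndF A) → Sat (word p) ρA →
        Shift (bndF B) ρ ρB → SatΓ (word q) ((ρA ++ reverse ρB) ∷ ρ ∷ [])

      -- An argument and an axiom on `B` form the dual of the function formula, next to a free `B`
      -- for the result. A single cut against it performs the application.
      netArg : ∀ A B (p : Net (A ∷ [])) → NetArg A B p (A ⊗ dual B)
      netArg A B p = netTen [] A (dual B) (B ∷ []) p (netId B) ,
        λ {ρA} {ρB} {ρ} l s sh → tenR-sat {word p} {word (netId B)} {cs = []} [] ρA (reverse ρB) (ρ ∷ []) (proj₁ (shift-length sh)) l
          (trans (rev-length ρB sh) (≡-sym (length-dual B))) s (idMW-satΓ B sh)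

      record AppSat (A B : Fm nLit) (p : Net ((dual A ⅋ B) ∷ [])) (q : Net (A ∷ [])) (ρ : List Val) : Set where
        constructor appSat
        field
          {ρA ρB} : List Val
          lenA  : length ρA ≡ length (bndF A)
          satA  : Sat (word q) ρA
          satF  : Sat (word p) (ρB ++ reverse ρA)
          moved : Shift (bndF B) ρ ρB

      -- One solution of the two premises suffices to show that the gluing exists. The glued
      -- multiword is then satisfied by what remains of every solution.
      netApp : ∀ A B (p : Net ((dual A ⅋ B) ∷ [])) (q : Net (A ∷ [])) → Σ (List Val) (AppSat A B p q) →
               Σ (Net (B ∷ [])) λ r → ∀ ρ → AppSat A B p q ρ → Sat (word r) ρ
      netApp A B p q (ρ₀ , s₀) with ≡-subst (NetArg A B q) (cong (_⊗ dual B) (≡-sym (dual-dual A))) (netArg A B q)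
      ... | q' , f with cut-exists [] (dual A ⅋ B) (B ∷ []) {word p} {word q'} {cycles (word p) ++ cycles (word q')}
                          (matches p) (matches q') (satE ρ₀ s₀)
        where
        satE : ∀ ρ (s : AppSat A B p q ρ) →
               SatE (cutVal [] (ρ ∷ []) (AppSat.ρB s ++ reverse (AppSat.ρA s))) _
        satE ρ (appSat {ρA} {ρB} l sA sF sh) =
          cut-satE {word p} {word q'} [] (ρB ++ reverse ρA) (ρ ∷ []) (proj₁ (shift-length sh))
            (length-++-≡ ρB (reverse ρA) {bndF B} {bndF (dual A)} (proj₂ (shift-length sh))
              (trans (length-reverse ρA) (trans l (≡-sym (length-dual A)))))
            sF (≡-subst (λ v → SatΓ (word q') (v ∷ ρ ∷ []))
                 (≡-sym (trans (reverse-++ ρB (reverse ρA)) (cong (_++ reverse ρB) (reverse-involutive ρA))))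
                 (f l sA sh))
      ...   | es , g , v =
        net (mw es _) (ruleCut [] (dual A ⅋ B) (B ∷ []) (derived p) (derived q') g) v (cong₂ _++_ (acyclic p) (acyclic q')) ,
        λ ρ (appSat {ρA} {ρB} l sA sF sh) →
          cut-sat {word p} {word q'} [] (ρB ++ reverse ρA) (ρ ∷ []) (proj₁ (shift-length sh))
            (length-++-≡ ρB (reverse ρA) {bndF B} {bndF (dual A)} (proj₂ (shift-length sh))
              (trans (length-reverse ρA) (trans l (≡-sym (length-dual A)))))
            sF (≡-subst (λ v → SatΓ (word q') (v ∷ ρ ∷ []))
                 (≡-sym (trans (reverse-++ ρB (reverse ρA)) (cong (_++ reverse ρB) (reverse-involutive ρA))))
                 (f l sA sh)) g

      -- The same net has to work for all kinds at once: `tokKind` shows that it can be glued and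
      -- which word it carries, while `treeKind` is what the phase model needs of lexicon entries.
      Realizer : LTy At → Obj → Set₁
      Realizer A M = Σ (Net (tr A ∷ [])) λ p → ∀ κ → R κ (mapTy φAt A) (Sat (word p)) M

      toF : ∀ A {ρ ρ'} → Shift (obj A) ρ ρ' → Shift (bndF (tr A)) ρ ρ'
      toF A {ρ} {ρ'} s = ≡-subst (λ X → Shift X ρ ρ') (≡-sym (bndF-tr A)) s

      realizeI : ∀ A → Realizer (A ⊸ A) Iᶜ
      realizeI A = netPar [] (dual (tr A)) (tr A) (netId (tr A)) ,
        λ κ Q M r → R-≈ κ (mapTy φAt A) (≈sym (I-≈ M)) (R-mono κ (mapTy φAt A)
          (λ ρ _ (ρ' , s , q) → ρ' , proj₂ (shift-length s) , q , idMW-sat (toF A s))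
          (R-shift κ (mapTy φAt A) r))

      realizeB : ∀ A B C → Realizer ((B ⊸ C) ⊸ (A ⊸ B) ⊸ A ⊸ C) Bᶜ
      realizeB A B C with ≡-subst (NetB (tr A) (tr B) (tr C))
                            (cong₂ (λ X Y → (Y ⊗ dual (tr C)) ⅋ ((X ⊗ dual (tr B)) ⅋ (dual (tr A) ⅋ tr C)))
                              (≡-sym (dual-dual (tr A))) (≡-sym (dual-dual (tr B))))
                            (netB (tr A) (tr B) (tr C))
      ... | p , sat = p , λ κ Qf F rf Qg G rg Qa M ra →
        R-≈ κ (mapTy φAt C) (≈sym (B-≈ F G M)) (R-mono κ (mapTy φAt C)
          (λ { ρc _ (ρc' , sc , ρb' , _ , (ρb , sb , ρa' , _ , (ρa , sa , qa) , qg) , qf) →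
               ρa , proj₂ (shift-length sa) , qa ,
               ρb ++ reverse ρa' ,
               length-++-≡ ρb (reverse ρa') {obj B} {perp (obj A)} (proj₂ (shift-length sb)) (length-reverse-≡ ρa' (obj A) (proj₁ (shift-length sa))) ,
               qg ,
               ρc' ++ reverse ρb' ,
               length-++-≡ ρc' (reverse ρb') {obj C} {perp (obj B)} (proj₂ (shift-length sc)) (length-reverse-≡ ρb' (obj B) (proj₁ (shift-length sb))) ,
               qf ,
               ≡-subst₂ (λ x y → Sat (word p) (((ρc ++ reverse ρa) ++ x) ++ y))
                 (≡-sym (trans (reverse-++ ρb (reverse ρa')) (cong (_++ reverse ρb) (reverse-involutive ρa'))))
                 (≡-sym (trans (reverse-++ ρc' (reverse ρb')) (cong (_++ reverse ρc') (reverse-involutive ρb'))))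
                 (sat (toF A sa) (toF B sb) (toF C sc)) })
          -- One shift for each of the three axiom links of the net.
          (R-shift κ (mapTy φAt C) (rf _ _ (R-shift κ (mapTy φAt B) (rg _ _ (R-shift κ (mapTy φAt A) ra))))))

      realizeC : ∀ A B C → Realizer ((A ⊸ B ⊸ C) ⊸ B ⊸ A ⊸ C) Cᶜ
      realizeC A B C with ≡-subst (NetC (tr A) (tr B) (tr C))
                            (cong₂ (λ X Y → (X ⊗ (Y ⊗ dual (tr C))) ⅋ (dual (tr B) ⅋ (dual (tr A) ⅋ tr C)))
                              (≡-sym (dual-dual (tr A))) (≡-sym (dual-dual (tr B))))
                            (netC (tr A) (tr B) (tr C))
      ... | p , sat = p , λ κ Qf F rf Qb M rb Qa M' ra →
        R-≈ κ (mapTy φAt C) (≈sym (C-≈ F M M')) (R-mono κ (mapTy φAt C)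
          (λ { ρc _ (ρc' , sc , ρb' , _ , (ρb , sb , qb) , ρa' , _ , (ρa , sa , qa) , qf) →
               ρa , proj₂ (shift-length sa) , qa ,
               ρb , proj₂ (shift-length sb) , qb ,
               (ρc' ++ reverse ρb') ++ reverse ρa' ,
               length-++-≡ (ρc' ++ reverse ρb') (reverse ρa') {obj C ++ perp (obj B)} {perp (obj A)}
                 (length-++-≡ ρc' (reverse ρb') {obj C} {perp (obj B)} (proj₂ (shift-length sc)) (length-reverse-≡ ρb' (obj B) (proj₁ (shift-length sb))))
                 (length-reverse-≡ ρa' (obj A) (proj₁ (shift-length sa))) ,
               qf ,
               ≡-subst (λ x → Sat (word p) (((ρc ++ reverse ρa) ++ reverse ρb) ++ x))
                 (≡-sym (trans (reverse-++ (ρc' ++ reverse ρb') (reverse ρa'))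
                   (cong₂ _++_ (reverse-involutive ρa')
                     (trans (reverse-++ ρc' (reverse ρb')) (cong (_++ reverse ρc') (reverse-involutive ρb'))))))
                 (sat (toF A sa) (toF B sb) (toF C sc)) })
          (R-shift κ (mapTy φAt C) (rf _ _ (R-shift κ (mapTy φAt A) ra) _ _ (R-shift κ (mapTy φAt B) rb))))

      realizeApp : ∀ {A B M M'} → Realizer (A ⊸ B) M → Realizer A M' → Realizer B (app M M')
      realizeApp {A} {B} (p , r) (q , r') = proj₁ rB ,
          λ κ → R-mono κ (mapTy φAt B) (λ ρ _ s → proj₂ rB ρ (toAppSat ρ s)) (R-shift κ (mapTy φAt B) (r κ _ _ (r' κ)))
        where
        toAppSat : ∀ ρ → ShiftR (obj B) (Sat (word p) ⊙[ length (obj A) ] Sat (word q)) ρ → AppSat (tr A) (tr B) p q ρ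
        toAppSat ρ (ρB , s , ρA , l , sA , sF) = appSat {ρA = ρA} {ρB} (trans l (cong length (≡-sym (bndF-tr A)))) sA sF (toF B s)
        inhabitant : Σ (List Val) (AppSat (tr A) (tr B) p q)
        inhabitant with nonEmpty (mapTy φAt B) (R-shift κ₀ (mapTy φAt B) (r κ₀ _ _ (r' κ₀)))
        ... | ρ , _ , s = ρ , toAppSat ρ s
        rB = netApp (tr A) (tr B) p q inhabitant

      module _ (realizeCon : ∀ c → Realizer (𝔗 c) (φ c)) where
        realize : ∀ {A} (e : Lin [] A) ξ → Realizer A (ev e ξ)
        realize (lcon c) ξ = realizeCon c
        realize (lI A) ξ = realizeI A
        realize (lB A B C) ξ = realizeB A B C
        realize (lC A B C) ξ = realizeC A B C
        realize (lapp {[]} {[]} e e' p) ξ = realizeApp (realize e ξ) (realize e' ξ)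
        realize (lapp {[]} {_ ∷ _} e e' p) ξ with () ← ↭-empty-inv p
        realize (lapp {_ ∷ _} e e' p) ξ with () ← ↭-empty-inv p

        realizeTyped : ∀ {t A} → Typing 𝔗 [] t A → Realizer A (mapTm φ t)
        realizeTyped d with compile d
        ... | e , s with realize e (level 0)
        ...   | p , r = p , λ κ → R-≈ κ _ s (r κ)

mapTy-atom : ∀ (A : LTy ⊤) → mapTy atom A ≡ A
mapTy-atom (atom _) = refl
mapTy-atom (A ⊸ B) = cong₂ _⊸_ (mapTy-atom A) (mapTy-atom B)

mapTm-con : ∀ {C} (t : Tm C) → mapTm con t ≡ t
mapTm-con (var k) = refl
mapTm-con (con x) = refl
mapTm-con (app t s) = cong₂ app (mapTm-con t) (mapTm-con s)
mapTm-con (lam t) = cong lam (mapTm-con t)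

-- Two readings of trees: up to βη, and in the filter model.

module Trees (N : Set) (n : ℕ) where
  open Realizability N n public
  open Valuations T

  -- `build` is a node that still waits for its last `j` subtrees; the two equations keep its term
  -- and its encoding in step with `M` and `u`.
  treeAccepts : ∀ {A k p j} (is : Vec (Fin (suc k)) j) (build : Vec (Tr N n) j → Tr N n) {h M u} → M ≈βη h →
    (∀ αs → rho (build αs) ≡ rhoArgs h αs) → (∀ αs → encode (build αs) ≡ u ++ encodeArgs A k p αs is) →
    Accepts (λ w M → Σ (Tr N n) λ α → encode α ≡ w × M ≈βη rho α) A k p M u is
  treeAccepts [] build e f g =
    build [] , trans (g []) (++-identityʳ _) , ≈trans e (≡⇒≈ (≡-sym (f [])))
  treeAccepts (i ∷ is) build {u = u} e f g w M' (α , refl , e') =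
    treeAccepts is (λ αs → build (α ∷ αs)) (≈app e e') (λ αs → f (α ∷ αs))
      (λ αs → trans (g (α ∷ αs)) (trans (cong (u ++_) (≡-sym (++-assoc (encode α) (_ ∷ []) _)))
        (≡-sym (++-assoc u (encode α ++ _ ∷ []) _))))

  treeKind : Kind
  treeKind = record
    { K     = λ w M → Σ (Tr N n) λ α → encode α ≡ w × M ≈βη rho α
    ; K-≈   = λ e (α , p , q) → α , p , ≈trans (≈sym e) q
    ; K-con = λ A k p → treeAccepts (tabulate suc) (node A k p) ≈refl (λ _ → refl) (λ _ → refl)
    }

  open Tokens T

  -- A tree token demands an argument containing the dummy token, which the tokens of
  -- variables lack: thus a tree applied to a variable denotes the empty set.
  dummy : Tok
  dummy = tok [] nothing

  treeTok : List T → Tok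
  treeTok w = tok ((dummy ∷ []) ∷ []) (just w)

  -- With no demands on arguments, it entails every token with the same atom, in particular
  -- `treeTok []`. A term with this token can therefore pass for a tree with the empty word, and so
  -- can its application to anything.
  varTok : Tok
  varTok = tok [] (just [])

  treeTok-injective : ∀ {w w'} → treeTok w ⊑ treeTok w' → w ≡ w'
  treeTok-injective p with refl ← ⊑-atomOf p = refl

  -- The denotation of a constructor computes encodings: it reads off a word from each argument and
  -- appends that word with its separator to `u`.
  ConTok : ∀ A k (p : k ≤ n) {j} → List T → Vec (Fin (suc k)) j → Tok → Set
  ConTok A k p u [] s       = treeTok u ⊑ s
  ConTok A k p u (i ∷ is) s = Σ (List T) λ w → ↑ (hd s) (treeTok w) × ConTok A k p (u ++ w ++ sym A k p i ∷ []) is (tl s)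

  ConTok-up : ∀ A k p {j} u (is : Vec (Fin (suc k)) j) → Up (ConTok A k p u is)
  ConTok-up A k p u [] q d = ⊑-trans d q
  ConTok-up A k p u (i ∷ is) q (w , (x , m , r) , d) with ⊑-hd q m
  ... | y , m' , r' = w , (y , m' , ⊑-trans r' r) , ConTok-up A k p _ is (⊑-tl q) d

  ConDen : TreeCon N n → Tok → Set
  ConDen (tcon A k p) = ConTok A k p (sym A k p zero ∷ []) (tabulate suc)

  ConDen-up : ∀ c → Up (ConDen c)
  ConDen-up (tcon A k p) = ConTok-up A k p (sym A k p zero ∷ []) (tabulate suc)

  open Denotation ConDen ConDen-up

  vars : Env
  vars _ = ↑ (varTok ∷ [])

  vars-up : UpEnv vars
  vars-up _ = ↑-up _

  tokAccepts : ∀ {A k p j} (is : Vec (Fin (suc k)) j) {M u} → (∀ s → ConTok A k p u is s → ⟦ M ⟧ vars s) →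
               Accepts (λ w M → ⟦ M ⟧ vars (treeTok w)) A k p M u is
  tokAccepts [] h = h _ ⊑-refl
  tokAccepts {A} {k} {p} (i ∷ is) {M} {u} h w M' d =
    tokAccepts is (λ { (tok Xs a) c → treeTok w ∷ [] , h _ (w , (_ , here refl , ⊑-refl) , c) , λ { (here refl) → d ; (there ()) } })

  tokKind : Kind
  tokKind = record
    { K     = λ w M → ⟦ M ⟧ vars (treeTok w)
    ; K-≈   = λ e → proj₁ (≈-sound e vars-up)
    ; K-con = λ A k p → tokAccepts {A} {k} {p} (tabulate suc) {con (tcon A k p)} {sym A k p zero ∷ []} (λ _ c → c)
    }

  mutual
    -- Mutual with nonemptiness: at `A ⊸ B` the full relation composed with `Q` is full again only
    -- if `Q` has a solution.
    R-full : ∀ A M → ⟦ M ⟧ vars varTok → R tokKind A (λ _ → ⊤) M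
    R-full (atom _) M d = lift ([] , ⟦⟧-up M vars-up base d , λ _ _ → 0 , tt)
    R-full (A ⊸ B) M d Q M' r with tokNonEmpty A r
    ... | ρ' , l , q =
      R-mono tokKind B (λ _ _ _ → ρ' , l , q , tt) (R-full B (app M M') ([] , ⟦⟧-up M vars-up base d , λ ()))

    R-var : ∀ A → R tokKind A (λ _ → ⊤) (var 0)
    R-var A = R-full A (var 0) (varTok , here refl , ⊑-refl)

    -- To inspect a relation of arrow type some argument is needed. A closed one may not exist, but
    -- a free variable always serves.
    tokNonEmpty : NonEmpty tokKind
    tokNonEmpty (atom _) (lift (w , _ , q)) = _ , refl , proj₂ (q [] 0)
    tokNonEmpty (A ⊸ B) r with tokNonEmpty B (r _ (var 0) (R-var A))
    ... | ρ , l , ρ' , l' , _ , q =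
      _ , length-++-≡ ρ (reverse ρ') {objB B} l (length-reverse-≡ ρ' (objB A) l') , q

  mutual
    -- Each tree has a token from which all its others follow, so its denotation determines its
    -- encoding. For an argument, the word read by the constructor is the right one because
    -- `treeTok` is injective up to `⊑`.
    rho-tok : ∀ α {ρ s} → ⟦ rho α ⟧ ρ s → treeTok (encode α) ⊑ s
    rho-tok (node A k p αs) d = rhoArgs-tok αs (tabulate suc) (con (tcon A k p)) _ (λ _ c → c) d

    rhoArgs-tok : ∀ {A k p j} (αs : Vec (Tr N n) j) is h u {ρ} → (∀ s → ⟦ h ⟧ ρ s → ConTok A k p u is s) →
                  ∀ {s} → ⟦ rhoArgs h αs ⟧ ρ s → treeTok (u ++ encodeArgs A k p αs is) ⊑ s
    rhoArgs-tok [] [] h u f d = ≡-subst (λ w → treeTok w ⊑ _) (≡-sym (++-identityʳ u)) (f _ d)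
    rhoArgs-tok {A} {k} {p} (α ∷ αs) (i ∷ is) h u {ρ} f {s} d =
      ≡-subst (λ w → treeTok w ⊑ s)
        (trans (++-assoc u (encode α ++ sym A k p i ∷ []) _) (cong (u ++_) (++-assoc (encode α) (sym A k p i ∷ []) _)))
        (rhoArgs-tok αs is (app h (rho α)) (u ++ encode α ++ sym A k p i ∷ []) step' d)
      where
      step' : ∀ s → ⟦ app h (rho α) ⟧ ρ s → ConTok A k p (u ++ encode α ++ sym A k p i ∷ []) is s
      step' (tok Xs a) (X , e , g) with f _ e
      ... | w , (x , m , r) , c with treeTok-injective (⊑-trans (rho-tok α (g m)) r)
      ...   | refl = c

  tok-rho : ∀ {w M} α → M ≈βη rho α → K tokKind w M → w ≡ encode α
  tok-rho α e d = ≡-sym (treeTok-injective (rho-tok α (proj₁ (≈-sound e vars-up) d)))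

  R-empty : ∀ A {Q M} → (∀ s → ⟦ M ⟧ vars s → ⊥) → R tokKind A Q M → ⊥
  R-empty (atom _) h (lift (w , d , _)) = h _ d
  R-empty (A ⊸ B) h r =
    R-empty B (λ { s (X , d , _) → h _ d }) (r _ (var 0) (R-var A))

  rho-var-empty : ∀ {M} α → M ≈βη rho α → ∀ s → ⟦ app M (var 0) ⟧ vars s → ⊥
  rho-var-empty α e (tok Xs a) (X , d , f) with ⊑-hd (rho-tok α (proj₁ (≈-sound e vars-up) d)) (here refl)
  ... | y , m , p with f m
  -- Entailment preserves atoms: a token of a variable has the atom `just []`, while `dummy` has
  -- `nothing`.
  ...   | _ , here refl , q with () ← trans (⊑-atomOf q) (⊑-atomOf p)

  rho-not-arrow : ∀ {A B Q M} α → M ≈βη rho α → R tokKind (A ⊸ B) Q M → ⊥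
  rho-not-arrow {A} {B} α e r =
    R-empty B (rho-var-empty α e) (r _ (var 0) (R-var A))

  -- Multiwords of the tree constructors.

  block : ℕ → ℕ
  block zero    = zero
  block (suc j) = suc (suc (block j))

  -- Block 0 of [T ⊸ … ⊸ T] is the result; the arguments follow, the last one first.
  mutual
    chain : ∀ A k (p : k ≤ n) {j} → ℕ → Fin (suc k) → Vec (Fin (suc k)) j → List (Edge ℕ T)
    chain A k p {j} s i is = (s , sym A k p i ∷ [] , suc (block j)) ∷ chainTail A k p is

    chainTail : ∀ A k (p : k ≤ n) {j} → Vec (Fin (suc k)) j → List (Edge ℕ T)
    chainTail A k p [] = []
    chainTail A k p {suc j} (i ∷ is) = chain A k p (block (suc j)) i is

  conMW : TreeCon N n → MW T
  conMW (tcon A k p) = mw (chain A k p 0 zero (tabulate suc)) []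

  length-arrows : ∀ j → length (objB (arrows j)) ≡ block (suc j)
  length-arrows zero = refl
  length-arrows (suc j) = trans (length-++ (objB (arrows j))) (trans (+-comm _ 2) (cong (λ m → suc (suc m)) (length-arrows j)))

  positions-arrows : ∀ b j → positions b 0 (objB (arrows (suc j))) ≡
    positions b 0 (objB (arrows j)) ++ positions b (block (suc j)) (true ∷ false ∷ [])
  positions-arrows b j = trans (positions-++ b 0 (objB (arrows j)) _)
    (cong (λ m → positions b 0 (objB (arrows j)) ++ positions b m (true ∷ false ∷ [])) (length-arrows j))

  -- A chain starts at `s` instead of at the left endpoint 0 of the result. Adding the missing
  -- vertex on either side states this without subtraction; at `s` equal to 0 both are cancelled.
  chain-sources : ∀ A k p {j} s i (is : Vec (Fin (suc k)) j) →
    0 ∷ ends true (chain A k p s i is) ↭ s ∷ positions true 0 (objB (arrows j))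
  chain-sources A k p s i [] = ↭-swap 0 s ↭-refl
  chain-sources A k p {suc j} s i (i' ∷ is) rewrite positions-arrows true j =
    ↭-trans (↭-swap 0 s (↭-refl))
      (prep s (↭-trans (chain-sources A k p (block (suc j)) i' is) (++-comm (block (suc j) ∷ []) _)))

  chain-targets : ∀ A k p {j} s i (is : Vec (Fin (suc k)) j) →
    ends false (chain A k p s i is) ↭ positions false 0 (objB (arrows j))
  chain-targets A k p s i [] = ↭-refl
  chain-targets A k p {suc j} s i (i' ∷ is) rewrite positions-arrows false j =
    ↭-trans (prep _ (chain-targets A k p (block (suc j)) i' is)) (++-comm (suc (block (suc j)) ∷ []) _)

  conMW-matches : ∀ c → Matches (objB (treeTy c)) (conMW c)
  conMW-matches (tcon A k p) true  = drop-∷ (chain-sources A k p 0 zero (tabulate suc))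
  conMW-matches (tcon A k p) false = chain-targets A k p 0 zero (tabulate suc)

  satE-weaken : ∀ {V : Set} {ν ν' : V → Maybe Val} → (∀ {u x} → ν u ≡ just x → ν' u ≡ just x) →
                ∀ {es : List (Edge V T)} → SatE ν es → SatE ν' es
  satE-weaken h [] = []
  satE-weaken {ν = ν} {ν'} h {(u , w , v) ∷ es} (r ∷ rs) = go r refl refl ∷ satE-weaken h rs
    where
    go : ∀ {a b} → Reads? w a b → ν u ≡ a → ν v ≡ b → Reads? w (ν' u) (ν' v)
    go (reads r) e e' rewrite h e | h e' = reads r

  -- Invariant of partial application: from vertex 0 the word `u` has been read, and the path stands
  -- at the right endpoint of block `j` with value `(y , m)`. The number `m'` depends on this value
  -- alone and not on the rest `τ`. The remaining edges avoid vertex 0, hence the quantification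
  -- over `x`.
  Reaches : ∀ A k (p : k ≤ n) {j} → Vec (Fin (suc k)) j → List T → Rel → Set
  Reaches A k p {j} is u Q = ∀ y m → Σ ℕ λ m' → ∀ τ → length τ ≡ suc (block j) → τ !! block j ≡ just (y , m) →
    (∀ x → SatE ((x ∷ τ) !!_) (chainTail A k p is)) → Q ((u ++ y , m') ∷ τ)

  chain-R : ∀ κ A k p {j} (is : Vec (Fin (suc k)) j) {u Q M} →
            Reaches A k p is u Q → Accepts (K κ) A k p M u is → R κ (arrows j) Q M
  chain-R κ A k p [] h acc = lift (_ , acc , λ z m → proj₁ (h z m) , proj₂ (h z m) ((z , m) ∷ []) refl refl (λ _ → []))
  chain-R κ A k p {suc j} (i ∷ is) {u} {Q} h acc Q₁ M₁ (lift (w , k₁ , q₁)) =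
    chain-R κ A k p is reach (acc w M₁ k₁)
    where
    S = sym A k p i
    reach : Reaches A k p is (u ++ w ++ S ∷ []) (Q ⊙[ 2 ] Q₁)
    -- The continuation of the argument begins with its separator, and the edge that carries the
    -- separator uses up one unit of the number.
    reach y m with q₁ (S ∷ y) (suc m)
    ... | m₁ , q with h (w ++ S ∷ y) m₁
    ...   | m' , f = m' , λ τ l e s →
      lv ∷ rv ∷ [] , refl , q ,
      ≡-subst (λ v → Q ((v , m') ∷ τ ++ rv ∷ lv ∷ []))
        (≡-sym (trans (++-assoc u (w ++ S ∷ []) y) (cong (u ++_) (++-assoc w (S ∷ []) y))))
        (f (τ ++ rv ∷ lv ∷ []) (trans (length-++ τ) (trans (+-comm (length τ) 2) (cong (λ x → suc (suc x)) l)))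
          (trans (cong ((τ ++ rv ∷ lv ∷ []) !!_) (trans (cong suc (≡-sym l)) (+-comm 1 (length τ)))) (!!-++ʳ τ))
          (λ x → first x τ l e ∷ satE-weaken (λ {p} → !!-++ˡ (x ∷ τ) {p = p}) (s x)))
      where
      lv rv : Val
      lv = w ++ S ∷ y , m₁
      rv = S ∷ y , suc m
      first : ∀ x τ → length τ ≡ suc (block j) → τ !! block j ≡ just (y , m) →
              EdgeSat ((x ∷ τ ++ rv ∷ lv ∷ []) !!_) (block (suc j) , S ∷ [] , suc (block j))
      first x τ l e
        rewrite !!-++ˡ τ {rv ∷ lv ∷ []} e
              | trans (cong ((τ ++ rv ∷ lv ∷ []) !!_) (trans (≡-sym l) (≡-sym (+-identityʳ (length τ))))) (!!-++ʳ τ {rv ∷ lv ∷ []}) =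
        reads (refl , ≤-refl)

  conMW-R : ∀ κ c → R κ (treeTy c) (Sat (conMW c)) (con c)
  conMW-R κ (tcon A k p) = chain-R κ A k p (tabulate suc)
    (λ y m → suc m , λ τ l e s → start y m τ e ∷ s _) (K-con κ A k p)
    where
    start : ∀ y m τ → τ !! block k ≡ just (y , m) →
            EdgeSat (((sym A k p zero ∷ y , suc m) ∷ τ) !!_) (0 , sym A k p zero ∷ [] , suc (block k))
    start y m τ e rewrite e = reads (refl , ≤-refl)

  -- The tree signature under its identity map. Here the constants are realized by explicit
  -- multiwords, and the combinators extend this to all closed typed terms.
  module TreeLevel = Realizers {⊤} {TreeCon N n} treeTy atom con (λ _ → refl) 1 (λ _ → true ∷ false ∷ []) (λ _ → zero) (λ _ → refl)

  open TreeLevel using (tr; bndF-tr)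
  open TreeLevel.Realize (λ _ _ → ⊤) _ tokKind tokNonEmpty using (Realizer; net; word; matches; realizeTyped)

  realizeTreeCon : ∀ c → Realizer (treeTy c) (con c)
  realizeTreeCon c =
    net (conMW c) tt (≡-subst (λ X → Matches X (conMW c)) (≡-sym (trans (bndF-tr (treeTy c)) (cong objB (mapTy-atom (treeTy c))))) (conMW-matches c)) refl ,
    λ κ → ≡-subst (λ A → R κ A (Sat (conMW c)) (con c)) (≡-sym (mapTy-atom (treeTy c))) (conMW-R κ c)

  abstract
    treeRealizer : ∀ {t A} → Typing treeTy [] t A →
                   Σ (MW T) λ σ → Matches (objB A) σ × cycles σ ≡ [] × (∀ κ → R κ A (Sat σ) t)
    treeRealizer {t} {A} d with realizeTyped realizeTreeCon d
    ... | p , r = word p , ≡-subst (λ X → Matches X (word p)) (trans (bndF-tr A) (cong objB (mapTy-atom A))) (matches p) ,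
        TreeLevel.Realize.acyclic p ,
        λ κ → ≡-subst₂ (λ A t → R κ A (Sat (word p)) t) (mapTy-atom A) (mapTm-con t) (r κ)

∷-split : ∀ {X : Set} (Γ : List X) {Δ Γ₁ F Γ₂} → Γ ++ Δ ≡ Γ₁ ++ F ∷ Γ₂ →
          (Σ (List X) λ Γ' → Γ ≡ Γ₁ ++ F ∷ Γ' × Γ₂ ≡ Γ' ++ Δ) ⊎
          (Σ (List X) λ Γ' → Γ₁ ≡ Γ ++ Γ' × Δ ≡ Γ' ++ F ∷ Γ₂)
∷-split [] {Γ₁ = Γ₁} e = inj₂ (Γ₁ , refl , e)
∷-split (x ∷ Γ) {Γ₁ = []} refl = inj₁ (Γ , refl , refl)
∷-split (x ∷ Γ) {Γ₁ = y ∷ Γ₁} e with refl ← ∷-injectiveˡ e | ∷-split Γ {Γ₁ = Γ₁} (∷-injectiveʳ e)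
... | inj₁ (Γ' , refl , e₂) = inj₁ (Γ' , refl , e₂)
... | inj₂ (Γ' , refl , e₂) = inj₂ (Γ' , refl , e₂)

-- A Chu-style phase model over worlds of linear variables.

module PhaseModel (N : Set) (n : ℕ) (nLit : ℕ) (bnd : Fin nLit → Boundary) (At : Set) (Cell : Set₁) where
  open Realizability N n using (T; Rel; ShiftR; length-++-≡)
  open Valuations T
  open LL nLit bnd T
  open RuleSat nLit bnd T
  open RuleMatches nLit bnd T using (bndF-dual; perp-perp; perp-++)

  Elem : Set₁
  Elem = (ℕ → Cell) → Rel

  Pred : Set₂
  Pred = World At → Elem → Set₁

  Agree : World At → (ℕ → Cell) → (ℕ → Cell) → Set₁
  Agree Θ ζ ζ' = ∀ {x A} → (x , A) ∈ Θ → ζ x ≡ ζ' x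

  Supported : World At → Elem → Set₁
  Supported Θ Q = ∀ {ζ ζ'} → Agree Θ ζ ζ' → ∀ ρ → Q ζ ρ → Q ζ' ρ

  Monotone : ℕ → Pred → Set₁
  Monotone m X = ∀ {Θ Θ' Q Q'} → Θ ↭ Θ' → (∀ ζ ρ → length ρ ≡ m → Q ζ ρ → Q' ζ ρ) → X Θ Q → X Θ' Q'

  ShiftClosed : Boundary → Pred → Set₁
  ShiftClosed X P = ∀ {Θ Q} → P Θ Q → P Θ (λ ζ → ShiftR X (Q ζ))

  shift-supported : ∀ {X Θ Q} → Supported Θ Q → Supported Θ (λ ζ → ShiftR X (Q ζ))
  shift-supported s ag ρ (ρ' , p , q) = ρ' , p , s ag ρ' q

  -- The resources are divided between the two components. Asking for an inclusion in `Q` makes the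
  -- predicate upward closed in `Q`.
  record Ten (a b : ℕ) (X Y : Pred) (Θ : World At) (Q : Elem) : Set₁ where
    constructor ten
    field
      {Θ₁ Θ₂} : World At
      {Q₁ Q₂} : Elem
      perm  : Θ₁ ++ Θ₂ ↭ Θ
      supp₁ : Supported Θ₁ Q₁
      supp₂ : Supported Θ₂ Q₂
      elem₁ : X Θ₁ Q₁
      elem₂ : Y Θ₂ Q₂
      incl  : ∀ ζ {ρ₁ ρ₂} → length ρ₁ ≡ a → length ρ₂ ≡ b → Q₁ ζ ρ₁ → Q₂ ζ ρ₂ → Q ζ (ρ₁ ++ ρ₂)

  feedˡ : ℕ → Elem → Elem → Elem
  feedˡ a Q Q' ζ ρ = Σ (List Val) λ ρ' → length ρ' ≡ a × Q' ζ ρ' × Q ζ (ρ ++ reverse ρ')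

  feedʳ : ℕ → Elem → Elem → Elem
  feedʳ b Q Q' ζ ρ = Σ (List Val) λ ρ' → length ρ' ≡ b × Q' ζ ρ' × Q ζ (reverse ρ' ++ ρ)

  -- As for par in a Chu space, both directions are recorded: a counter-element of either side is
  -- turned into an element of the other.
  Par : (a b : ℕ) (X⁻ X Y⁻ Y : Pred) → Pred
  Par a b X⁻ X Y⁻ Y Θ Q =
    (∀ Θ' Q' → Supported Θ' Q' → X⁻ Θ' Q' → Y (Θ ++ Θ') (feedˡ a Q Q')) ×
    (∀ Θ' Q' → Supported Θ' Q' → Y⁻ Θ' Q' → X (Θ ++ Θ') (feedʳ b Q Q'))

  size : Fm nLit → ℕ
  size A = length (bndF A)

  polar : Fm nLit → Bool → Boundary
  polar A true  = bndF A
  polar A false = perp (bndF A)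

  ten-monotone : ∀ {a b m X Y} → a + b ≡ m → Monotone m (Ten a b X Y)
  ten-monotone e p f (ten q s₁ s₂ x y i) =
    ten (↭-trans q p) s₁ s₂ x y
      (λ ζ {ρ₁} l₁ l₂ q₁ q₂ → f ζ _ (trans (length-++ ρ₁) (trans (cong₂ _+_ l₁ l₂) e)) (i ζ l₁ l₂ q₁ q₂))

  par-monotone : ∀ {a b m X⁻ X Y⁻ Y} → b + a ≡ m → Monotone a X → Monotone b Y → Monotone m (Par a b X⁻ X Y⁻ Y)
  par-monotone e mX mY p f (g , h) =
    (λ Θ' Q' s x → mY (++⁺ʳ Θ' p)
      (λ ζ ρ l (ρ' , l' , q' , q) → ρ' , l' , q' ,
        f ζ _ (trans (length-++ ρ) (trans (cong₂ _+_ l (trans (length-reverse ρ') l')) e)) q) (g Θ' Q' s x)) ,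
    (λ Θ' Q' s y → mX (++⁺ʳ Θ' p)
      (λ ζ ρ l (ρ' , l' , q' , q) → ρ' , l' , q' ,
        f ζ _ (trans (length-++ (reverse ρ')) (trans (cong₂ _+_ (trans (length-reverse ρ') l') l) e)) q) (h Θ' Q' s y))

  ten-shift : ∀ {a b X Y x y} → ShiftClosed x X → ShiftClosed y Y → a ≡ length x → b ≡ length y →
              ShiftClosed (x ++ y) (Ten a b X Y)
  ten-shift sX sY refl refl (ten p s₁ s₂ x y i) =
    ten p (shift-supported s₁) (shift-supported s₂) (sX x) (sY y)
      (λ { ζ _ _ (ρ₁' , h₁ , q₁) (ρ₂' , h₂ , q₂) →
           ρ₁' ++ ρ₂' , shift-++ h₁ h₂ , i ζ (proj₂ (shift-length h₁)) (proj₂ (shift-length h₂)) q₁ q₂ })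

  par-shift : ∀ {a b X⁻ X Y⁻ Y x x⁻ y y⁻} → Monotone a X → Monotone b Y →
              ShiftClosed x X → ShiftClosed x⁻ X⁻ → ShiftClosed y Y → ShiftClosed y⁻ Y⁻ →
              perp x⁻ ≡ x → perp y⁻ ≡ y → a ≡ length x⁻ → b ≡ length y⁻ →
              ShiftClosed (y ++ x) (Par a b X⁻ X Y⁻ Y)
  par-shift mX mY sX sX⁻ sY sY⁻ refl refl refl refl (g , h) =
    (λ Θ' Q' s x → mY ↭-refl
      (λ { ζ ρ l (ρ₁ , h₁ , ρ₂ , l₂ , (ρ₃ , h₃ , q') , q) →
           ρ₃ , proj₂ (shift-length h₃) , q' , _ , shift-++ h₁ (shift-perp h₃) , q })
      (sY (g Θ' _ (shift-supported s) (sX⁻ x)))) ,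
    (λ Θ' Q' s y → mX ↭-refl
      (λ { ζ ρ l (ρ₁ , h₁ , ρ₂ , l₂ , (ρ₃ , h₃ , q') , q) →
           ρ₃ , proj₂ (shift-length h₃) , q' , _ , shift-++ (shift-perp h₃) h₁ , q })
      (sX (h Θ' _ (shift-supported s) (sY⁻ y))))

  module Interpretation (Lit : Fin nLit → Pred)
    (Lit-monotone : ∀ P → Monotone (length (bnd P)) (Lit P))
    (Lit-shift : ∀ P → ShiftClosed (bnd P) (Lit P)) where

    Empty⁻ : Pred
    Empty⁻ _ _ = Lift _ ⊥

    -- sem A true are the elements of A and sem A false its counter-elements.  Literals have no
    -- counter-elements, which makes A ⊸ B the full space of functions from elements to elements.
    sem : Fm nLit → Bool → Pred
    sem (pos P) true  = Lit P
    sem (pos P) false = Empty⁻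
    sem (neg P) true  = Empty⁻
    sem (neg P) false = Lit P
    sem (A ⊗ B) true  = Ten (size A) (size B) (sem A true) (sem B true)
    sem (A ⊗ B) false = Par (size A) (size B) (sem A true) (sem A false) (sem B true) (sem B false)
    sem (A ⅋ B) true  = Par (size A) (size B) (sem A false) (sem A true) (sem B false) (sem B true)
    sem (A ⅋ B) false = Ten (size A) (size B) (sem A false) (sem B false)

    size-dual : ∀ A → size (dual A) ≡ size A
    size-dual A = trans (cong length (bndF-dual A)) (length-perp (bndF A))

    sem-dual : ∀ A p → sem (dual A) p ≡ sem A (not p)
    sem-dual (pos P) true  = refl
    sem-dual (pos P) false = refl
    sem-dual (neg P) true  = refl
    sem-dual (neg P) false = refl
    sem-dual (A ⊗ B) true
      rewrite size-dual A | size-dual B | sem-dual A true | sem-dual A false | sem-dual B true | sem-dual B false = refl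
    sem-dual (A ⊗ B) false
      rewrite size-dual A | size-dual B | sem-dual A false | sem-dual B false = refl
    sem-dual (A ⅋ B) true
      rewrite size-dual A | size-dual B | sem-dual A true | sem-dual B true = refl
    sem-dual (A ⅋ B) false
      rewrite size-dual A | size-dual B | sem-dual A true | sem-dual A false | sem-dual B true | sem-dual B false = refl

    sem-monotone : ∀ A p → Monotone (size A) (sem A p)
    sem-monotone (pos P) true  = Lit-monotone P
    sem-monotone (neg P) false p f x =
      Lit-monotone P p (λ ζ ρ l → f ζ ρ (trans l (≡-sym (length-perp (bnd P))))) x
    sem-monotone (A ⊗ B) true  = ten-monotone (≡-sym (length-++ (bndF A)))
    sem-monotone (A ⊗ B) false =
      par-monotone (trans (+-comm (size B) (size A)) (≡-sym (length-++ (bndF A)))) (sem-monotone A false) (sem-monotone B false)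
    sem-monotone (A ⅋ B) true  = par-monotone (≡-sym (length-++ (bndF B))) (sem-monotone A true) (sem-monotone B true)
    sem-monotone (A ⅋ B) false = ten-monotone (trans (+-comm (size A) (size B)) (≡-sym (length-++ (bndF B))))

    -- This is what the identity rule asks of a formula, as an axiom link hands on an element only
    -- up to a shift.
    sem-shift : ∀ A p → ShiftClosed (polar A p) (sem A p)
    sem-shift (pos P) true  = Lit-shift P
    sem-shift (neg P) false = ≡-subst (λ X → ShiftClosed X (Lit P)) (≡-sym (perp-perp (bnd P))) (Lit-shift P)
    sem-shift (A ⊗ B) true  = ten-shift (sem-shift A true) (sem-shift B true) refl refl
    sem-shift (A ⊗ B) false =
      ≡-subst (λ X → ShiftClosed X (sem (A ⊗ B) false)) (≡-sym (perp-++ (bndF A) (bndF B)))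
        (par-shift (sem-monotone A false) (sem-monotone B false) (sem-shift A false) (sem-shift A true)
          (sem-shift B false) (sem-shift B true) refl refl refl refl)
    sem-shift (A ⅋ B) true =
      par-shift (sem-monotone A true) (sem-monotone B true) (sem-shift A true) (sem-shift A false)
        (sem-shift B true) (sem-shift B false) (perp-perp (bndF A)) (perp-perp (bndF B))
        (≡-sym (length-perp (bndF A))) (≡-sym (length-perp (bndF B)))
    sem-shift (A ⅋ B) false =
      ≡-subst (λ X → ShiftClosed X (sem (A ⅋ B) false)) (≡-sym (perp-++ (bndF B) (bndF A)))
        (ten-shift (sem-shift A false) (sem-shift B false) (≡-sym (length-perp (bndF A))) (≡-sym (length-perp (bndF B))))

    record Counter (A : Fm nLit) : Set₁ where
      constructor counter
      field
        {world} : World At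
        {rel}   : Elem
        supp    : Supported world rel
        elem    : sem A false world rel
    open Counter

    Counters : List (Fm nLit) → Set₁
    Counters = All Counter

    worlds : ∀ {Γ} → Counters Γ → World At
    worlds []       = []
    worlds (c ∷ cs) = world c ++ worlds cs

    -- A counter-element of `A` lives on the dual boundary, hence it is applied to the reversed
    -- block.
    rels : ∀ {Γ} → Counters Γ → (ℕ → Cell) → List (List Val) → Set
    rels [] ζ []                 = ⊤
    rels [] ζ (_ ∷ _)            = ⊥
    rels (c ∷ cs) ζ []           = ⊥
    rels {A ∷ Γ} (c ∷ cs) ζ (ρ ∷ ρs) = (length ρ ≡ size A × rel c ζ (reverse ρ)) × rels cs ζ ρs

    rels-fits : ∀ {Γ} (c : Counters Γ) {ζ ρs} → rels c ζ ρs → Fits Γ ρs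
    rels-fits [] {ρs = []} _ = []
    rels-fits (c ∷ cs) {ρs = ρ ∷ ρs} ((l , _) , r) = l ∷ rels-fits cs r

    rels-agree : ∀ {Γ} (c : Counters Γ) {ζ ζ' ρs} → Agree (worlds c) ζ ζ' → rels c ζ ρs → rels c ζ' ρs
    rels-agree [] {ρs = []} ag _ = tt
    rels-agree (c ∷ cs) {ρs = ρ ∷ ρs} ag ((l , q) , r) =
      (l , supp c (λ m → ag (∈-++⁺ˡ m)) _ q) , rels-agree cs (λ m → ag (∈-++⁺ʳ (world c) m)) r

    worlds-++ : ∀ {Γ Δ} (c : Counters Γ) (d : Counters Δ) → worlds (All-++⁺ c d) ≡ worlds c ++ worlds d
    worlds-++ [] d = refl
    worlds-++ (c ∷ cs) d = trans (cong (world c ++_) (worlds-++ cs d)) (≡-sym (++-assoc (world c) _ _))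

    worlds-split : ∀ Γ {Δ} (c : Counters (Γ ++ Δ)) → worlds (All-++⁻ˡ Γ c) ++ worlds (All-++⁻ʳ Γ c) ≡ worlds c
    worlds-split [] c = refl
    worlds-split (A ∷ Γ) (c ∷ cs) = trans (++-assoc (world c) _ _) (cong (world c ++_) (worlds-split Γ cs))

    rels-++⁻ : ∀ {Γ Δ} (c : Counters Γ) (d : Counters Δ) {ζ ρs} → rels (All-++⁺ c d) ζ ρs →
               Σ (List (List Val)) λ γ → Σ (List (List Val)) λ δ → ρs ≡ γ ++ δ × rels c ζ γ × rels d ζ δ
    rels-++⁻ [] d {ρs = ρs} r = [] , ρs , refl , tt , r
    rels-++⁻ (c ∷ cs) d {ρs = ρ ∷ ρs} (q , r) with rels-++⁻ cs d r
    ... | γ , δ , refl , r₁ , r₂ = ρ ∷ γ , δ , refl , (q , r₁) , r₂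

    rels-join : ∀ Γ {Δ} (c : Counters (Γ ++ Δ)) {ζ γ δ} → rels (All-++⁻ˡ Γ c) ζ γ → rels (All-++⁻ʳ Γ c) ζ δ →
                rels c ζ (γ ++ δ)
    rels-join [] c {γ = []} _ r = r
    rels-join (A ∷ Γ) (c ∷ cs) {γ = ρ ∷ γ} (q , r₁) r₂ = q , rels-join Γ cs r₁ r₂

    plug : ∀ {Γ₁ Γ₂} → Counters Γ₁ → Counters Γ₂ → MW T → Elem
    plug c₁ c₂ σ ζ ρ = Σ (List (List Val)) λ γ₁ → Σ (List (List Val)) λ γ₂ →
      rels c₁ ζ γ₁ × rels c₂ ζ γ₂ × SatΓ σ (γ₁ ++ ρ ∷ γ₂)

    plug-supported : ∀ {Γ₁ Γ₂} (c₁ : Counters Γ₁) (c₂ : Counters Γ₂) σ →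
                     Supported (worlds c₁ ++ worlds c₂) (plug c₁ c₂ σ)
    plug-supported c₁ c₂ σ ag ρ (γ₁ , γ₂ , r₁ , r₂ , s) =
      γ₁ , γ₂ , rels-agree c₁ (λ m → ag (∈-++⁺ˡ m)) r₁ , rels-agree c₂ (λ m → ag (∈-++⁺ʳ (worlds c₁) m)) r₂ , s

    -- Any formula of the sequent may be the one that is produced, with counter-elements plugged
    -- into all others. The cases are independent: elements and counter-elements are not defined as
    -- each other's orthogonals, so one choice of `F` does not yield the rest.
    Sound : List (Fm nLit) → MW T → Set₁
    Sound Γ σ = ∀ Γ₁ F Γ₂ → Γ ≡ Γ₁ ++ F ∷ Γ₂ → (c₁ : Counters Γ₁) (c₂ : Counters Γ₂) →
                sem F true (worlds c₁ ++ worlds c₂) (plug c₁ c₂ σ)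

    module W = Algebra.Solver.CommutativeMonoid (++-commutativeMonoid {A = ℕ × LTy At})
    open W using (_⊕_; _⊜_)

    sound-id : ∀ A → Sound (dual A ∷ A ∷ []) (idMW (bndF A))
    sound-id A [] F Γ₂ refl [] (c ∷ []) =
      ≡-subst (λ P → P (world c ++ []) (plug [] (c ∷ []) (idMW (bndF A)))) (≡-sym (sem-dual A true))
        (sem-monotone A false (↭-reflexive (≡-sym (++-identityʳ (world c))))
          (λ { ζ ρ l (ρ' , s , q) → [] , reverse ρ' ∷ [] , tt ,
               ((trans (length-reverse ρ') (trans (proj₂ (shift-length s)) (length-perp (bndF A))) ,
                 ≡-subst (rel c ζ) (≡-sym (reverse-involutive ρ')) q) , tt) ,
               ≡-subst (λ v → Sat (idMW (bndF A)) (reverse ρ' ++ v)) (reverse-involutive ρ)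
                 (idMW-sat (≡-subst (λ X → Shift X (reverse ρ') (reverse ρ)) (perp-perp (bndF A)) (shift-perp s))) })
          (sem-shift A false (elem c)))
    sound-id A (_ ∷ []) F Γ₂ refl (c ∷ []) [] =
      sem-monotone A true (↭-reflexive (≡-sym (trans (++-identityʳ _) (++-identityʳ (world c)))))
        (λ { ζ ρ l (ρ' , s , q) → reverse ρ' ∷ [] , [] ,
             ((trans (length-reverse ρ') (trans (proj₂ (shift-length s)) (≡-sym (size-dual A))) ,
               ≡-subst (rel c ζ) (≡-sym (reverse-involutive ρ')) q) , tt) , tt , idMW-sat s })
        (sem-shift A true (≡-subst (λ P → P (world c) (rel c)) (sem-dual A false) (elem c)))
    sound-id A (_ ∷ _ ∷ []) F Γ₂ ()
    sound-id A (_ ∷ _ ∷ _ ∷ _) F Γ₂ ()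

    exMW : List (Fm nLit) → Fm nLit → Fm nLit → MW T → MW T
    exMW Δ B A = relabel (exPos (length (bndCtx Δ)) (size B) (size A))

    sound-ex : ∀ Γ A B Δ {σ} → Sound (Γ ++ A ∷ B ∷ Δ) σ →
               Sound (Γ ++ B ∷ A ∷ Δ) (exMW Δ B A σ)
    sound-ex Γ A B Δ {σ} h Γ₁ F Γ₂ e c₁ c₂ with ∷-split Γ {Γ₁ = Γ₁} e
    ... | inj₁ (Γ' , refl , refl) with All-++⁻ˡ Γ' c₂ in eˡ | All-++⁻ʳ Γ' c₂ in eʳ
    ...   | cΓ' | cB ∷ cA ∷ cΔ =
      sem-monotone F true
        (≡-subst₂ (λ x y → worlds c₁ ++ x ↭ worlds c₁ ++ y) (≡-sym (worlds-++ cΓ' (cA ∷ cB ∷ cΔ)))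
          (trans (≡-sym (cong₂ (λ x y → worlds x ++ worlds y) eˡ eʳ)) (worlds-split Γ' c₂))
          (W.solve 5 (λ a b c d e → a ⊕ (b ⊕ (c ⊕ (d ⊕ e))) ⊜ a ⊕ (b ⊕ (d ⊕ (c ⊕ e)))) ↭-refl
            (worlds c₁) (worlds cΓ') (world cA) (world cB) (worlds cΔ)))
        incl
        (h Γ₁ F (Γ' ++ A ∷ B ∷ Δ) (++-assoc Γ₁ (F ∷ Γ') _) c₁ (All-++⁺ cΓ' (cA ∷ cB ∷ cΔ)))
      where
      incl : ∀ ζ ρ → length ρ ≡ size F → plug c₁ (All-++⁺ cΓ' (cA ∷ cB ∷ cΔ)) σ ζ ρ → plug c₁ c₂ (exMW Δ B A σ) ζ ρ
      incl ζ ρ l (γ₁ , γ₂ , r₁ , r₂ , s) with rels-++⁻ cΓ' (cA ∷ cB ∷ cΔ) r₂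
      ... | γ' , ρA ∷ ρB ∷ δ , refl , r' , (qA , qB , rΔ) =
        γ₁ , γ' ++ ρB ∷ ρA ∷ δ , r₁ ,
        rels-join Γ' c₂ (≡-subst (λ c → rels c ζ γ') (≡-sym eˡ) r')
          (≡-subst (λ c → rels c ζ (ρB ∷ ρA ∷ δ)) (≡-sym eʳ) (qB , qA , rΔ)) ,
        ≡-subst (SatΓ (exMW Δ B A σ)) (++-assoc γ₁ (ρ ∷ γ') _)
          (exR-sat {σ} (γ₁ ++ ρ ∷ γ') ρA ρB δ (fits-flat (rels-fits cΔ rΔ)) (proj₁ qB) (proj₁ qA)
            (≡-subst (SatΓ σ) (≡-sym (++-assoc γ₁ (ρ ∷ γ') _)) s))
    sound-ex Γ A B Δ {σ} h Γ₁ F Γ₂ e c₁ (cA ∷ cΔ) | inj₂ ([] , refl , refl) with All-++⁻ʳ Γ c₁ in eʳ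
    ... | [] =
      sem-monotone B true
        (≡-subst₂ (λ x y → x ++ worlds cΔ ↭ y ++ (world cA ++ worlds cΔ)) (≡-sym (worlds-++ cΓ (cA ∷ [])))
          (trans (≡-sym (cong (λ x → worlds cΓ ++ worlds x) eʳ)) (worlds-split Γ c₁))
          (W.solve 3 (λ a b c → (a ⊕ (b ⊕ W.id)) ⊕ c ⊜ (a ⊕ W.id) ⊕ (b ⊕ c)) ↭-refl (worlds cΓ) (world cA) (worlds cΔ)))
        incl
        (h (Γ ++ A ∷ []) B Δ (≡-sym (++-assoc Γ (A ∷ []) _)) (All-++⁺ cΓ (cA ∷ [])) cΔ)
      where
      cΓ = All-++⁻ˡ Γ c₁
      incl : ∀ ζ ρ → length ρ ≡ size B → plug (All-++⁺ cΓ (cA ∷ [])) cΔ σ ζ ρ → plug c₁ (cA ∷ cΔ) (exMW Δ B A σ) ζ ρ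
      incl ζ ρ l (γ₁ , δ , r₁ , rΔ , s) with rels-++⁻ cΓ (cA ∷ []) r₁
      ... | γ , ρA ∷ [] , refl , r , (qA , _) =
        γ , ρA ∷ δ ,
        ≡-subst (rels c₁ ζ) (++-identityʳ γ) (rels-join Γ c₁ r (≡-subst (λ c → rels c ζ []) (≡-sym eʳ) tt)) ,
        (qA , rΔ) ,
        exR-sat {σ} γ ρA ρ δ (fits-flat (rels-fits cΔ rΔ)) l (proj₁ qA) (≡-subst (SatΓ σ) (++-assoc γ (ρA ∷ []) _) s)
    sound-ex Γ A B Δ {σ} h Γ₁ F Γ₂ e c₁ c₂ | inj₂ (_ ∷ [] , refl , refl) with All-++⁻ʳ Γ c₁ in eʳ
    ... | cB ∷ [] =
      sem-monotone A true
        (≡-subst (λ y → worlds cΓ ++ (world cB ++ worlds c₂) ↭ y ++ worlds c₂)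
          (trans (≡-sym (cong (λ x → worlds cΓ ++ worlds x) eʳ)) (worlds-split Γ c₁))
          (W.solve 3 (λ a b c → a ⊕ (b ⊕ c) ⊜ (a ⊕ (b ⊕ W.id)) ⊕ c) ↭-refl (worlds cΓ) (world cB) (worlds c₂)))
        incl
        (h Γ A (B ∷ Δ) refl cΓ (cB ∷ c₂))
      where
      cΓ = All-++⁻ˡ Γ c₁
      incl : ∀ ζ ρ → length ρ ≡ size A → plug cΓ (cB ∷ c₂) σ ζ ρ → plug c₁ c₂ (exMW Δ B A σ) ζ ρ
      incl ζ ρ l (γ , ρB ∷ δ , r , (qB , rΔ) , s) =
        γ ++ ρB ∷ [] , δ , rels-join Γ c₁ r (≡-subst (λ c → rels c ζ (ρB ∷ [])) (≡-sym eʳ) (qB , tt)) , rΔ ,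
        ≡-subst (SatΓ (exMW Δ B A σ)) (≡-sym (++-assoc γ (ρB ∷ []) _))
          (exR-sat {σ} γ ρ ρB δ (fits-flat (rels-fits c₂ rΔ)) (proj₁ qB) l s)
    sound-ex Γ A B Δ {σ} h Γ₁ F Γ₂ e c₁ c₂ | inj₂ (_ ∷ _ ∷ Γ' , refl , refl) with All-++⁻ʳ Γ c₁ in eʳ
    ... | cB ∷ cA ∷ c' =
      sem-monotone F true
        (≡-subst₂ (λ x y → x ++ worlds c₂ ↭ y ++ worlds c₂) (≡-sym (worlds-++ cΓ (cA ∷ cB ∷ c')))
          (trans (≡-sym (cong (λ x → worlds cΓ ++ worlds x) eʳ)) (worlds-split Γ c₁))
          (W.solve 5 (λ a b c d e → (a ⊕ (b ⊕ (c ⊕ d))) ⊕ e ⊜ (a ⊕ (c ⊕ (b ⊕ d))) ⊕ e) ↭-refl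
            (worlds cΓ) (world cA) (world cB) (worlds c') (worlds c₂)))
        incl
        (h (Γ ++ A ∷ B ∷ Γ') F Γ₂ (≡-sym (++-assoc Γ (A ∷ B ∷ Γ') _)) (All-++⁺ cΓ (cA ∷ cB ∷ c')) c₂)
      where
      cΓ = All-++⁻ˡ Γ c₁
      incl : ∀ ζ ρ → length ρ ≡ size F → plug (All-++⁺ cΓ (cA ∷ cB ∷ c')) c₂ σ ζ ρ → plug c₁ c₂ (exMW Δ B A σ) ζ ρ
      incl ζ ρ l (γ₁ , γ₂ , r₁ , r₂ , s) with rels-++⁻ cΓ (cA ∷ cB ∷ c') r₁
      ... | γ , ρA ∷ ρB ∷ γ' , refl , r , (qA , qB , r') =
        γ ++ ρB ∷ ρA ∷ γ' , γ₂ ,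
        rels-join Γ c₁ r (≡-subst (λ c → rels c ζ (ρB ∷ ρA ∷ γ')) (≡-sym eʳ) (qB , qA , r')) , r₂ ,
        ≡-subst (SatΓ (exMW Δ B A σ)) (≡-sym (++-assoc γ (ρB ∷ ρA ∷ γ') _))
          (exR-sat {σ} γ ρA ρB (γ' ++ ρ ∷ γ₂)
            (fits-flat (Pointwise-++ (rels-fits c' r') (l ∷ rels-fits c₂ r₂)))
            (proj₁ qB) (proj₁ qA) (≡-subst (SatΓ σ) (++-assoc γ (ρA ∷ ρB ∷ γ') _) s))

    -- A counter-element of `A ⅋ B` is a pair and splits into counter-elements for the premise. If
    -- `A ⅋ B` itself is produced, its two directions come from the premise by producing `B` and by
    -- producing `A`.
    sound-par : ∀ Γ A B {σ} → Sound (Γ ++ A ∷ B ∷ []) σ → Sound (Γ ++ (A ⅋ B) ∷ []) σ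
    sound-par Γ A B {σ} h Γ₁ F Γ₂ e c₁ c₂ with ∷-split Γ {Γ₁ = Γ₁} e
    ... | inj₁ (Γ' , refl , refl) with All-++⁻ˡ Γ' c₂ in eˡ | All-++⁻ʳ Γ' c₂ in eʳ
    ...   | c' | counter {Θ} {Q} s (ten {Θ₁} {Θ₂} {Q₁} {Q₂} p s₁ s₂ x y i) ∷ [] =
      sem-monotone F true
        (≡-subst₂ (λ x y → worlds c₁ ++ x ↭ worlds c₁ ++ y) (≡-sym (worlds-++ c' (cA ∷ cB ∷ [])))
          (trans (≡-sym (cong₂ (λ x y → worlds x ++ worlds y) eˡ eʳ)) (worlds-split Γ' c₂))
          (↭-trans (W.solve 4 (λ a b c d → a ⊕ (b ⊕ (c ⊕ (d ⊕ W.id))) ⊜ a ⊕ (b ⊕ (c ⊕ d))) ↭-refl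
                     (worlds c₁) (worlds c') Θ₁ Θ₂)
            (++⁺ˡ (worlds c₁) (++⁺ˡ (worlds c') (↭-trans p (↭-reflexive (≡-sym (++-identityʳ Θ))))))))
        incl
        (h Γ₁ F (Γ' ++ A ∷ B ∷ []) (++-assoc Γ₁ (F ∷ Γ') _) c₁ (All-++⁺ c' (cA ∷ cB ∷ [])))
      where
      cA : Counter A
      cA = counter s₁ x
      cB : Counter B
      cB = counter s₂ y
      incl : ∀ ζ ρ → length ρ ≡ size F → plug c₁ (All-++⁺ c' (cA ∷ cB ∷ [])) σ ζ ρ → plug c₁ c₂ σ ζ ρ
      incl ζ ρ l (γ₁ , γ₂ , r₁ , r₂ , sat) with rels-++⁻ c' (cA ∷ cB ∷ []) r₂
      ... | γ' , ρA ∷ ρB ∷ [] , refl , r' , ((lA , qA) , (lB , qB) , _) =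
        γ₁ , γ' ++ (ρB ++ ρA) ∷ [] , r₁ ,
        rels-join Γ' c₂ (≡-subst (λ c → rels c ζ γ') (≡-sym eˡ) r')
          (≡-subst (λ c → rels c ζ ((ρB ++ ρA) ∷ [])) (≡-sym eʳ)
            ((length-++-≡ ρB ρA {bndF B} lB lA ,
              ≡-subst (Q ζ) (≡-sym (reverse-++ ρB ρA))
                (i ζ (trans (length-reverse ρA) lA) (trans (length-reverse ρB) lB) qA qB)) , tt)) ,
        ≡-subst (SatΓ σ) (++-assoc γ₁ (ρ ∷ γ') _)
          (parR-sat {σ} (γ₁ ++ ρ ∷ γ') ρA ρB (≡-subst (SatΓ σ) (≡-sym (++-assoc γ₁ (ρ ∷ γ') _)) sat))
    sound-par Γ A B {σ} h Γ₁ F Γ₂ e c₁ [] | inj₂ ([] , refl , refl) = toB , toA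
      where
      cΓ = All-++⁻ˡ Γ c₁
      Γ≡ : worlds cΓ ≡ worlds c₁
      Γ≡ = trans (≡-sym (++-identityʳ (worlds cΓ))) (trans (cong (worlds cΓ ++_) (≡-sym (nil (All-++⁻ʳ Γ c₁)))) (worlds-split Γ c₁))
        where
        nil : (c : Counters []) → worlds c ≡ []
        nil [] = refl
      relsΓ : ∀ {ζ γ} → rels cΓ ζ γ → rels c₁ ζ γ
      relsΓ {ζ} {γ} r = ≡-subst (rels c₁ ζ) (++-identityʳ γ) (rels-join Γ c₁ r (nil (All-++⁻ʳ Γ c₁)))
        where
        nil : (c : Counters []) → rels c ζ []
        nil [] = tt
      toB : ∀ Θ' Q' → Supported Θ' Q' → sem A false Θ' Q' →
            sem B true ((worlds c₁ ++ []) ++ Θ') (feedˡ (size A) (plug c₁ [] σ) Q')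
      toB Θ' Q' s x = sem-monotone B true
        (≡-subst₂ (λ x y → x ++ [] ↭ (y ++ []) ++ Θ') (≡-sym (worlds-++ cΓ (cA ∷ []))) Γ≡
          (W.solve 2 (λ a b → (a ⊕ (b ⊕ W.id)) ⊕ W.id ⊜ (a ⊕ W.id) ⊕ b) ↭-refl (worlds cΓ) Θ'))
        incl
        (h (Γ ++ A ∷ []) B [] (≡-sym (++-assoc Γ (A ∷ []) _)) (All-++⁺ cΓ (cA ∷ [])) [])
        where
        cA : Counter A
        cA = counter s x
        incl : ∀ ζ ρ → length ρ ≡ size B → plug (All-++⁺ cΓ (cA ∷ [])) [] σ ζ ρ →
               feedˡ (size A) (plug c₁ [] σ) Q' ζ ρ
        incl ζ ρ l (γ₁ , [] , r₁ , _ , sat) with rels-++⁻ cΓ (cA ∷ []) r₁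
        ... | γ , ρA ∷ [] , refl , r , ((lA , qA) , _) =
          reverse ρA , trans (length-reverse ρA) lA , qA , γ , [] , relsΓ r , tt ,
          ≡-subst (λ v → SatΓ σ (γ ++ (ρ ++ v) ∷ [])) (≡-sym (reverse-involutive ρA))
            (parR-sat {σ} γ ρA ρ (≡-subst (SatΓ σ) (++-assoc γ (ρA ∷ []) _) sat))
      toA : ∀ Θ' Q' → Supported Θ' Q' → sem B false Θ' Q' →
            sem A true ((worlds c₁ ++ []) ++ Θ') (feedʳ (size B) (plug c₁ [] σ) Q')
      toA Θ' Q' s y = sem-monotone A true
        (≡-subst (λ y → worlds cΓ ++ (Θ' ++ []) ↭ (y ++ []) ++ Θ') Γ≡
          (W.solve 2 (λ a b → a ⊕ (b ⊕ W.id) ⊜ (a ⊕ W.id) ⊕ b) ↭-refl (worlds cΓ) Θ'))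
        incl
        (h Γ A (B ∷ []) refl cΓ (cB ∷ []))
        where
        cB : Counter B
        cB = counter s y
        incl : ∀ ζ ρ → length ρ ≡ size A → plug cΓ (cB ∷ []) σ ζ ρ → feedʳ (size B) (plug c₁ [] σ) Q' ζ ρ
        incl ζ ρ l (γ , ρB ∷ [] , r , ((lB , qB) , _) , sat) =
          reverse ρB , trans (length-reverse ρB) lB , qB , γ , [] , relsΓ r , tt ,
          ≡-subst (λ v → SatΓ σ (γ ++ (v ++ ρ) ∷ [])) (≡-sym (reverse-involutive ρB)) (parR-sat {σ} γ ρ ρB sat)
    sound-par Γ A B {σ} h Γ₁ F Γ₂ e c₁ c₂ | inj₂ (_ ∷ [] , refl , ())
    sound-par Γ A B {σ} h Γ₁ F Γ₂ e c₁ c₂ | inj₂ (_ ∷ _ ∷ _ , refl , ())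

    tenMW : List (Fm nLit) → Fm nLit → Fm nLit → MW T → MW T → MW T
    tenMW Δ A B σ₁ σ₂ =
      mw (mapE (tensR (length (bndCtx Δ)) (size A)) (edges σ₂) ++
          mapE (tensL (length (bndCtx Δ)) (size A) (size B)) (edges σ₁))
         (cycles σ₁ ++ cycles σ₂)

    -- A counter-element of `A ⊗ B` is a pair of functions. Fed with the element that one premise
    -- produces, it becomes a counter-element for the other premise, which then produces `F`.
    sound-ten : ∀ Γ A B Δ {σ₁ σ₂} → Sound (Γ ++ A ∷ []) σ₁ → Sound (B ∷ Δ) σ₂ →
                Sound (Γ ++ (A ⊗ B) ∷ Δ) (tenMW Δ A B σ₁ σ₂)
    sound-ten Γ A B Δ {σ₁} {σ₂} h₁ h₂ Γ₁ F Γ₂ e c₁ c₂ with ∷-split Γ {Γ₁ = Γ₁} e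
    ... | inj₁ (Γ' , refl , refl) with All-++⁻ˡ Γ' c₂ in eˡ | All-++⁻ʳ Γ' c₂ in eʳ
    ...   | c' | counter {Θ} {Q} s (_ , y) ∷ cΔ =
      sem-monotone F true
        (≡-subst₂ (λ x y → worlds c₁ ++ x ↭ worlds c₁ ++ y) (≡-sym (worlds-++ c' (cA ∷ [])))
          (trans (≡-sym (cong₂ (λ x y → worlds x ++ worlds y) eˡ eʳ)) (worlds-split Γ' c₂))
          (W.solve 4 (λ a b c d → a ⊕ (b ⊕ ((c ⊕ d) ⊕ W.id)) ⊜ a ⊕ (b ⊕ (c ⊕ d))) ↭-refl
            (worlds c₁) (worlds c') Θ (worlds cΔ)))
        incl
        (h₁ Γ₁ F (Γ' ++ A ∷ []) (++-assoc Γ₁ (F ∷ Γ') _) c₁ (All-++⁺ c' (cA ∷ [])))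
      where
      QB : Elem
      QB = plug [] cΔ σ₂
      cA : Counter A
      cA = counter {world = Θ ++ worlds cΔ} {feedʳ (size B) Q QB}
        (λ ag ρ (ρ' , l , q , r) → ρ' , l , plug-supported [] cΔ σ₂ (λ m → ag (∈-++⁺ʳ Θ m)) ρ' q , s (λ m → ag (∈-++⁺ˡ m)) _ r)
        (y (worlds cΔ) QB (plug-supported [] cΔ σ₂) (h₂ [] B Δ refl [] cΔ))
      incl : ∀ ζ ρ → length ρ ≡ size F → plug c₁ (All-++⁺ c' (cA ∷ [])) σ₁ ζ ρ → plug c₁ c₂ (tenMW Δ A B σ₁ σ₂) ζ ρ
      incl ζ ρ l (γ₁ , γ₂ , r₁ , r₂ , sat) with rels-++⁻ c' (cA ∷ []) r₂
      ... | γ' , ρA ∷ [] , refl , r' , ((lA , ρB , lB , ([] , δ , _ , rΔ , satB) , q) , _) =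
        γ₁ , γ' ++ (ρA ++ ρB) ∷ δ , r₁ ,
        rels-join Γ' c₂ (≡-subst (λ c → rels c ζ γ') (≡-sym eˡ) r')
          (≡-subst (λ c → rels c ζ ((ρA ++ ρB) ∷ δ)) (≡-sym eʳ)
            ((length-++-≡ ρA ρB {bndF A} lA lB , ≡-subst (Q ζ) (≡-sym (reverse-++ ρA ρB)) q) , rΔ)) ,
        ≡-subst (SatΓ (tenMW Δ A B σ₁ σ₂)) (++-assoc γ₁ (ρ ∷ γ') _)
          (tenR-sat {σ₁} {σ₂} {cs = []} (γ₁ ++ ρ ∷ γ') ρA ρB δ (fits-flat (rels-fits cΔ rΔ)) lA lB
            (≡-subst (SatΓ σ₁) (≡-sym (++-assoc γ₁ (ρ ∷ γ') _)) sat) satB)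
    sound-ten Γ A B Δ {σ₁} {σ₂} h₁ h₂ Γ₁ F Γ₂ e c₁ c₂ | inj₂ ([] , refl , refl) with All-++⁻ʳ Γ c₁ in eʳ
    ... | [] =
      ten (≡-subst (λ x → (worlds cΓ ++ []) ++ worlds c₂ ↭ x ++ worlds c₂)
            (trans (≡-sym (cong (λ x → worlds cΓ ++ worlds x) eʳ)) (worlds-split Γ c₁)) ↭-refl)
        (plug-supported cΓ [] σ₁) (plug-supported [] c₂ σ₂)
        (h₁ Γ A [] refl cΓ []) (h₂ [] B Δ refl [] c₂)
        incl
      where
      cΓ = All-++⁻ˡ Γ c₁
      incl : ∀ ζ {ρA ρB} → length ρA ≡ size A → length ρB ≡ size B → plug cΓ [] σ₁ ζ ρA → plug [] c₂ σ₂ ζ ρB →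
             plug c₁ c₂ (tenMW Δ A B σ₁ σ₂) ζ (ρA ++ ρB)
      incl ζ {ρA} {ρB} lA lB (γ , [] , r , _ , satA) ([] , δ , _ , rΔ , satB) =
        γ , δ , ≡-subst (rels c₁ ζ) (++-identityʳ γ) (rels-join Γ c₁ r (≡-subst (λ c → rels c ζ []) (≡-sym eʳ) tt)) , rΔ ,
        tenR-sat {σ₁} {σ₂} {cs = []} γ ρA ρB δ (fits-flat (rels-fits c₂ rΔ)) lA lB satA satB
    sound-ten Γ A B Δ {σ₁} {σ₂} h₁ h₂ Γ₁ F Γ₂ e c₁ c₂ | inj₂ (_ ∷ Γ' , refl , refl) with All-++⁻ʳ Γ c₁ in eʳ
    ... | counter {Θ} {Q} s (x , _) ∷ c' =
      sem-monotone F true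
        (≡-subst (λ y → ((Θ ++ (worlds cΓ ++ [])) ++ worlds c') ++ worlds c₂ ↭ y ++ worlds c₂)
          (trans (≡-sym (cong (λ x → worlds cΓ ++ worlds x) eʳ)) (worlds-split Γ c₁))
          (W.solve 4 (λ a b c d → ((b ⊕ (a ⊕ W.id)) ⊕ c) ⊕ d ⊜ (a ⊕ (b ⊕ c)) ⊕ d) ↭-refl
            (worlds cΓ) Θ (worlds c') (worlds c₂)))
        incl
        (h₂ (B ∷ Γ') F Γ₂ refl (cB ∷ c') c₂)
      where
      cΓ = All-++⁻ˡ Γ c₁
      QA : Elem
      QA = plug cΓ [] σ₁
      cB : Counter B
      cB = counter {world = Θ ++ (worlds cΓ ++ [])} {feedˡ (size A) Q QA}
        (λ ag ρ (ρ' , l , q , r) → ρ' , l , plug-supported cΓ [] σ₁ (λ m → ag (∈-++⁺ʳ Θ m)) ρ' q , s (λ m → ag (∈-++⁺ˡ m)) _ r)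
        (x (worlds cΓ ++ []) QA (plug-supported cΓ [] σ₁) (h₁ Γ A [] refl cΓ []))
      incl : ∀ ζ ρ → length ρ ≡ size F → plug (cB ∷ c') c₂ σ₂ ζ ρ → plug c₁ c₂ (tenMW Δ A B σ₁ σ₂) ζ ρ
      incl ζ ρ l (ρB ∷ γ' , γ₂ , ((lB , ρA , lA , (γ , [] , r , _ , satA) , q) , r') , r₂ , sat) =
        γ ++ (ρA ++ ρB) ∷ γ' , γ₂ ,
        rels-join Γ c₁ r (≡-subst (λ c → rels c ζ ((ρA ++ ρB) ∷ γ')) (≡-sym eʳ)
          ((length-++-≡ ρA ρB {bndF A} lA lB , ≡-subst (Q ζ) (≡-sym (reverse-++ ρA ρB)) q) , r')) , r₂ ,
        ≡-subst (SatΓ (tenMW Δ A B σ₁ σ₂)) (≡-sym (++-assoc γ ((ρA ++ ρB) ∷ γ') _))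
          (tenR-sat {σ₁} {σ₂} {cs = []} γ ρA ρB (γ' ++ ρ ∷ γ₂)
            (fits-flat (Pointwise-++ (rels-fits c' r') (l ∷ rels-fits c₂ r₂))) lA lB satA sat)

    -- An element of `dual A` is a counter-element of `A`, so what one premise produces is plugged
    -- straight into the other.
    sound-cut : ∀ Γ A Δ {σ₁ σ₂ τ cs} → Sound (Γ ++ A ∷ []) σ₁ → Sound (dual A ∷ Δ) σ₂ →
      Glue (mapE (cutR (length (bndCtx Δ)) (size A)) (edges σ₂) ++
            mapE (cutL (length (bndCtx Δ)) (size A)) (edges σ₁)) cs τ →
      Sound (Γ ++ Δ) τ
    sound-cut Γ A Δ {σ₁} {σ₂} {τ} h₁ h₂ g Γ₁ F Γ₂ e c₁ c₂ with ∷-split Γ {Γ₁ = Γ₁} e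
    ... | inj₁ (Γ' , refl , refl) =
      sem-monotone F true
        (≡-subst₂ (λ x y → worlds c₁ ++ x ↭ worlds c₁ ++ y) (≡-sym (worlds-++ c' (cA ∷ []))) (worlds-split Γ' c₂)
          (W.solve 3 (λ a b c → a ⊕ (b ⊕ (c ⊕ W.id)) ⊜ a ⊕ (b ⊕ c)) ↭-refl (worlds c₁) (worlds c') (worlds cΔ)))
        incl
        (h₁ Γ₁ F (Γ' ++ A ∷ []) (++-assoc Γ₁ (F ∷ Γ') _) c₁ (All-++⁺ c' (cA ∷ [])))
      where
      c' = All-++⁻ˡ Γ' c₂
      cΔ = All-++⁻ʳ Γ' c₂
      cA : Counter A
      cA = counter {world = worlds cΔ} {plug [] cΔ σ₂} (plug-supported [] cΔ σ₂)
        (≡-subst (λ P → P (worlds cΔ) (plug [] cΔ σ₂)) (sem-dual A true) (h₂ [] (dual A) Δ refl [] cΔ))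
      incl : ∀ ζ ρ → length ρ ≡ size F → plug c₁ (All-++⁺ c' (cA ∷ [])) σ₁ ζ ρ → plug c₁ c₂ τ ζ ρ
      incl ζ ρ l (γ₁ , γ₂ , r₁ , r₂ , sat) with rels-++⁻ c' (cA ∷ []) r₂
      ... | γ' , ρA ∷ [] , refl , r' , ((lA , [] , δ , _ , rΔ , sat') , _) =
        γ₁ , γ' ++ δ , r₁ , rels-join Γ' c₂ r' rΔ ,
        ≡-subst (SatΓ τ) (++-assoc γ₁ (ρ ∷ γ') δ)
          (cut-sat {σ₁} {σ₂} (γ₁ ++ ρ ∷ γ') ρA δ (fits-flat (rels-fits cΔ rΔ)) lA
            (≡-subst (SatΓ σ₁) (≡-sym (++-assoc γ₁ (ρ ∷ γ') _)) sat) sat' g)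
    ... | inj₂ (Γ' , refl , refl) =
      sem-monotone F true
        (≡-subst (λ y → ((worlds cΓ ++ []) ++ worlds c') ++ worlds c₂ ↭ y ++ worlds c₂) (worlds-split Γ c₁)
          (W.solve 3 (λ a b c → ((a ⊕ W.id) ⊕ b) ⊕ c ⊜ (a ⊕ b) ⊕ c) ↭-refl (worlds cΓ) (worlds c') (worlds c₂)))
        incl
        (h₂ (dual A ∷ Γ') F Γ₂ refl (cA ∷ c') c₂)
      where
      cΓ = All-++⁻ˡ Γ c₁
      c' = All-++⁻ʳ Γ c₁
      cA : Counter (dual A)
      cA = counter {world = worlds cΓ ++ []} {plug cΓ [] σ₁} (plug-supported cΓ [] σ₁)
        (≡-subst (λ P → P (worlds cΓ ++ []) (plug cΓ [] σ₁)) (≡-sym (sem-dual A false)) (h₁ Γ A [] refl cΓ []))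
      incl : ∀ ζ ρ → length ρ ≡ size F → plug (cA ∷ c') c₂ σ₂ ζ ρ → plug c₁ c₂ τ ζ ρ
      incl ζ ρ l (ρA ∷ γ' , γ₂ , ((lA , γ , [] , r , _ , sat') , r') , r₂ , sat) =
        γ ++ γ' , γ₂ , rels-join Γ c₁ r r' , r₂ ,
        ≡-subst (SatΓ τ) (≡-sym (++-assoc γ γ' (ρ ∷ γ₂)))
          (cut-sat {σ₁} {σ₂} γ (reverse ρA) (γ' ++ ρ ∷ γ₂)
            (fits-flat (Pointwise-++ (rels-fits c' r') (l ∷ rels-fits c₂ r₂)))
            (trans (length-reverse ρA) (trans lA (size-dual A)))
            sat' (≡-subst (λ v → SatΓ σ₂ (v ∷ γ' ++ ρ ∷ γ₂)) (≡-sym (reverse-involutive ρA)) sat) g)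

    soundness : ∀ {Lex} → (∀ {Γ σ v} → (Γ , σ , v) ∈ Lex → Sound Γ σ) → ∀ {Γ σ} → Derivable Lex Γ σ → Sound Γ σ
    soundness lex (lexR m) = lex m
    soundness lex (idR A) = sound-id A
    soundness lex (exR Γ A B Δ {σ} d) = sound-ex Γ A B Δ {σ} (soundness lex d)
    soundness lex (parR Γ A B {σ} d) = sound-par Γ A B {σ} (soundness lex d)
    soundness lex (tenR Γ A B Δ {σ₁} {σ₂} d₁ d₂) = sound-ten Γ A B Δ {σ₁} {σ₂} (soundness lex d₁) (soundness lex d₂)
    soundness lex (cut Γ A Δ {σ₁} {σ₂} d₁ d₂ g) = sound-cut Γ A Δ {σ₁} {σ₂} (soundness lex d₁) (soundness lex d₂) g

shift-closed : ∀ {At Con : Set} {𝔗 : Con → LTy At} {Γ t A c} → Typing 𝔗 Γ t A → length Γ ≤ c → shift c t ≡ t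
shift-closed (tvar o) l rewrite <⇒<ᵇ-true (≤-trans (only-bound o) l) = refl
shift-closed (tcon _) l = refl
shift-closed (tapp d d' m) l =
  cong₂ app (shift-closed d (≤-trans (≤-reflexive (proj₁ (merge-length m))) l))
            (shift-closed d' (≤-trans (≤-reflexive (proj₂ (merge-length m))) l))
shift-closed (tlam d) l = cong lam (shift-closed d (s≤s l))

fresh : ∀ {At} (Θ : World At) → Σ ℕ λ x → Fresh x Θ
fresh Θ = suc (bound Θ) , λ m → <-irrefl refl (s≤s (bounded Θ m))
  where
  bound : ∀ {At} → World At → ℕ
  bound []            = 0
  bound ((y , _) ∷ Θ) = y ⊔ bound Θ
  bounded : ∀ {At} (Θ : World At) {y A} → (y , A) ∈ Θ → y ≤ bound Θ
  bounded ((y , _) ∷ Θ) (here refl) = m≤m⊔n y (bound Θ)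
  bounded ((y , _) ∷ Θ) (there m) = ≤-trans (bounded Θ m) (m≤n⊔m y (bound Θ))

-- The grammar of a tree ACG.

module Translation {N : Set} {n : ℕ} (G : TreeACG N n) where
  open TreeACG G
  open Trees N n
  open Valuations T

  φ-closed : ∀ c → shift 0 (φCon c) ≡ φCon c
  φ-closed c = shift-closed (φTyped c) z≤n

  bnd : Fin nAt → Boundary
  bnd p = objB (φAt p)

  open LL nAt bnd T
  open Realizers 𝔗 φAt φCon φ-closed nAt bnd id (λ _ → refl)
  open Linear 𝔗 φCon φ-closed

  conWord : ∀ c → Σ (MW T) λ σ → Matches (obj (𝔗 c)) σ × cycles σ ≡ [] × (∀ κ → R κ (mapTy φAt (𝔗 c)) (Sat σ) (φCon c))
  conWord c = treeRealizer (φTyped c)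

  conMatches : ∀ c → Matches (bndCtx (tr (𝔗 c) ∷ [])) (proj₁ (conWord c))
  conMatches c = ≡-subst (λ X → Matches X (proj₁ (conWord c))) (≡-sym (bndF-tr (𝔗 c))) (proj₁ (proj₂ (conWord c)))

  entry : Fin nCon → LexEntry
  entry c = tr (𝔗 c) ∷ [] , proj₁ (conWord c) , matches⇒valid (conMatches c)

  Lex : List LexEntry
  Lex = map entry (allFin nCon)

  derivable-rules : Rules (Derivable Lex)
  derivable-rules = record { ruleId = idR ; ruleEx = exR ; rulePar = parR ; ruleTen = tenR ; ruleCut = cut }

  open Realize (Derivable Lex) derivable-rules tokKind tokNonEmpty

  realizeCon : ∀ c → Realizer (𝔗 c) (φCon c)
  realizeCon c =
    net (proj₁ (conWord c)) (lexR (∈-map⁺ entry (∈-allFin c))) (conMatches c) (proj₁ (proj₂ (proj₂ (conWord c)))) ,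
    proj₂ (proj₂ (proj₂ (conWord c)))

  realizer : ∀ {t A} → Typing 𝔗 [] t A → Realizer A (mapTm φCon t)
  realizer = realizeTyped realizeCon

  record Cell : Set₁ where
    constructor cell
    field
      cellRel  : Rel
      cellTerm : Obj
  open Cell

  open PhaseModel N n nAt bnd (Fin nAt) Cell hiding (size)

  Realizes : (ℕ → Cell) → ℕ × LTy (Fin nAt) → Set₁
  Realizes ζ (x , A) = R treeKind (mapTy φAt A) (cellRel (ζ x)) (cellTerm (ζ x))

  -- The term `e` is chosen before the environment `ζ`, so an element over the empty world contains
  -- an actual closed term.
  Good : LTy (Fin nAt) → Pred
  Good A Θ Q = Σ (Lin Θ A) λ e → ∀ ζ → All (Realizes ζ) Θ → R treeKind (mapTy φAt A) (Q ζ) (ev e (cellTerm ∘ ζ))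

  good-monotone : ∀ A → Monotone (length (obj A)) (Good A)
  good-monotone A p f (e , r) = lin-↭ p e , λ ζ ok →
    ≡-subst (R treeKind (mapTy φAt A) _) (≡-sym (ev-↭ p e (cellTerm ∘ ζ)))
      (R-mono treeKind (mapTy φAt A) (f ζ) (r ζ (All-resp-↭ (↭-sym p) ok)))

  good-shift : ∀ A → ShiftClosed (obj A) (Good A)
  good-shift A (e , r) = e , λ ζ ok → R-shift treeKind (mapTy φAt A) (r ζ ok)

  open Interpretation (λ P → Good (atom P)) (λ P → good-monotone (atom P)) (λ P → good-shift (atom P))

  -- A counter-element of `A ⊸ B` includes one of `B`, and so on down to the result literal, which
  -- has none.
  no-counter : ∀ A {Θ Q} → sem (tr A) false Θ Q → ⊥
  no-counter (atom _) (lift ())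
  no-counter (A ⊸ B) t = no-counter B (Ten.elem₂ t)

  length-dual-tr : ∀ A → length (bndF (dual (tr A))) ≡ length (obj A)
  length-dual-tr A = trans (length-dual (tr A)) (cong length (bndF-tr A))

  mutual
    -- As in normalisation by evaluation: `reify` at an arrow type applies the semantic function to
    -- a fresh variable, reifies the result and abstracts the variable, while `reflect` turns a term
    -- into the function that applies it.
    reflect : ∀ A {Θ Q} → Good A Θ Q → sem (tr A) true Θ Q
    reflect (atom _) g = g
    reflect (A ⊸ B) {Θ} {Q} (e , r) =
      (λ Θ' Q' s x → reflect B (applied Θ' Q' (reify A s (≡-subst (λ P → P Θ' Q') (sem-dual (tr A) false) x)))) ,
      -- The backward direction of the par would start from a counter-element of `B`.
      (λ _ _ _ y → ⊥-elim (no-counter B y))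
      where
      applied : ∀ Θ' Q' → Good A Θ' Q' → Good B (Θ ++ Θ') (feedˡ (length (bndF (dual (tr A)))) Q Q')
      applied Θ' Q' (e' , r') = lapp e e' ↭-refl , λ ζ ok →
        R-mono treeKind (mapTy φAt B) (λ ρ _ (ρ' , l , q) → ρ' , trans l (≡-sym (length-dual-tr A)) , q)
          (r ζ (All-++⁻ˡ Θ ok) _ _ (r' ζ (All-++⁻ʳ Θ ok)))

    reify : ∀ A {Θ Q} → Supported Θ Q → sem (tr A) true Θ Q → Good A Θ Q
    reify (atom _) s g = g
    reify (A ⊸ B) {Θ} {Q} s (f , _) = proj₁ abs , realizes
      where
      x = proj₁ (fresh Θ)
      Θx : World (Fin nAt)
      Θx = (x , A) ∷ []
      -- The generic argument is whatever relation the environment will assign to `x`.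
      Qx : Elem
      Qx ζ = cellRel (ζ x)
      a = length (bndF (dual (tr A)))
      sx : Supported Θx Qx
      sx ag ρ q = ≡-subst (λ c → cellRel c ρ) (ag (here refl)) q
      body : Good B (Θ ++ Θx) (feedˡ a Q Qx)
      body = reify B
        (λ ag ρ (ρ' , l , q' , q) → ρ' , l , sx (λ m → ag (∈-++⁺ʳ Θ m)) ρ' q' , s (λ m → ag (∈-++⁺ˡ m)) _ q)
        (f Θx Qx sx (≡-subst (λ P → P Θx Qx) (≡-sym (sem-dual (tr A) false))
          (reflect A (lvar , λ { ζ (r ∷ []) → r }))))
      e : Lin (Θ ++ Θx) B
      e = proj₁ body
      abs : Σ (Lin Θ (A ⊸ B)) (Abstracts x e)
      abs = abstraction e (++-comm Θ Θx)
      realizes : ∀ ζ → All (Realizes ζ) Θ →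
                 R treeKind (mapTy φAt (A ⊸ B)) (Q ζ) (ev (proj₁ abs) (cellTerm ∘ ζ))
      realizes ζ ok Q' M' r' =
        R-≈ treeKind (mapTy φAt B)
          (≈trans (≡⇒≈ (ev-cong e (λ {y} _ → term y)))
                  (≈sym (proj₂ abs (proj₂ (fresh Θ)) (cellTerm ∘ ζ) M')))
          -- Writing the given argument into the cell of `x` specialises the generic one. As `Q` is
          -- supported on `Θ` and `x` is fresh for it, `Q` does not see the update.
          (R-mono treeKind (mapTy φAt B)
            (λ ρ _ (ρ' , l , q' , q) → ρ' , trans l (length-dual-tr A) ,
               ≡-subst (λ c → cellRel c ρ') (upd-same ζ x c) q' , s same _ q)
            (proj₂ body ζ' (All-++⁺ (old Θ same ok) (≡-subst realizes-A (≡-sym (upd-same ζ x c)) r' ∷ []))))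
        where
        c = cell Q' M'
        ζ' = upd ζ x c
        realizes-A : Cell → Set₁
        realizes-A c = R treeKind (mapTy φAt A) (cellRel c) (cellTerm c)
        same : Agree Θ ζ' ζ
        same m = upd-other ζ {x} c (λ { refl → proj₂ (fresh Θ) m })
        old : ∀ Θ → Agree Θ ζ' ζ → All (Realizes ζ) Θ → All (Realizes ζ') Θ
        old [] ag [] = []
        old ((y , C) ∷ Θ) ag (r ∷ rs) =
          ≡-subst (λ c → R treeKind (mapTy φAt C) (cellRel c) (cellTerm c)) (≡-sym (ag (here refl))) r ∷
          old Θ (λ m → ag (there m)) rs
        term : ∀ y → cellTerm (ζ' y) ≡ upd (cellTerm ∘ ζ) x M' y
        term y with x ≡ᵇ y
        ... | true  = refl
        ... | false = refl

  sound-lex : ∀ {Γ σ v} → (Γ , σ , v) ∈ Lex → Sound Γ σ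
  sound-lex m with ∈-map⁻ entry m
  ... | c , _ , refl = go
    where
    go : Sound (tr (𝔗 c) ∷ []) (proj₁ (conWord c))
    go [] F [] refl [] [] =
      reflect (𝔗 c) (lcon c , λ ζ _ → R-mono treeKind (mapTy φAt (𝔗 c)) (λ ρ _ s → [] , [] , tt , tt , s)
        (proj₂ (proj₂ (proj₂ (conWord c))) treeKind))
    go (_ ∷ []) F Γ₂ ()
    go (_ ∷ _ ∷ _) F Γ₂ ()

  derived-term : ∀ {A σ} → Derivable Lex (pos A ∷ []) σ →
    Σ (Tm (Fin nCon)) λ t → Typing 𝔗 [] t (atom A) × R treeKind (φAt A) (Sat σ) (mapTm φCon t)
  derived-term {A} {σ} d with soundness sound-lex d [] (pos A) [] refl [] []
  ... | e , r with decompile e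
  ...   | t , d' , f = t , d' , ≡-subst (R treeKind (φAt A) (Sat σ)) (≡-sym (f _))
    -- The world is empty, so any environment will do.
    (R-mono treeKind (φAt A) (λ { ρ _ ([] , [] , _ , _ , s) → s }) (r (λ _ → cell (λ _ → ⊤) (var 0)) []))

  -- No number lies below the 0 at vertex 1, so this vertex is not a source and the edge runs from 0
  -- to 1. The empty continuation then leaves exactly the label.
  single-edge : ∀ {σ : MW T} {i j w x m} → edges σ ≡ (i , w , j) ∷ [] →
                Sat σ ((x , m) ∷ ([] , 0) ∷ []) → x ≡ w
  single-edge {mw _ _} {zero} {zero} refl (reads (_ , l) ∷ []) = ⊥-elim (<-irrefl refl l)
  single-edge {mw _ _} {zero} {suc zero} {w} refl (reads (e , _) ∷ []) = trans e (++-identityʳ w)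
  single-edge {mw _ _} {zero} {suc (suc j)} refl (() ∷ [])
  single-edge {mw _ _} {suc zero} {zero} refl (reads (_ , ()) ∷ [])
  single-edge {mw _ _} {suc zero} {suc zero} refl (reads (_ , ()) ∷ [])
  single-edge {mw _ _} {suc zero} {suc (suc j)} refl (() ∷ [])
  single-edge {mw _ _} {suc (suc i)} refl (() ∷ [])

  matches-single : ∀ {σ : MW T} → Matches (true ∷ false ∷ []) σ →
                   Σ ℕ λ i → Σ (List T) λ w → Σ ℕ λ j → edges σ ≡ (i , w , j) ∷ []
  matches-single {mw [] _} v with () ← ↭-singleton-inv (v true)
  matches-single {mw ((i , w , j) ∷ []) _} v = i , w , j , refl
  matches-single {mw (_ ∷ _ ∷ _) _} v with () ← ↭-singleton-inv (v true)

  grammar : φAt S ≡ atom tt → LLG T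
  grammar eq = record { nLit = nAt ; bnd = bnd ; Lex = Lex ; S' = S ; S'bnd = inj₁ (cong objB eq) }

  TreeWord : List T → Set
  TreeWord w = Σ (Tr N n) λ α → treeLang G α × (encode α ≡ w)

  grammar⇒tree : ∀ eq w → llgLang (grammar eq) w → TreeWord w
  grammar⇒tree eq w (σ , d , _ , i , j , e) with derived-term d
  ... | t , d' , r with ≡-subst (λ A → R treeKind A (Sat σ) (mapTm φCon t)) eq r
  ...   | lift (_ , (α , refl , p) , q) =
    α , (t , d' , ≈sym p) ,
    trans (≡-sym (++-identityʳ (encode α))) (single-edge {σ} e (proj₂ (q [] 0)))

  -- With `treeKind` the edge would be known only as the encoding of some tree whose term is
  -- βη-equal to that of `α`. With `tokKind` its word is read off from the denotation, which pins it
  -- to `encode α`.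
  tree⇒grammar : ∀ eq w → TreeWord w → llgLang (grammar eq) w
  tree⇒grammar eq _ (α , (t , d , p) , refl) =
    word r , derived r , acyclic r , label
      (≡-subst (λ A → R tokKind A (Sat (word r)) (mapTm φCon t)) eq (proj₂ (realizer d) tokKind))
      (matches-single {word r} (≡-subst (λ X → Matches X (word r)) (cong objB eq) (matches r)))
    where
    r : Net (tr (atom S) ∷ [])
    r = proj₁ (realizer d)
    label : R tokKind (atom tt) (Sat (word r)) (mapTm φCon t) →
            (Σ ℕ λ i → Σ (List T) λ w → Σ ℕ λ j → edges (word r) ≡ (i , w , j) ∷ []) →
            Σ ℕ λ i → Σ ℕ λ j → edges (word r) ≡ (i , encode α , j) ∷ []
    label (lift (w , k , q)) (i , w' , j , e) = i , j ,
      ≡-subst (λ v → edges (word r) ≡ (i , v , j) ∷ [])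
        (trans (≡-sym (single-edge {word r} e (proj₂ (q [] 0)))) (trans (++-identityʳ w) (tok-rho α (≈sym p) k))) e

  -- Covers a compound φ(S), where the boundary of the literal `S` need not be that of a single
  -- edge.
  emptyGrammar : LLG T
  emptyGrammar = record { nLit = 1 ; bnd = λ _ → true ∷ false ∷ [] ; Lex = [] ; S' = zero ; S'bnd = inj₁ refl }

  -- Derivations exist even without a lexicon, by identities and cuts. Interpreting the literal by
  -- the empty predicate shows that none of them ends in the literal alone.
  emptyGrammar-empty : ∀ w → llgLang emptyGrammar w → ⊥
  emptyGrammar-empty w (σ , d , _) = impossible (E.soundness (λ ()) d [] (pos zero) [] refl [] [])
    where
    module P = PhaseModel N n 1 (λ _ → true ∷ false ∷ []) ⊤ (Lift _ ⊤)
    ⊥₁ : Set₁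
    ⊥₁ = Lift _ ⊥
    impossible : ∀ {a} {A : Set a} → ⊥₁ → A
    impossible (lift ())
    module E = P.Interpretation (λ _ _ _ → ⊥₁) (λ _ _ _ → impossible) (λ _ → impossible)

  no-trees : ∀ {A B} → φAt S ≡ A ⊸ B → ∀ w → TreeWord w → ⊥
  no-trees eq w (α , (t , d , p) , _) =
    rho-not-arrow {Q = Sat (word (proj₁ (realizer d)))} α (≈sym p)
      (≡-subst (λ A → R tokKind A (Sat (word (proj₁ (realizer d)))) (mapTm φCon t)) eq (proj₂ (realizer d) tokKind))

  translation : Σ (LLG T) λ G' → (w : List T) → llgLang G' w ⇔ TreeWord w
  translation with φAt S in eq
  ... | atom tt = grammar eq , λ w → mk⇔ (grammar⇒tree eq w) (tree⇒grammar eq w)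
  ... | A ⊸ B   = emptyGrammar , λ w → mk⇔ (λ l → ⊥-elim (emptyGrammar-empty w l)) (λ t → ⊥-elim (no-trees eq w t))

mainTheorem3 : (m n : ℕ) (G : TreeACG (Fin m) n) →
    Σ (LLG (TSym (Fin m) n)) λ G' →
    (w : List (TSym (Fin m) n)) →
    llgLang G' w ⇔ (Σ (Tr (Fin m) n) λ α → treeLang G α × (encode α ≡ w))
mainTheorem3 m n G = Translation.translation G
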